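{- Let $q$ be a prime power and $m,n$ positive integers with $\max\{m,n\}>1$. Then $$|\mathrm{TSRI}(m,n;q)|\le \frac{|\operatorname{GL}_m(\mathbb{F}_q)|}{q^m-1}\,|\mathcal{I}(m;q)|\,q^{n-1}\quad\text{and}\quad |\mathrm{TSRP}(m,n;q)|\le \frac{|\operatorname{GL}_m(\mathbb{F}_q)|}{q^m-1}\,|\mathcal{P}(m;q)|\,q^{n-1}.$$
   Context: An $(m,n)$-TSR matrix over $\mathbb{F}_q$ is a matrix $T\in \operatorname{M}_{mn}(\mathbb{F}_q)$ which, viewed as an $n\times n$ array of $m\times m$ blocks, has $I_m$ in block positions $(i+1,i)$ for $1\le i\le n-1$, has last block column $(c_0B,\dots,c_{n-1}B)^{T}$ (top to bottom) for some $c_i\in\mathbb{F}_q$ and $B\in \operatorname{M}_m(\mathbb{F}_q)$, and all other blocks zero. $\mathrm{TSRI}(m,n;q)$ (resp. $\mathrm{TSRP}(m,n;q)$) is the set of such matrices whose characteristic polynomial is irreducible (resp. primitive) over $\mathbb{F}_q$. $\mathcal{I}(r;q)$ and $\mathcal{P}(r;q)$ denote the sets of monic irreducible, resp. primitive, polynomials of degree $r$ in $\mathbb{F}_q[X]$. -}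

module Defs where

open import Data.Nat as ℕ using (ℕ; zero; suc; _∸_; _^_)
open import Data.Fin as Fin using (Fin; toℕ; remQuot)
open import Data.Fin.Properties using () renaming (_≟_ to _≟ᶠ_)
open import Data.Vec as Vec using (Vec; []; _∷_; tabulate; lookup; removeAt)
open import Data.List as List using (List; []; _∷_; length)
open import Data.List.Membership.Propositional using (_∈_)
open import Data.List.Relation.Unary.All using (All)
open import Data.List.Relation.Unary.Unique.Propositional using (Unique)
open import Data.Product using (Σ; ∃; _×_; _,_; proj₁; proj₂)
open import Data.Sum using (_⊎_)
open import Relation.Nullary using (¬_; yes; no)
open import Relation.Binary.PropositionalEquality using (_≡_)
open import Algebra.Structures using (IsCommutativeRing)

Card : {A : Set} → (A → Set) → ℕ → Set
Card {A} P k = Σ (List A) λ L →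
  Unique L × All P L × (∀ x → P x → x ∈ L) × length L ≡ k

-- A finite field (equality is propositional equality); its size is q.
-- Every finite field has prime-power order, and F_q is unique up to
-- isomorphism, so quantifying over all such records is quantifying over
-- all F_q with q a prime power.

record FiniteField : Set₁ where
  field
    Carrier  : Set
    _+_ _*_  : Carrier → Carrier → Carrier
    -_       : Carrier → Carrier
    0# 1#    : Carrier
    isCommutativeRing : IsCommutativeRing _≡_ _+_ _*_ -_ 0# 1#
    0≢1      : ¬ (0# ≡ 1#)
    inverse  : (x : Carrier) → ¬ (x ≡ 0#) → Σ Carrier λ y → x * y ≡ 1#
    elements : List Carrier
    elements-unique   : Unique elements
    elements-complete : (x : Carrier) → x ∈ elements

  size : ℕ
  size = length elements

record RingOps (R : Set) : Set where
  field
    zeroR oneR : R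
    addR mulR  : R → R → R
    negR       : R → R

Matrix : Set → ℕ → Set
Matrix R k = Vec (Vec R k) k

module Det {R : Set} (ops : RingOps R) where
  open RingOps ops

  minor : ∀ {k} → Matrix R (suc k) → Fin (suc k) → Matrix R k
  minor (_ ∷ rows) j = Vec.map (λ row → removeAt row j) rows

  altSum : ∀ {k} → (Fin k → R) → R
  altSum {zero}  f = zeroR
  altSum {suc k} f = addR (f Fin.zero) (negR (altSum (λ j → f (Fin.suc j))))

  det : ∀ {k} → Matrix R k → R
  det {zero}  M = oneR
  det {suc k} M = altSum λ j → mulR (lookup (Vec.head M) j) (det (minor M j))

module _ (F : FiniteField) where
  open FiniteField F

  fieldOps : RingOps Carrier
  fieldOps = record { zeroR = 0# ; oneR = 1# ; addR = _+_ ; mulR = _*_ ; negR = -_ }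

  -- Polynomials over F as coefficient lists (constant term first);
  -- equality of polynomials is equality of all coefficients.
  Poly : Set
  Poly = List Carrier

  coeff : Poly → ℕ → Carrier
  coeff []       _       = 0#
  coeff (a ∷ p)  zero    = a
  coeff (a ∷ p)  (suc i) = coeff p i

  _≈ₚ_ : Poly → Poly → Set
  p ≈ₚ r = ∀ i → coeff p i ≡ coeff r i

  addP : Poly → Poly → Poly
  addP []       r        = r
  addP (a ∷ p)  []       = a ∷ p
  addP (a ∷ p)  (b ∷ r)  = (a + b) ∷ addP p r

  negP : Poly → Poly
  negP = List.map -_

  mulP : Poly → Poly → Poly
  mulP []      r = []
  mulP (a ∷ p) r = addP (List.map (a *_) r) (0# ∷ mulP p r)

  oneP : Poly
  oneP = 1# ∷ []

  polyOps : RingOps Poly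
  polyOps = record { zeroR = [] ; oneR = oneP ; addR = addP ; mulR = mulP ; negR = negP }

  xPowMinusOne : ℕ → Poly
  xPowMinusOne e = addP (List.replicate e 0# List.++ (1# ∷ [])) (negP oneP)

  _∣ₚ_ : Poly → Poly → Set
  f ∣ₚ g = Σ Poly λ h → mulP f h ≈ₚ g

  IsUnitP : Poly → Set
  IsUnitP g = Σ Poly λ h → mulP g h ≈ₚ oneP

  Irreducible : Poly → Set
  Irreducible f = ¬ IsUnitP f × ¬ (f ≈ₚ []) ×
    (∀ g h → f ≈ₚ mulP g h → IsUnitP g ⊎ IsUnitP h)

  Primitive : ℕ → Poly → Set
  Primitive r f = Irreducible f × f ∣ₚ xPowMinusOne (size ^ r ∸ 1) ×
    (∀ e → 1 ℕ.≤ e → e ℕ.< size ^ r ∸ 1 → ¬ (f ∣ₚ xPowMinusOne e))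

  monic : ∀ {r} → Vec Carrier r → Poly
  monic v = Vec.toList v List.++ (1# ∷ [])

  Irr : (r : ℕ) → Vec Carrier r → Set
  Irr r v = Irreducible (monic v)

  Prim : (r : ℕ) → Vec Carrier r → Set
  Prim r v = Primitive r (monic v)

  detF : ∀ {k} → Matrix Carrier k → Carrier
  detF = Det.det fieldOps

  GL : (m : ℕ) → Matrix Carrier m → Set
  GL m A = ¬ (detF A ≡ 0#)

  charPoly : ∀ {k} → Matrix Carrier k → Poly
  charPoly {k} T = Det.det polyOps (tabulate λ r → tabulate λ s →
    let t = - lookup (lookup T r) s in
    diagEntry r s t)
    where
    diagEntry : Fin k → Fin k → Carrier → Poly
    diagEntry r s t with r ≟ᶠ s
    ... | yes _ = t ∷ 1# ∷ []
    ... | no  _ = t ∷ []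

  -- the (m,n)-TSR matrix with coefficients c = (c_0,…,c_{n-1}) and block B,
  -- of size (n*m) × (n*m), viewed as an n × n array of m × m blocks
  tsr : (m n : ℕ) → Vec Carrier n → Matrix Carrier m → Matrix Carrier (n ℕ.* m)
  tsr m n c B = tabulate λ r → tabulate λ s →
    entry (remQuot {n} m r) (remQuot {n} m s)
    where
    entry : Fin n × Fin m → Fin n × Fin m → Carrier
    entry (i , a) (j , b) with toℕ j ℕ.≟ (n ∸ 1)
    ... | yes _ = lookup c i * lookup (lookup B a) b
    ... | no  _ with toℕ i ℕ.≟ suc (toℕ j)
    ...   | no  _ = 0#
    ...   | yes _ with a ≟ᶠ b
    ...     | yes _ = 1#
    ...     | no  _ = 0#

  IsTSR : (m n : ℕ) → Matrix Carrier (n ℕ.* m) → Set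
  IsTSR m n T = Σ (Vec Carrier n) λ c → Σ (Matrix Carrier m) λ B → T ≡ tsr m n c B

  TSRI : (m n : ℕ) → Matrix Carrier (n ℕ.* m) → Set
  TSRI m n T = IsTSR m n T × Irreducible (charPoly T)

  TSRP : (m n : ℕ) → Matrix Carrier (n ℕ.* m) → Set
  TSRP m n T = IsTSR m n T × Primitive (n ℕ.* m) (charPoly T)

{-# OPTIONS --safe #-}
-- Row vectors split into n blocks of length m, and on them a TSR matrix T with data (c , B) acts
-- as the shift register (x₁ … xₙ) ↦ (x₂ … xₙ , (Σ cᵢ xᵢ) B).  If the characteristic polynomial of T
-- is irreducible, every nonzero vector generates the whole space under T; a small B-invariant
-- subspace W would give the T-invariant subspace Wⁿ, so B has irreducible characteristic polynomial
-- too, and c₀ ≢ 0 may be scaled to any nonzero constant.  The number of B with irreducible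
-- characteristic polynomial is bounded by sending (B , v), v ≢ 0, to that polynomial and to the
-- invertible matrix with rows v , vB , … , vB^(m-1), from which B and v can be recovered.
-- For primitivity, T generates the field K = F[T] with q^(mn) elements, which contains L = F[B] with
-- Q = q^m elements.  T is a root of Yⁿ − B (c₀ + … + cₙ₋₁ Yⁿ⁻¹) over L, whose other roots are the
-- conjugates T^(Q^j), so (−1)ⁿ⁺¹ c₀ B = T^(1+Q+…+Q^(n-1)) and B is primitive once c₀ = (−1)ⁿ⁺¹.
module Submission where

open import Defs
open import Level using (0ℓ)
open import Algebra.Bundles using (CommutativeRing; CommutativeMonoid)
import Algebra.Properties.AbelianGroup
import Algebra.Properties.CommutativeMonoid.Sum
import Algebra.Properties.CommutativeSemiring.Exp
import Algebra.Properties.Ring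
import Algebra.Properties.Semiring.Exp
import Algebra.Properties.Semiring.Mult
import Algebra.Properties.Semiring.Sum
import Algebra.Solver.Ring
import Algebra.Solver.Ring.AlmostCommutativeRing as ACR
open import Data.Fin as Fin using (Fin; zero; suc; toℕ; inject₁; fromℕ; punchIn; punchOut; remQuot; _↑ˡ_; _↑ʳ_)
import Data.Fin.Properties as Finₚ
open import Data.Fin.Relation.Unary.Top using (view; ‵fromℕ; ‵inject₁)
open import Data.Integer as ℤ using (ℤ; -[1+_])
import Data.Integer.Properties as ℤₚ
open import Data.List as List using (List; []; _∷_; length)
import Data.List.Properties as Listₚ
open import Data.List.Membership.Propositional using (_∈_; find; lose)
import Data.List.Membership.Propositional.Properties as ∈ₚ
open import Data.List.Relation.Binary.Permutation.Propositional as ↭ using (_↭_)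
import Data.List.Relation.Binary.Permutation.Propositional.Properties as ↭ₚ
open import Data.List.Relation.Unary.All as All using (All; []; _∷_)
import Data.List.Relation.Unary.All.Properties as Allₚ
open import Data.List.Relation.Unary.AllPairs as AllPairs using (AllPairs; []; _∷_)
import Data.List.Relation.Unary.AllPairs.Properties as AllPairsₚ
open import Data.List.Relation.Unary.Any as Any using (here; there)
import Data.List.Relation.Unary.Any.Properties as Anyₚ
open import Data.List.Relation.Unary.Unique.Propositional using (Unique)
import Data.List.Relation.Unary.Unique.Propositional.Properties as Uniqueₚ
open import Data.Maybe using (Maybe; just; nothing)
open import Data.Nat as ℕ using (ℕ; zero; suc; _∸_)
import Data.Nat.Properties as ℕₚ
import Data.Nat.Solver
open import Data.Product using (Σ; ∃; _×_; _,_; proj₁; proj₂)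
import Data.Sign as Sign
open import Data.Sum using (_⊎_; inj₁; inj₂)
open import Data.Unit using (⊤; tt)
open import Data.Vec as Vec using (Vec; []; _∷_; lookup; tabulate)
import Data.Vec.Properties as Vecₚ
open import Data.Vec.Relation.Unary.All using ([]; _∷_) renaming (All to Allᵛ)
open import Function using (_∘_; case_of_)
open import Relation.Binary.Definitions using (DecidableEquality)
open import Relation.Binary.PropositionalEquality as ≡ using (_≡_; _≢_)
import Relation.Binary.Reasoning.Setoid
open import Relation.Nullary using (¬_; yes; no; contradiction)
open import Relation.Nullary.Decidable using (_×-dec_; ¬?; decidable-stable)

-- The quotient by q^m - 1 becomes a count of pairs (T , v) with v a nonzero row vector of length m.
-- T depends on c and B only through the products cᵢ B, so prescribing c₀ loses no matrix and leaves
-- n - 1 free coefficients, whence q^(n-1). Finiteness replaces structure theory: dimensions are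
-- compared by counting vectors, an element of F[T] is a polynomial known by its action on one
-- generating state, and polynomials over F[T] occur only as functions in Horner form. The Frobenius
-- map y ↦ y^Q is needed, but neither the characteristic nor binomial coefficients are: its
-- additivity follows because any two monic functions of degree Q that vanish on the Q elements of L
-- agree everywhere. The norm formula needs n distinct conjugates T^(Q^j). Primitivity supplies
-- them, since a coincidence would give T an order at most Q^j - Q^i, which is below q^(mn) - 1.
-- With E = 1 + Q + ... + Q^(n-1) one has E (Q - 1) = q^(mn) - 1, so B = T^E turns an order q^(mn) -
-- 1 of T into an order Q - 1 of B.

-- Counting with lists.

∈-skip : {A : Set} {x y : A} (xs {ys} : List A) →
  x ∈ xs List.++ y ∷ ys → x ≢ y → x ∈ xs List.++ ys
∈-skip []       (here p)  x≢y = contradiction p x≢y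
∈-skip []       (there p) x≢y = p
∈-skip (_ ∷ xs) (here p)  x≢y = here p
∈-skip (_ ∷ xs) (there p) x≢y = there (∈-skip xs p x≢y)

-- Each element of `xs` uses up one occurrence of its partner in `ys`, which no other element can
-- share. A relation serves for injections, for surjections read backwards, and for encodings that
-- carry an existential witness.
length-≤ : {A B : Set} (R : A → B → Set) →
  (∀ {x x′ y} → R x y → R x′ y → x ≡ x′) →
  ∀ {xs ys} → Unique xs → (∀ {x} → x ∈ xs → ∃ λ y → y ∈ ys × R x y) →
  length xs ℕ.≤ length ys
length-≤ R inj {[]} _ _ = ℕ.z≤n
length-≤ R inj {x ∷ xs} (x∉ ∷ uniq) total with total (here ≡.refl)
... | y , y∈ys , Rxy with ∈ₚ.∈-∃++ y∈ys
... | as , bs , ≡.refl =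
  ℕₚ.≤-trans (ℕ.s≤s (length-≤ R inj uniq rest)) (ℕₚ.≤-reflexive count)
  where
  rest : ∀ {x′} → x′ ∈ xs → ∃ λ y′ → y′ ∈ as List.++ bs × R x′ y′
  rest x′∈ with total (there x′∈)
  ... | y′ , y′∈ , Rx′y′ = y′ , ∈-skip as y′∈ differs , Rx′y′
    where
    differs : y′ ≢ y
    differs ≡.refl = All.lookup x∉ x′∈ (inj Rxy Rx′y′)
  count : suc (length (as List.++ bs)) ≡ length (as List.++ y ∷ bs)
  count = ≡.trans (≡.cong suc (Listₚ.length-++ as))
    (≡.trans (≡.sym (ℕₚ.+-suc (length as) (length bs))) (≡.sym (Listₚ.length-++ as)))

-- A missed value could be put in front of `List.map f xs`, giving more distinct elements than `ys`
-- has room for. This takes the place of a comparison of dimensions.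
surjective-onto : {A B : Set} → DecidableEquality B → (f : A → B) →
  (∀ {x x′} → f x ≡ f x′ → x ≡ x′) →
  ∀ {xs ys} → Unique xs → (∀ x → f x ∈ ys) → length ys ℕ.≤ length xs →
  ∀ {y} → y ∈ ys → ∃ λ x → f x ≡ y
surjective-onto _≟_ f inj {xs} {ys} uniq into ys≤xs {y} y∈ with Any.any? (λ x → f x ≟ y) xs
... | yes hit = let x , _ , fx≡y = find hit in x , fx≡y
... | no miss = contradiction
  (ℕₚ.≤-trans
    (length-≤ _≡_ (λ p q → ≡.trans p (≡.sym q)) unique′ (λ {z} z∈ → z , sub z∈ , ≡.refl))
    ys≤xs)
  (ℕₚ.<⇒≱ (ℕ.s≤s (ℕₚ.≤-reflexive (≡.sym (Listₚ.length-map f xs)))))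
  where
  y∉ : All (y ≢_) (List.map f xs)
  y∉ = All.tabulate λ z∈ y≡z → let x , x∈ , z≡fx = ∈ₚ.∈-map⁻ f z∈ in
    miss (lose x∈ (≡.sym (≡.trans y≡z z≡fx)))
  unique′ : Unique (y ∷ List.map f xs)
  unique′ = y∉ ∷ Uniqueₚ.map⁺ inj uniq
  sub : ∀ {z} → z ∈ y ∷ List.map f xs → z ∈ ys
  sub (here ≡.refl) = y∈
  sub (there z∈) with ∈ₚ.∈-map⁻ f z∈
  ... | x , _ , ≡.refl = into x

length-cartesianProductWith : {A B C : Set} (f : A → B → C) (xs : List A) (ys : List B) →
  length (List.cartesianProductWith f xs ys) ≡ length xs ℕ.* length ys
length-cartesianProductWith f []       ys = ≡.refl
length-cartesianProductWith f (x ∷ xs) ys = ≡.trans (Listₚ.length-++ (List.map (f x) ys))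
  (≡.cong₂ ℕ._+_ (Listₚ.length-map (f x) ys) (length-cartesianProductWith f xs ys))

allVecs : {A : Set} → List A → (k : ℕ) → List (Vec A k)
allVecs xs zero    = [] ∷ []
allVecs xs (suc k) = List.cartesianProductWith _∷_ xs (allVecs xs k)

allVecs-unique : {A : Set} {xs : List A} → Unique xs → ∀ k → Unique (allVecs xs k)
allVecs-unique uniq zero    = [] ∷ []
allVecs-unique uniq (suc k) =
  Uniqueₚ.cartesianProductWith⁺ _∷_ (λ { ≡.refl → ≡.refl , ≡.refl }) uniq (allVecs-unique uniq k)

allVecs-complete : {A : Set} {xs : List A} → (∀ x → x ∈ xs) →
  ∀ {k} (v : Vec A k) → v ∈ allVecs xs k
allVecs-complete all []      = here ≡.refl
allVecs-complete all (x ∷ v) = ∈ₚ.∈-cartesianProductWith⁺ _∷_ (all x) (allVecs-complete all v)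

length-allVecs : {A : Set} (xs : List A) (k : ℕ) → length (allVecs xs k) ≡ length xs ℕ.^ k
length-allVecs xs zero    = ≡.refl
length-allVecs xs (suc k) = ≡.trans (length-cartesianProductWith _∷_ xs (allVecs xs k))
  (≡.cong (length xs ℕ.*_) (length-allVecs xs k))

-- Solving ring equations.

-- The library's ring solvers need decidable equality to compare
-- coefficients; integer coefficients provide it over any commutative ring.
module ℤ-Solver (R : CommutativeRing 0ℓ 0ℓ) where
  open CommutativeRing R
  open Algebra.Properties.Ring ring
  open Algebra.Properties.AbelianGroup +-abelianGroup using (⁻¹-∙-comm; ⁻¹-involutive; ε⁻¹≈ε)
  open Algebra.Properties.Semiring.Mult semiring using (×-homo-+; ×1-homo-*) renaming (_×_ to _×ⁿ_)
  open Relation.Binary.Reasoning.Setoid setoid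

  ⟦_⟧ᶻ : ℤ → Carrier
  ⟦ ℤ.+ n ⟧ᶻ      = n ×ⁿ 1#
  ⟦ -[1+ n ] ⟧ᶻ = - (suc n ×ⁿ 1#)

  cancel-1+ : ∀ x y → (1# + x) + - (1# + y) ≈ x + - y
  cancel-1+ x y = begin
    (1# + x) + - (1# + y)        ≈⟨ +-cong (+-comm 1# x) (sym (⁻¹-∙-comm 1# y)) ⟩
    (x + 1#) + (- 1# + - y)      ≈⟨ +-assoc x 1# _ ⟩
    x + (1# + (- 1# + - y))      ≈⟨ +-congˡ (sym (+-assoc 1# (- 1#) (- y))) ⟩
    x + ((1# + - 1#) + - y)      ≈⟨ +-congˡ (+-congʳ (-‿inverseʳ 1#)) ⟩
    x + (0# + - y)               ≈⟨ +-congˡ (+-identityˡ (- y)) ⟩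
    x + - y                      ∎

  ⊖-homo : ∀ m n → ⟦ m ℤ.⊖ n ⟧ᶻ ≈ m ×ⁿ 1# + - (n ×ⁿ 1#)
  ⊖-homo zero    zero    = sym (-‿inverseʳ 0#)
  ⊖-homo zero    (suc n) = sym (+-identityˡ _)
  ⊖-homo (suc m) zero    = sym (trans (+-congˡ ε⁻¹≈ε) (+-identityʳ _))
  ⊖-homo (suc m) (suc n) = begin
    ⟦ suc m ℤ.⊖ suc n ⟧ᶻ            ≡⟨ ≡.cong ⟦_⟧ᶻ (ℤₚ.[1+m]⊖[1+n]≡m⊖n m n) ⟩
    ⟦ m ℤ.⊖ n ⟧ᶻ                    ≈⟨ ⊖-homo m n ⟩
    m ×ⁿ 1# + - (n ×ⁿ 1#)             ≈⟨ sym (cancel-1+ _ _) ⟩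
    suc m ×ⁿ 1# + - (suc n ×ⁿ 1#)     ∎

  -‿homo : ∀ i → ⟦ ℤ.- i ⟧ᶻ ≈ - ⟦ i ⟧ᶻ
  -‿homo (ℤ.+ zero)  = sym ε⁻¹≈ε
  -‿homo (ℤ.+ suc n) = refl
  -‿homo -[1+ n ]  = sym (⁻¹-involutive _)

  +-homo : ∀ i j → ⟦ i ℤ.+ j ⟧ᶻ ≈ ⟦ i ⟧ᶻ + ⟦ j ⟧ᶻ
  +-homo (ℤ.+ m)    (ℤ.+ n)    = ×-homo-+ 1# m n
  +-homo (ℤ.+ m)    -[1+ n ] = ⊖-homo m (suc n)
  +-homo -[1+ m ] (ℤ.+ n)    = trans (⊖-homo n (suc m)) (+-comm _ _)
  +-homo -[1+ m ] -[1+ n ] = begin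
    - (suc (suc (m ℕ.+ n)) ×ⁿ 1#)              ≡⟨ ≡.cong (λ k → - (k ×ⁿ 1#)) (≡.cong suc (≡.sym (ℕₚ.+-suc m n))) ⟩
    - ((suc m ℕ.+ suc n) ×ⁿ 1#)                ≈⟨ -‿cong (×-homo-+ 1# (suc m) (suc n)) ⟩
    - (suc m ×ⁿ 1# + suc n ×ⁿ 1#)               ≈⟨ sym (⁻¹-∙-comm _ _) ⟩
    - (suc m ×ⁿ 1#) + - (suc n ×ⁿ 1#)           ∎

  *-homo : ∀ i j → ⟦ i ℤ.* j ⟧ᶻ ≈ ⟦ i ⟧ᶻ * ⟦ j ⟧ᶻ
  *-homo (ℤ.+ m) (ℤ.+ n) = begin
    ⟦ Sign.+ ℤ.◃ (m ℕ.* n) ⟧ᶻ  ≡⟨ ≡.cong ⟦_⟧ᶻ (ℤₚ.+◃n≡+n (m ℕ.* n)) ⟩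
    (m ℕ.* n) ×ⁿ 1#             ≈⟨ ×1-homo-* m n ⟩
    m ×ⁿ 1# * (n ×ⁿ 1#)          ∎
  *-homo (ℤ.+ m) -[1+ n ] = begin
    ⟦ Sign.- ℤ.◃ (m ℕ.* suc n) ⟧ᶻ  ≡⟨ ≡.cong ⟦_⟧ᶻ (ℤₚ.-◃n≡-n (m ℕ.* suc n)) ⟩
    ⟦ ℤ.- (ℤ.+ (m ℕ.* suc n)) ⟧ᶻ     ≈⟨ -‿homo (ℤ.+ (m ℕ.* suc n)) ⟩
    - ((m ℕ.* suc n) ×ⁿ 1#)         ≈⟨ -‿cong (×1-homo-* m (suc n)) ⟩
    - (m ×ⁿ 1# * (suc n ×ⁿ 1#))      ≈⟨ -‿distribʳ-* _ _ ⟩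
    m ×ⁿ 1# * - (suc n ×ⁿ 1#)        ∎
  *-homo -[1+ m ] (ℤ.+ n) = begin
    ⟦ Sign.- ℤ.◃ (suc m ℕ.* n) ⟧ᶻ  ≡⟨ ≡.cong ⟦_⟧ᶻ (ℤₚ.-◃n≡-n (suc m ℕ.* n)) ⟩
    ⟦ ℤ.- (ℤ.+ (suc m ℕ.* n)) ⟧ᶻ     ≈⟨ -‿homo (ℤ.+ (suc m ℕ.* n)) ⟩
    - ((suc m ℕ.* n) ×ⁿ 1#)         ≈⟨ -‿cong (×1-homo-* (suc m) n) ⟩
    - (suc m ×ⁿ 1# * (n ×ⁿ 1#))      ≈⟨ -‿distribˡ-* _ _ ⟩
    - (suc m ×ⁿ 1#) * (n ×ⁿ 1#)      ∎
  *-homo -[1+ m ] -[1+ n ] = begin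
    ⟦ Sign.+ ℤ.◃ (suc m ℕ.* suc n) ⟧ᶻ  ≡⟨ ≡.cong ⟦_⟧ᶻ (ℤₚ.+◃n≡+n (suc m ℕ.* suc n)) ⟩
    (suc m ℕ.* suc n) ×ⁿ 1#             ≈⟨ ×1-homo-* (suc m) (suc n) ⟩
    suc m ×ⁿ 1# * (suc n ×ⁿ 1#)          ≈⟨ sym (⁻¹-involutive _) ⟩
    - - (suc m ×ⁿ 1# * (suc n ×ⁿ 1#))    ≈⟨ -‿cong (-‿distribˡ-* _ _) ⟩
    - (- (suc m ×ⁿ 1#) * (suc n ×ⁿ 1#))  ≈⟨ -‿distribʳ-* _ _ ⟩
    - (suc m ×ⁿ 1#) * - (suc n ×ⁿ 1#)    ∎

  ⟦⟧ᶻ-morphism : ℤ.+-*-rawRing ACR.-Raw-AlmostCommutative⟶ ACR.fromCommutativeRing R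
  ⟦⟧ᶻ-morphism = record
    { ⟦_⟧    = ⟦_⟧ᶻ
    ; +-homo = +-homo
    ; *-homo = *-homo
    ; -‿homo = -‿homo
    ; 0-homo = refl
    ; 1-homo = +-identityʳ 1#
    }

  _coeff≟_ : ∀ i j → Maybe (⟦ i ⟧ᶻ ≈ ⟦ j ⟧ᶻ)
  i coeff≟ j with i ℤ.≟ j
  ... | yes i≡j = just (reflexive (≡.cong ⟦_⟧ᶻ i≡j))
  ... | no  _   = nothing

  open Algebra.Solver.Ring ℤ.+-*-rawRing (ACR.fromCommutativeRing R) ⟦⟧ᶻ-morphism _coeff≟_ public
    using (solve; con; _:+_; _:*_; _:-_; :-_; _:=_)

-- Determinants over a commutative ring.

-- The transposition of the neighbours `inject₁ i` and `suc i`.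
swap : ∀ {k} → Fin k → Fin (suc k) → Fin (suc k)
swap zero    zero          = suc zero
swap zero    (suc zero)    = zero
swap zero    (suc (suc c)) = suc (suc c)
swap (suc i) zero          = zero
swap (suc i) (suc c)       = suc (swap i c)

swap-inject₁ : ∀ {k} (i : Fin k) → swap i (inject₁ i) ≡ suc i
swap-inject₁ zero    = ≡.refl
swap-inject₁ (suc i) = ≡.cong suc (swap-inject₁ i)

swap-suc : ∀ {k} (i : Fin k) → swap i (suc i) ≡ inject₁ i
swap-suc zero    = ≡.refl
swap-suc (suc i) = ≡.cong suc (swap-suc i)

swap-other : ∀ {k} (i : Fin k) {c} → c ≢ inject₁ i → c ≢ suc i → swap i c ≡ c
swap-other zero    {zero}        c≢ _  = contradiction ≡.refl c≢
swap-other zero    {suc zero}    _  c≢ = contradiction ≡.refl c≢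
swap-other zero    {suc (suc c)} _  _  = ≡.refl
swap-other (suc i) {zero}        _  _  = ≡.refl
swap-other (suc i) {suc c}       p  q  = ≡.cong suc (swap-other i (p ∘ ≡.cong suc) (q ∘ ≡.cong suc))

-- Since the pair is adjacent, the two minors that delete one of its columns change places under the
-- swap without any reordering of the remaining columns.
swap-punchIn-inject₁ : ∀ {k} (i : Fin k) c → swap i (punchIn (inject₁ i) c) ≡ punchIn (suc i) c
swap-punchIn-inject₁ zero    zero    = ≡.refl
swap-punchIn-inject₁ zero    (suc c) = ≡.refl
swap-punchIn-inject₁ (suc i) zero    = ≡.refl
swap-punchIn-inject₁ (suc i) (suc c) = ≡.cong suc (swap-punchIn-inject₁ i c)

swap-punchIn-suc : ∀ {k} (i : Fin k) c → swap i (punchIn (suc i) c) ≡ punchIn (inject₁ i) c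
swap-punchIn-suc zero    zero    = ≡.refl
swap-punchIn-suc zero    (suc c) = ≡.refl
swap-punchIn-suc (suc i) zero    = ≡.refl
swap-punchIn-suc (suc i) (suc c) = ≡.cong suc (swap-punchIn-suc i c)

-- Deleting an index `j` outside a pair of neighbours leaves them neighbours, now at position
-- `index`. Column operations on adjacent columns therefore pass to minors, and induction applies.
record AdjacentIn {k} (j : Fin (suc (suc k))) (i : Fin (suc k)) : Set where
  field
    index : Fin k
    left  : punchIn j (inject₁ index) ≡ inject₁ i
    right : punchIn j (suc index) ≡ suc i
    swaps : ∀ c → swap i (punchIn j c) ≡ punchIn j (swap index c)

adjacentIn : ∀ {k} (j : Fin (suc (suc k))) (i : Fin (suc k)) →
  j ≢ inject₁ i → j ≢ suc i → AdjacentIn j i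
adjacentIn zero zero p q = contradiction ≡.refl p
adjacentIn (suc zero) zero p q = contradiction ≡.refl q
adjacentIn {suc k} (suc (suc j)) zero p q = record
  { index = zero ; left = ≡.refl ; right = ≡.refl
  ; swaps = λ { zero → ≡.refl ; (suc zero) → ≡.refl ; (suc (suc c)) → ≡.refl } }
adjacentIn zero (suc i) p q = record
  { index = i ; left = ≡.refl ; right = ≡.refl ; swaps = λ _ → ≡.refl }
adjacentIn {suc k} (suc j) (suc i) p q = record
  { index = suc index ; left = ≡.cong suc left ; right = ≡.cong suc right
  ; swaps = λ { zero → ≡.refl ; (suc c) → ≡.cong suc (swaps c) } }
  where open AdjacentIn (adjacentIn j i (p ∘ ≡.cong suc) (q ∘ ≡.cong suc))

lookup-removeAt : ∀ {A : Set} {k} (xs : Vec A (suc k)) (j : Fin (suc k)) c →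
  lookup (Vec.removeAt xs j) c ≡ lookup xs (punchIn j c)
lookup-removeAt (x ∷ xs)     zero    c       = ≡.refl
lookup-removeAt (x ∷ y ∷ xs) (suc j) zero    = ≡.refl
lookup-removeAt (x ∷ y ∷ xs) (suc j) (suc c) = lookup-removeAt (y ∷ xs) j c

-- Matrices are functions of a row and a column index, so that the column
-- operations below are compositions with maps of the column index.
module Determinant (R : CommutativeRing 0ℓ 0ℓ) where
  open CommutativeRing R hiding (zero)
  open Algebra.Properties.Ring ring
  open Algebra.Properties.Semiring.Sum semiring using (sum; sum-cong-≋) public
  open Relation.Binary.Reasoning.Setoid setoid
  open ℤ-Solver R

  ringOps : RingOps Carrier
  ringOps = record { zeroR = 0# ; oneR = 1# ; addR = _+_ ; mulR = _*_ ; negR = -_ }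

  open Det ringOps using (altSum)

  Mat : ℕ → Set
  Mat k = Fin k → Fin k → Carrier

  minor : ∀ {k} → Mat (suc k) → Fin (suc k) → Mat k
  minor M j r c = M (suc r) (punchIn j c)

  det : ∀ {k} → Mat k → Carrier
  det {zero}  M = 1#
  det {suc k} M = altSum λ j → M zero j * det (minor M j)

  altSum-cong : ∀ {k} {f g : Fin k → Carrier} → (∀ j → f j ≈ g j) → altSum f ≈ altSum g
  altSum-cong {zero}  eq = refl
  altSum-cong {suc k} eq = +-cong (eq zero) (-‿cong (altSum-cong (eq ∘ suc)))

  altSum-zero : ∀ {k} {f : Fin k → Carrier} → (∀ j → f j ≈ 0#) → altSum f ≈ 0#
  altSum-zero {zero}  eq = refl
  altSum-zero {suc k} eq =
    trans (+-cong (eq zero) (-‿cong (altSum-zero (eq ∘ suc)))) (-‿inverseʳ 0#)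

  altSum-linear : ∀ {k} (x y : Carrier) (f g : Fin k → Carrier) →
    altSum (λ j → x * f j + y * g j) ≈ x * altSum f + y * altSum g
  altSum-linear {zero}  x y f g = solve 2 (λ x y → con ℤ.0ℤ := x :* con ℤ.0ℤ :+ y :* con ℤ.0ℤ) refl x y
  altSum-linear {suc k} x y f g = trans
    (+-congˡ (-‿cong (altSum-linear x y (f ∘ suc) (g ∘ suc))))
    (solve 6 (λ x y f g F G → (x :* f :+ y :* g) :- (x :* F :+ y :* G) := x :* (f :- F) :+ y :* (g :- G))
      refl x y (f zero) (g zero) (altSum (f ∘ suc)) (altSum (g ∘ suc)))

  altSum-adjacent : ∀ {k} (i : Fin k) {f : Fin (suc k) → Carrier} → f (inject₁ i) ≈ f (suc i) →
    (∀ j → j ≢ inject₁ i → j ≢ suc i → f j ≈ 0#) → altSum f ≈ 0#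
  altSum-adjacent zero {f} eq zeros = begin
    f zero - (f (suc zero) - altSum (λ j → f (suc (suc j))))
      ≈⟨ +-cong eq (-‿cong (+-congˡ (-‿cong (altSum-zero λ j → zeros (suc (suc j)) (λ ()) (λ ()))))) ⟩
    f (suc zero) - (f (suc zero) - 0#)
      ≈⟨ solve 1 (λ x → x :- (x :- con ℤ.0ℤ) := con ℤ.0ℤ) refl (f (suc zero)) ⟩
    0# ∎
  altSum-adjacent (suc i) {f} eq zeros = trans
    (+-cong (zeros zero (λ ()) (λ ()))
      (-‿cong (altSum-adjacent i eq λ j p q → zeros (suc j) (p ∘ Finₚ.suc-injective) (q ∘ Finₚ.suc-injective))))
    (-‿inverseʳ 0#)

  -- Neighbouring positions carry opposite signs, so exchanging the two terms has the effect that
  -- negation has on all the others.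
  altSum-swap : ∀ {k} (i : Fin k) {f g : Fin (suc k) → Carrier} →
    g (inject₁ i) ≈ f (suc i) → g (suc i) ≈ f (inject₁ i) →
    (∀ j → j ≢ inject₁ i → j ≢ suc i → g j ≈ - f j) → altSum g ≈ - altSum f
  altSum-swap zero {f} {g} p q others = begin
    g zero - (g (suc zero) - altSum (λ j → g (suc (suc j))))
      ≈⟨ +-cong p (-‿cong (+-cong q (-‿cong rest))) ⟩
    f (suc zero) - (f zero - - F)
      ≈⟨ solve 3 (λ x y z → y :- (x :- :- z) := :- (x :- (y :- z))) refl (f zero) (f (suc zero)) F ⟩
    - (f zero - (f (suc zero) - F)) ∎
    where
    F = altSum (λ j → f (suc (suc j)))
    rest : altSum (λ j → g (suc (suc j))) ≈ - F
    rest = begin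
      altSum (λ j → g (suc (suc j)))
        ≈⟨ altSum-cong (λ j → trans (others (suc (suc j)) (λ ()) (λ ()))
             (solve 1 (λ x → :- x := :- con ℤ.1ℤ :* x :+ con ℤ.0ℤ :* x) refl _)) ⟩
      altSum (λ j → - 1₀ * f (suc (suc j)) + 0₀ * f (suc (suc j)))
        ≈⟨ altSum-linear (- 1₀) 0₀ (λ j → f (suc (suc j))) (λ j → f (suc (suc j))) ⟩
      - 1₀ * F + 0₀ * F
        ≈⟨ solve 1 (λ x → :- con ℤ.1ℤ :* x :+ con ℤ.0ℤ :* x := :- x) refl F ⟩
      - F ∎
      where
      -- The solver constant `con ℤ.1ℤ` denotes `1# + 0#` rather than `1#`, so the coefficients have
      -- to be taken in the solver's form.
      1₀ 0₀ : Carrier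
      1₀ = ⟦ ℤ.1ℤ ⟧ᶻ
      0₀ = ⟦ ℤ.0ℤ ⟧ᶻ
  altSum-swap (suc i) {f} {g} p q others = trans
    (+-cong (others zero (λ ()) (λ ()))
      (-‿cong (altSum-swap i p q λ j p′ q′ →
        others (suc j) (p′ ∘ Finₚ.suc-injective) (q′ ∘ Finₚ.suc-injective))))
    (solve 2 (λ x y → :- x :- :- y := :- (x :- y)) refl _ _)

  -- Phrased as a vanishing, so that the sign belonging to position `j` never has to be tracked.
  altSum-isolated : ∀ {k} (j : Fin k) {f : Fin k → Carrier} →
    (∀ c → c ≢ j → f c ≈ 0#) → altSum f ≈ 0# → f j ≈ 0#
  altSum-isolated zero {f} zeros eq = begin
    f zero                     ≈⟨ solve 2 (λ x y → x := (x :- y) :+ y) refl _ _ ⟩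
    altSum f + altSum (f ∘ suc)  ≈⟨ +-cong eq (altSum-zero λ c → zeros (suc c) (λ ())) ⟩
    0# + 0#                    ≈⟨ +-identityˡ 0# ⟩
    0#                         ∎
  altSum-isolated (suc j) {f} zeros eq =
    altSum-isolated j (λ c c≢j → zeros (suc c) (c≢j ∘ Finₚ.suc-injective)) (begin
      altSum (f ∘ suc)     ≈⟨ solve 2 (λ x y → y := x :- (x :- y)) refl (f zero) _ ⟩
      f zero - altSum f    ≈⟨ +-cong (zeros zero (λ ())) (-‿cong eq) ⟩
      0# - 0#              ≈⟨ -‿inverseʳ 0# ⟩
      0#                   ∎)

  det-cong : ∀ {k} {M N : Mat k} → (∀ r c → M r c ≈ N r c) → det M ≈ det N
  det-cong {zero}  eq = refl
  det-cong {suc k} eq = altSum-cong λ j →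
    *-cong (eq zero j) (det-cong λ r c → eq (suc r) (punchIn j c))

  det-lookup : ∀ {k} (M : Matrix Carrier k) → Det.det ringOps M ≈ det (λ r c → lookup (lookup M r) c)
  det-lookup {zero}  M            = refl
  det-lookup {suc k} (row ∷ rows) = altSum-cong λ j →
    *-congˡ {lookup row j} (trans (det-lookup (Det.minor ringOps (row ∷ rows) j)) (det-cong λ r c → reflexive (entry j r c)))
    where
    entry : ∀ j r c → lookup (lookup (Det.minor ringOps (row ∷ rows) j) r) c
                    ≡ lookup (lookup rows r) (punchIn j c)
    entry j r c = ≡.trans
      (≡.cong (λ v → lookup v c) (Vecₚ.lookup-map r (λ v → Vec.removeAt v j) rows))
      (lookup-removeAt (lookup rows r) j c)

  -- In the first-row expansion the term at `j` is linear through its entry, and every other term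
  -- through its minor, by induction.
  det-linear : ∀ {k} (j : Fin k) (x y : Carrier) {A B C : Mat k} →
    (∀ r → A r j ≈ x * B r j + y * C r j) →
    (∀ r c → c ≢ j → A r c ≈ B r c) → (∀ r c → c ≢ j → A r c ≈ C r c) →
    det A ≈ x * det B + y * det C
  det-linear {suc k} j x y {A} {B} {C} at-j A≈B A≈C =
    trans (altSum-cong term)
      (altSum-linear x y (λ c → B zero c * det (minor B c)) (λ c → C zero c * det (minor C c)))
    where
    term : ∀ c → A zero c * det (minor A c) ≈
      x * (B zero c * det (minor B c)) + y * (C zero c * det (minor C c))
    term c with c Finₚ.≟ j
    term c | yes ≡.refl = begin
      A zero c * det (minor A c)
        ≈⟨ *-cong (at-j zero) refl ⟩
      (x * B zero c + y * C zero c) * det (minor A c)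
        ≈⟨ solve 5 (λ x y b c d → (x :* b :+ y :* c) :* d := x :* (b :* d) :+ y :* (c :* d))
             refl x y (B zero c) (C zero c) (det (minor A c)) ⟩
      x * (B zero c * det (minor A c)) + y * (C zero c * det (minor A c))
        ≈⟨ +-cong
             (*-congˡ (*-congˡ (det-cong λ r s → A≈B (suc r) _ (Finₚ.punchInᵢ≢i c s))))
             (*-congˡ (*-congˡ (det-cong λ r s → A≈C (suc r) _ (Finₚ.punchInᵢ≢i c s)))) ⟩
      x * (B zero c * det (minor B c)) + y * (C zero c * det (minor C c)) ∎
    term c | no c≢j = begin
      A zero c * det (minor A c)
        ≈⟨ *-congˡ (det-linear j′ x y at-j′ (off A≈B) (off A≈C)) ⟩
      A zero c * (x * det (minor B c) + y * det (minor C c))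
        ≈⟨ solve 5 (λ x y a b c → a :* (x :* b :+ y :* c) := x :* (a :* b) :+ y :* (a :* c))
             refl x y (A zero c) (det (minor B c)) (det (minor C c)) ⟩
      x * (A zero c * det (minor B c)) + y * (A zero c * det (minor C c))
        ≈⟨ +-cong (*-congˡ (*-congʳ (A≈B zero c c≢j))) (*-congˡ (*-congʳ (A≈C zero c c≢j))) ⟩
      x * (B zero c * det (minor B c)) + y * (C zero c * det (minor C c)) ∎
      where
      j′ = punchOut c≢j
      j′≡j : punchIn c j′ ≡ j
      j′≡j = Finₚ.punchIn-punchOut c≢j
      at-j′ : ∀ r → minor A c r j′ ≈ x * minor B c r j′ + y * minor C c r j′
      at-j′ r = ≡.subst (λ s → A (suc r) s ≈ x * B (suc r) s + y * C (suc r) s) (≡.sym j′≡j) (at-j (suc r))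
      off : {D : Mat (suc k)} → (∀ r s → s ≢ j → A r s ≈ D r s) →
        ∀ r s → s ≢ j′ → minor A c r s ≈ minor D c r s
      off A≈D r s s≢ = A≈D (suc r) _
        λ eq → s≢ (Finₚ.punchIn-injective c s j′ (≡.trans eq (≡.sym j′≡j)))

  det-zero-column : ∀ {k} (j : Fin k) {M : Mat k} → (∀ r → M r j ≈ 0#) → det M ≈ 0#
  det-zero-column j {M} zeros = trans
    (det-linear j 0# 0# {M} {M} {M} (λ r → trans (zeros r) (sym vanish)) (λ _ _ _ → refl) (λ _ _ _ → refl))
    vanish
    where
    vanish : ∀ {x y} → 0# * x + 0# * y ≈ 0#
    vanish = trans (+-cong (zeroˡ _) (zeroˡ _)) (+-identityˡ 0#)

  -- The expansion terms of the pair cancel, and every other minor again has two equal neighbours.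
  -- Antisymmetry would not suffice: it only gives `det M ≈ - det M`, which says nothing in
  -- characteristic 2.
  det-adjacent : ∀ {k} (i : Fin k) {M : Mat (suc k)} → (∀ r → M r (inject₁ i) ≈ M r (suc i)) → det M ≈ 0#
  det-adjacent {suc k} i {M} eq = altSum-adjacent i {λ j → M zero j * det (minor M j)}
    (*-cong (eq zero) (det-cong λ r c → columns r (λ s → M (suc r) s) i c (eq (suc r))))
    (λ j p q → let open AdjacentIn (adjacentIn j i p q) in trans
      (*-congˡ (det-adjacent index {minor M j} λ r → begin
        M (suc r) (punchIn j (inject₁ index)) ≡⟨ ≡.cong (M (suc r)) left ⟩
        M (suc r) (inject₁ i)                 ≈⟨ eq (suc r) ⟩
        M (suc r) (suc i)                     ≡⟨ ≡.cong (M (suc r)) right ⟨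
        M (suc r) (punchIn j (suc index))     ∎))
      (zeroʳ _))
    where
    columns : ∀ {k} (r : Fin (suc k)) {l} (f : Fin (suc l) → Carrier) (i c : Fin l) →
      f (inject₁ i) ≈ f (suc i) → f (punchIn (inject₁ i) c) ≈ f (punchIn (suc i) c)
    columns r f zero    zero    eq = sym eq
    columns r f zero    (suc c) eq = refl
    columns r f (suc i) zero    eq = refl
    columns r f (suc i) (suc c) eq = columns r (f ∘ suc) i c eq

  det-swap : ∀ {k} (i : Fin k) (M : Mat (suc k)) → det (λ r c → M r (swap i c)) ≈ - det M
  det-swap {suc k} i M = altSum-swap i
    (*-cong (reflexive (≡.cong (M zero) (swap-inject₁ i)))
      (det-cong λ r c → reflexive (≡.cong (M (suc r)) (swap-punchIn-inject₁ i c))))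
    (*-cong (reflexive (≡.cong (M zero) (swap-suc i)))
      (det-cong λ r c → reflexive (≡.cong (M (suc r)) (swap-punchIn-suc i c))))
    (λ j p q → let open AdjacentIn (adjacentIn j i p q) in begin
      M zero (swap i j) * det (λ r c → M (suc r) (swap i (punchIn j c)))
        ≈⟨ *-cong (reflexive (≡.cong (M zero) (swap-other i p q)))
             (det-cong λ r c → reflexive (≡.cong (M (suc r)) (swaps c))) ⟩
      M zero j * det (λ r c → minor M j r (swap index c))
        ≈⟨ *-congˡ (det-swap index (minor M j)) ⟩
      M zero j * - det (minor M j)
        ≈⟨ sym (-‿distribʳ-* _ _) ⟩
      - (M zero j * det (minor M j)) ∎)

  -- Adjacent swaps move column `b` to the left until it stands next to `a`; `n` is its position and
  -- drives the recursion.
  det-alternating-< : ∀ n {k} {a b : Fin k} {M : Mat k} → toℕ b ≡ n → toℕ a ℕ.< n →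
    (∀ r → M r a ≈ M r b) → det M ≈ 0#
  det-alternating-< (suc n) {suc k} {a} {suc b} {M} b≡n a<n eq with a Finₚ.≟ inject₁ b
  ... | yes ≡.refl = det-adjacent b {M} eq
  ... | no a≢b = begin
    det M                           ≈⟨ solve 1 (λ x → x := :- :- x) refl _ ⟩
    - - det M                       ≈⟨ -‿cong (sym (det-swap b M)) ⟩
    - det (λ r c → M r (swap b c))  ≈⟨ -‿cong (det-alternating-< n {a = a} {inject₁ b} b′≡n a<n′ eq′) ⟩
    - 0#                            ≈⟨ -0#≈0# ⟩
    0#                              ∎
    where
    b′≡n : toℕ (inject₁ b) ≡ n
    b′≡n = ≡.trans (Finₚ.toℕ-inject₁ b) (ℕₚ.suc-injective b≡n)
    a<n′ : toℕ a ℕ.< n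
    a<n′ = ℕₚ.≤∧≢⇒< (ℕₚ.≤-pred a<n) λ a≡n → a≢b (Finₚ.toℕ-injective (≡.trans a≡n (≡.sym b′≡n)))
    a≢suc : a ≢ suc b
    a≢suc ≡.refl = ℕₚ.<-irrefl b≡n a<n
    eq′ : ∀ r → M r (swap b a) ≈ M r (swap b (inject₁ b))
    eq′ r = begin
      M r (swap b a)             ≡⟨ ≡.cong (M r) (swap-other b a≢b a≢suc) ⟩
      M r a                      ≈⟨ eq r ⟩
      M r (suc b)                ≡⟨ ≡.cong (M r) (swap-inject₁ b) ⟨
      M r (swap b (inject₁ b))   ∎

  det-alternating : ∀ {k} (a b : Fin k) {M : Mat k} → a ≢ b → (∀ r → M r a ≈ M r b) → det M ≈ 0#
  det-alternating a b a≢b eq with toℕ a ℕₚ.<? toℕ b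
  ... | yes a<b = det-alternating-< (toℕ b) {a = a} {b} ≡.refl a<b eq
  ... | no a≮b = det-alternating-< (toℕ a) {a = b} {a} ≡.refl
    (ℕₚ.≤∧≢⇒< (ℕₚ.≮⇒≥ a≮b) λ b≡a → a≢b (≡.sym (Finₚ.toℕ-injective b≡a)))
    (λ r → sym (eq r))

  _[_≔_] : ∀ {k} → Mat k → Fin k → (Fin k → Carrier) → Mat k
  (M [ j ≔ v ]) r c with c Finₚ.≟ j
  ... | yes _ = v r
  ... | no  _ = M r c

  replace-at : ∀ {k} (M : Mat k) j v r → (M [ j ≔ v ]) r j ≡ v r
  replace-at M j v r with j Finₚ.≟ j
  ... | yes _  = ≡.refl
  ... | no j≢j = contradiction ≡.refl j≢j

  replace-off : ∀ {k} (M : Mat k) {j} v r {c} → c ≢ j → (M [ j ≔ v ]) r c ≡ M r c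
  replace-off M {j} v r {c} c≢j with c Finₚ.≟ j
  ... | yes c≡j = contradiction c≡j c≢j
  ... | no  _   = ≡.refl

  det-replace-column : ∀ {k} (M : Mat k) j → det (M [ j ≔ (λ r → M r j) ]) ≈ det M
  det-replace-column M j = det-cong entry
    where
    entry : ∀ r c → (M [ j ≔ (λ r → M r j) ]) r c ≈ M r c
    entry r c with c Finₚ.≟ j
    ... | yes ≡.refl = refl
    ... | no  _      = refl

  det-replace-other-column : ∀ {k} (M : Mat k) {j c} → c ≢ j → det (M [ j ≔ (λ r → M r c) ]) ≈ 0#
  det-replace-other-column M {j} {c} c≢j = det-alternating c j c≢j λ r → reflexive
    (≡.trans (replace-off M _ r c≢j) (≡.sym (replace-at M j _ r)))

  det-replace-cong : ∀ {k} (M : Mat k) j {v w : Fin k → Carrier} → (∀ r → v r ≈ w r) →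
    det (M [ j ≔ v ]) ≈ det (M [ j ≔ w ])
  det-replace-cong M j {v} {w} v≈w = det-cong entry
    where
    entry : ∀ r c → (M [ j ≔ v ]) r c ≈ (M [ j ≔ w ]) r c
    entry r c with c Finₚ.≟ j
    ... | yes _ = v≈w r
    ... | no  _ = refl

  det-replace-sum : ∀ {k} (M : Mat k) j {l} (x : Fin l → Carrier) (V : Fin l → Fin k → Carrier) →
    det (M [ j ≔ (λ r → sum λ i → x i * V i r) ]) ≈ sum λ i → x i * det (M [ j ≔ V i ])
  det-replace-sum M j {zero}  x V = det-zero-column j λ r → reflexive (replace-at M j _ r)
  det-replace-sum {k} M j {suc l} x V = begin
    det (M [ j ≔ (λ r → sum λ i → x i * V i r) ])
      ≈⟨ det-linear j (x zero) 1# at-j (off _ (V zero)) (off _ tail) ⟩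
    x zero * det (M [ j ≔ V zero ]) + 1# * det (M [ j ≔ tail ])
      ≈⟨ +-congˡ (trans (*-identityˡ _) (det-replace-sum M j (x ∘ suc) (V ∘ suc))) ⟩
    x zero * det (M [ j ≔ V zero ]) + sum (λ i → x (suc i) * det (M [ j ≔ V (suc i) ])) ∎
    where
    tail : Fin k → Carrier
    tail r = sum λ i → x (suc i) * V (suc i) r
    at-j : ∀ r → (M [ j ≔ (λ r → sum λ i → x i * V i r) ]) r j ≈
      x zero * (M [ j ≔ V zero ]) r j + 1# * (M [ j ≔ tail ]) r j
    at-j r = begin
      (M [ j ≔ (λ r → sum λ i → x i * V i r) ]) r j  ≡⟨ replace-at M j _ r ⟩
      x zero * V zero r + tail r
        ≡⟨ ≡.cong₂ (λ a b → x zero * a + b) (replace-at M j _ r) (replace-at M j _ r) ⟨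
      x zero * (M [ j ≔ V zero ]) r j + (M [ j ≔ tail ]) r j
        ≈⟨ +-congˡ (sym (*-identityˡ _)) ⟩
      x zero * (M [ j ≔ V zero ]) r j + 1# * (M [ j ≔ tail ]) r j ∎
    off : ∀ v w r c → c ≢ j → (M [ j ≔ v ]) r c ≈ (M [ j ≔ w ]) r c
    off v w r c c≢j = reflexive (≡.trans (replace-off M v r c≢j) (≡.sym (replace-off M w r c≢j)))

  δ : ∀ {k} → Fin k → Fin k → Carrier
  δ i j with i Finₚ.≟ j
  ... | yes _ = 1#
  ... | no  _ = 0#

  δ-diagonal : ∀ {k} (i : Fin k) → δ i i ≡ 1#
  δ-diagonal i with i Finₚ.≟ i
  ... | yes _  = ≡.refl
  ... | no i≢i = contradiction ≡.refl i≢i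

  δ-off-diagonal : ∀ {k} {i j : Fin k} → i ≢ j → δ i j ≡ 0#
  δ-off-diagonal {i = i} {j} i≢j with i Finₚ.≟ j
  ... | yes i≡j = contradiction i≡j i≢j
  ... | no  _   = ≡.refl

  sum-zero : ∀ {k} {f : Fin k → Carrier} → (∀ i → f i ≈ 0#) → sum f ≈ 0#
  sum-zero {zero}  eq = refl
  sum-zero {suc k} eq = trans (+-cong (eq zero) (sum-zero (eq ∘ suc))) (+-identityˡ 0#)

  sum-isolated : ∀ {k} (j : Fin k) {f : Fin k → Carrier} → (∀ i → i ≢ j → f i ≈ 0#) → sum f ≈ f j
  sum-isolated zero    eq = trans (+-congˡ (sum-zero λ i → eq (suc i) λ ())) (+-identityʳ _)
  sum-isolated (suc j) eq = trans
    (+-cong (eq zero λ ()) (sum-isolated j λ i i≢j → eq (suc i) (i≢j ∘ Finₚ.suc-injective)))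
    (+-identityˡ _)

  -- The cofactors in the form of Cramer's rule: column `j` becomes a unit vector, and no signs or
  -- double deletions occur.
  adjugate : ∀ {k} → Mat k → Mat k
  adjugate M j i = det (M [ j ≔ δ i ])

  -- By linearity the sum is the determinant of `M` with column `j` replaced by column `c`. That is
  -- `M` itself if `c` is `j`, and has a repeated column otherwise.
  adjugate-* : ∀ {k} (M : Mat k) j c → sum (λ i → adjugate M j i * M i c) ≈ δ j c * det M
  adjugate-* M j c = begin
    sum (λ i → adjugate M j i * M i c)               ≈⟨ sum-cong-≋ (λ i → *-comm (adjugate M j i) (M i c)) ⟩
    sum (λ i → M i c * det (M [ j ≔ δ i ]))          ≈⟨ sym (det-replace-sum M j (λ i → M i c) δ) ⟩
    det (M [ j ≔ (λ r → sum λ i → M i c * δ i r) ])  ≈⟨ det-replace-cong M j column ⟩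
    det (M [ j ≔ (λ r → M r c) ])                    ≈⟨ replaced ⟩
    δ j c * det M                                    ∎
    where
    column : ∀ r → sum (λ i → M i c * δ i r) ≈ M r c
    column r = trans
      (sum-isolated r λ i i≢r → trans (*-congˡ (reflexive (δ-off-diagonal i≢r))) (zeroʳ _))
      (trans (*-congˡ (reflexive (δ-diagonal r))) (*-identityʳ _))
    replaced : det (M [ j ≔ (λ r → M r c) ]) ≈ δ j c * det M
    replaced with j Finₚ.≟ c
    ... | yes ≡.refl = trans (det-replace-column M j) (sym (*-identityˡ _))
    ... | no j≢c     = trans (det-replace-other-column M (j≢c ∘ ≡.sym)) (sym (zeroˡ _))

  -- The columns c ≢ j contribute determinants with a repeated column.
  det-replace-combination : ∀ {k} (M : Mat k) j (x : Fin k → Carrier) →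
    det (M [ j ≔ (λ r → sum λ c → x c * M r c) ]) ≈ x j * det M
  det-replace-combination M j x = begin
    det (M [ j ≔ (λ r → sum λ c → x c * M r c) ])
      ≈⟨ det-replace-sum M j x (λ c r → M r c) ⟩
    sum (λ c → x c * det (M [ j ≔ (λ r → M r c) ]))
      ≈⟨ sum-isolated j (λ c c≢j → trans (*-congˡ (det-replace-other-column M c≢j)) (zeroʳ _)) ⟩
    x j * det (M [ j ≔ (λ r → M r j) ])
      ≈⟨ *-congˡ (det-replace-column M j) ⟩
    x j * det M ∎

  -- Column `j` is a multiple of the first unit vector, so in the first-row expansion every other
  -- minor keeps a zero column and only the term at `j` survives.
  det-replace-top : ∀ {k} (M : Mat (suc k)) j {v : Fin (suc k) → Carrier} →
    (∀ r → v (suc r) ≈ 0#) → det (M [ j ≔ v ]) ≈ 0# → v zero * det (minor M j) ≈ 0#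
  det-replace-top M j {v} zeros eq = begin
    v zero * det (minor M j)
      ≈⟨ *-cong (reflexive (≡.sym (replace-at M j v zero)))
           (det-cong λ r c → reflexive (≡.sym (replace-off M v (suc r) (Finₚ.punchInᵢ≢i j c)))) ⟩
    (M [ j ≔ v ]) zero j * det (minor (M [ j ≔ v ]) j)
      ≈⟨ altSum-isolated j {λ c → (M [ j ≔ v ]) zero c * det (minor (M [ j ≔ v ]) c)}
           (λ c c≢j → trans (*-congˡ (minor-zero c c≢j)) (zeroʳ _)) eq ⟩
    0# ∎
    where
    minor-zero : ∀ c → c ≢ j → det (minor (M [ j ≔ v ]) c) ≈ 0#
    minor-zero c c≢j = det-zero-column (punchOut c≢j) λ r → begin
      (M [ j ≔ v ]) (suc r) (punchIn c (punchOut c≢j))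
        ≡⟨ ≡.cong ((M [ j ≔ v ]) (suc r)) (Finₚ.punchIn-punchOut c≢j) ⟩
      (M [ j ≔ v ]) (suc r) j  ≡⟨ replace-at M j v (suc r) ⟩
      v (suc r)                ≈⟨ zeros r ⟩
      0#                       ∎

-- The polynomial ring over the field.

fieldRing : FiniteField → CommutativeRing 0ℓ 0ℓ
fieldRing F = record { isCommutativeRing = FiniteField.isCommutativeRing F }

module Polynomials (F : FiniteField) where
  open CommutativeRing (fieldRing F) hiding (zero; refl; sym; trans; _≈_)
  open Algebra.Properties.Ring ring
  open ℤ-Solver (fieldRing F)
  open ≡ using (refl; sym; trans; cong; cong₂)
  open ≡.≡-Reasoning

  -- _≈ₚ_ as a record, so that both polynomials can be inferred from a proof.
  record _≈_ (p r : Poly F) : Set where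
    constructor coefficientwise
    field coeff-≡ : _≈ₚ_ F p r
  open _≈_ public

  scale : Carrier → Poly F → Poly F
  scale a = List.map (a *_)

  shift : Poly F → Poly F
  shift p = 0# ∷ p

  coeff-add : ∀ p r i → coeff F (addP F p r) i ≡ coeff F p i + coeff F r i
  coeff-add []      r       i       = sym (+-identityˡ _)
  coeff-add (a ∷ p) []      i       = sym (+-identityʳ _)
  coeff-add (a ∷ p) (b ∷ r) zero    = refl
  coeff-add (a ∷ p) (b ∷ r) (suc i) = coeff-add p r i

  coeff-scale : ∀ a p i → coeff F (scale a p) i ≡ a * coeff F p i
  coeff-scale a []      i       = sym (zeroʳ a)
  coeff-scale a (b ∷ p) zero    = refl
  coeff-scale a (b ∷ p) (suc i) = coeff-scale a p i

  coeff-neg : ∀ p i → coeff F (negP F p) i ≡ - coeff F p i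
  coeff-neg []      i       = sym -0#≈0#
  coeff-neg (a ∷ p) zero    = refl
  coeff-neg (a ∷ p) (suc i) = coeff-neg p i

  ∷-cong : ∀ {a b p r} → a ≡ b → p ≈ r → (a ∷ p) ≈ (b ∷ r)
  ∷-cong a≡b p≈r .coeff-≡ zero    = a≡b
  ∷-cong a≡b p≈r .coeff-≡ (suc i) = p≈r .coeff-≡ i

  shift-[] : shift [] ≈ []
  shift-[] .coeff-≡ zero    = refl
  shift-[] .coeff-≡ (suc i) = refl

  ≈-refl : ∀ {p} → p ≈ p
  ≈-refl .coeff-≡ i = refl

  ≈-sym : ∀ {p r} → p ≈ r → r ≈ p
  ≈-sym eq .coeff-≡ i = sym (eq .coeff-≡ i)

  ≈-trans : ∀ {p r s} → p ≈ r → r ≈ s → p ≈ s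
  ≈-trans eq eq′ .coeff-≡ i = trans (eq .coeff-≡ i) (eq′ .coeff-≡ i)

  addP-cong : ∀ {p p′ r r′} → p ≈ p′ → r ≈ r′ → addP F p r ≈ addP F p′ r′
  addP-cong {p} {p′} {r} {r′} p≈ r≈ .coeff-≡ i = begin
    coeff F (addP F p r) i          ≡⟨ coeff-add p r i ⟩
    coeff F p i + coeff F r i       ≡⟨ cong₂ _+_ (p≈ .coeff-≡ i) (r≈ .coeff-≡ i) ⟩
    coeff F p′ i + coeff F r′ i     ≡⟨ coeff-add p′ r′ i ⟨
    coeff F (addP F p′ r′) i        ∎

  scale-cong : ∀ a {p r} → p ≈ r → scale a p ≈ scale a r
  scale-cong a {p} {r} p≈r .coeff-≡ i = trans (coeff-scale a p i) (trans (cong (a *_) (p≈r .coeff-≡ i)) (sym (coeff-scale a r i)))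

  negP-cong : ∀ {p r} → p ≈ r → negP F p ≈ negP F r
  negP-cong {p} {r} p≈r .coeff-≡ i = trans (coeff-neg p i) (trans (cong -_ (p≈r .coeff-≡ i)) (sym (coeff-neg r i)))

  mulP-congʳ : ∀ p {r r′} → r ≈ r′ → mulP F p r ≈ mulP F p r′
  mulP-congʳ []      r≈ = ≈-refl
  mulP-congʳ (a ∷ p) r≈ = addP-cong (scale-cong a r≈) (∷-cong refl (mulP-congʳ p r≈))

  addP-assoc : ∀ p r s → addP F (addP F p r) s ≈ addP F p (addP F r s)
  addP-assoc p r s .coeff-≡ i = begin
    coeff F (addP F (addP F p r) s) i              ≡⟨ coeff-add (addP F p r) s i ⟩
    coeff F (addP F p r) i + coeff F s i           ≡⟨ cong (_+ _) (coeff-add p r i) ⟩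
    coeff F p i + coeff F r i + coeff F s i        ≡⟨ +-assoc _ _ _ ⟩
    coeff F p i + (coeff F r i + coeff F s i)      ≡⟨ cong (_ +_) (coeff-add r s i) ⟨
    coeff F p i + coeff F (addP F r s) i           ≡⟨ coeff-add p (addP F r s) i ⟨
    coeff F (addP F p (addP F r s)) i              ∎

  addP-comm : ∀ p r → addP F p r ≈ addP F r p
  addP-comm p r .coeff-≡ i = trans (coeff-add p r i) (trans (+-comm _ _) (sym (coeff-add r p i)))

  addP-identityʳ : ∀ p → addP F p [] ≈ p
  addP-identityʳ []      = ≈-refl
  addP-identityʳ (a ∷ p) = ≈-refl

  addP-inverseʳ : ∀ p → addP F p (negP F p) ≈ []
  addP-inverseʳ p .coeff-≡ i =
    trans (coeff-add p (negP F p) i) (trans (+-congˡ (coeff-neg p i)) (-‿inverseʳ _))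

  addP-interchange : ∀ p r s t → addP F (addP F p r) (addP F s t) ≈ addP F (addP F p s) (addP F r t)
  addP-interchange p r s t .coeff-≡ i = begin
    coeff F (addP F (addP F p r) (addP F s t)) i
      ≡⟨ trans (coeff-add (addP F p r) (addP F s t) i) (cong₂ _+_ (coeff-add p r i) (coeff-add s t i)) ⟩
    (coeff F p i + coeff F r i) + (coeff F s i + coeff F t i)
      ≡⟨ solve 4 (λ a b c d → (a :+ b) :+ (c :+ d) := (a :+ c) :+ (b :+ d)) refl _ _ _ _ ⟩
    (coeff F p i + coeff F s i) + (coeff F r i + coeff F t i)
      ≡⟨ trans (coeff-add (addP F p s) (addP F r t) i) (cong₂ _+_ (coeff-add p s i) (coeff-add r t i)) ⟨
    coeff F (addP F (addP F p s) (addP F r t)) i ∎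

  scale-addP : ∀ a p r → scale a (addP F p r) ≈ addP F (scale a p) (scale a r)
  scale-addP a p r .coeff-≡ i = begin
    coeff F (scale a (addP F p r)) i               ≡⟨ trans (coeff-scale a (addP F p r) i) (cong (a *_) (coeff-add p r i)) ⟩
    a * (coeff F p i + coeff F r i)                ≡⟨ distribˡ a _ _ ⟩
    a * coeff F p i + a * coeff F r i              ≡⟨ cong₂ _+_ (coeff-scale a p i) (coeff-scale a r i) ⟨
    coeff F (scale a p) i + coeff F (scale a r) i  ≡⟨ coeff-add (scale a p) (scale a r) i ⟨
    coeff F (addP F (scale a p) (scale a r)) i     ∎

  scale-scale : ∀ a b p → scale (a * b) p ≈ scale a (scale b p)
  scale-scale a b p .coeff-≡ i = begin
    coeff F (scale (a * b) p) i      ≡⟨ coeff-scale (a * b) p i ⟩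
    a * b * coeff F p i              ≡⟨ *-assoc a b _ ⟩
    a * (b * coeff F p i)            ≡⟨ cong (a *_) (coeff-scale b p i) ⟨
    a * coeff F (scale b p) i        ≡⟨ coeff-scale a (scale b p) i ⟨
    coeff F (scale a (scale b p)) i  ∎

  scale-1 : ∀ p → scale 1# p ≈ p
  scale-1 p .coeff-≡ i = trans (coeff-scale 1# p i) (*-identityˡ _)

  scale-0 : ∀ p → scale 0# p ≈ []
  scale-0 p .coeff-≡ i = trans (coeff-scale 0# p i) (zeroˡ _)

  scale-shift : ∀ a p → scale a (shift p) ≈ shift (scale a p)
  scale-shift a p = ∷-cong (zeroʳ a) ≈-refl

  mulP-[] : ∀ p → mulP F p [] ≈ []
  mulP-[] []      = ≈-refl
  mulP-[] (a ∷ p) = ≈-trans (∷-cong refl (mulP-[] p)) shift-[]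

  mulP-shiftˡ : ∀ p r → mulP F (shift p) r ≈ shift (mulP F p r)
  mulP-shiftˡ p r .coeff-≡ i = trans (coeff-add (scale 0# r) (shift (mulP F p r)) i)
    (trans (+-congʳ (scale-0 r .coeff-≡ i)) (+-identityˡ _))

  mulP-distribˡ : ∀ p r s → mulP F p (addP F r s) ≈ addP F (mulP F p r) (mulP F p s)
  mulP-distribˡ []      r s = ≈-refl
  mulP-distribˡ (a ∷ p) r s = ≈-trans
    (addP-cong (scale-addP a r s)
      (≈-trans (∷-cong refl (mulP-distribˡ p r s)) (∷-cong (sym (+-identityˡ 0#)) ≈-refl)))
    (addP-interchange (scale a r) (scale a s) (shift (mulP F p r)) (shift (mulP F p s)))

  -- The recursion of `mulP` read on its second argument; it makes commutativity a plain induction.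
  mulP-∷ʳ : ∀ p b r → mulP F p (b ∷ r) ≈ addP F (scale b p) (shift (mulP F p r))
  mulP-∷ʳ []      b r = ≈-sym shift-[]
  mulP-∷ʳ (a ∷ p) b r = ∷-cong (cong (_+ 0#) (*-comm a b)) (≈-trans
    (addP-cong (≈-refl {scale a r}) (mulP-∷ʳ p b r))
    (coefficientwise λ i → begin
      coeff F (addP F (scale a r) (addP F (scale b p) (shift (mulP F p r)))) i
        ≡⟨ trans (coeff-add (scale a r) _ i) (cong (_ +_) (coeff-add (scale b p) _ i)) ⟩
      coeff F (scale a r) i + (coeff F (scale b p) i + coeff F (shift (mulP F p r)) i)
        ≡⟨ solve 3 (λ x y z → x :+ (y :+ z) := y :+ (x :+ z)) refl _ _ _ ⟩
      coeff F (scale b p) i + (coeff F (scale a r) i + coeff F (shift (mulP F p r)) i)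
        ≡⟨ trans (coeff-add (scale b p) _ i) (cong (_ +_) (coeff-add (scale a r) _ i)) ⟨
      coeff F (addP F (scale b p) (addP F (scale a r) (shift (mulP F p r)))) i ∎))

  mulP-comm : ∀ p r → mulP F p r ≈ mulP F r p
  mulP-comm []      r = ≈-sym (mulP-[] r)
  mulP-comm (a ∷ p) r = ≈-trans
    (addP-cong (≈-refl {scale a r}) (∷-cong refl (mulP-comm p r))) (≈-sym (mulP-∷ʳ r a p))

  mulP-cong : ∀ {p p′ r r′} → p ≈ p′ → r ≈ r′ → mulP F p r ≈ mulP F p′ r′
  mulP-cong {p} {p′} {r} {r′} p≈ r≈ = ≈-trans (mulP-congʳ p r≈)
    (≈-trans (mulP-comm p r′) (≈-trans (mulP-congʳ r′ p≈) (mulP-comm r′ p′)))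

  mulP-distribʳ : ∀ s p r → mulP F (addP F p r) s ≈ addP F (mulP F p s) (mulP F r s)
  mulP-distribʳ s p r = ≈-trans (mulP-comm (addP F p r) s)
    (≈-trans (mulP-distribˡ s p r) (addP-cong (mulP-comm s p) (mulP-comm s r)))

  mulP-scale : ∀ a p r → mulP F (scale a p) r ≈ scale a (mulP F p r)
  mulP-scale a []      r = ≈-refl
  mulP-scale a (b ∷ p) r = ≈-trans
    (addP-cong (scale-scale a b r)
      (≈-trans (∷-cong refl (mulP-scale a p r)) (≈-sym (scale-shift a (mulP F p r)))))
    (≈-sym (scale-addP a (scale b r) (shift (mulP F p r))))

  mulP-assoc : ∀ p r s → mulP F (mulP F p r) s ≈ mulP F p (mulP F r s)
  mulP-assoc []      r s = ≈-refl
  mulP-assoc (a ∷ p) r s = ≈-trans (mulP-distribʳ s (scale a r) (shift (mulP F p r)))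
    (addP-cong (mulP-scale a r s)
      (≈-trans (mulP-shiftˡ (mulP F p r) s) (∷-cong refl (mulP-assoc p r s))))

  mulP-constant : ∀ a p → mulP F (a ∷ []) p ≈ scale a p
  mulP-constant a p = ≈-trans (addP-cong (≈-refl {scale a p}) shift-[]) (addP-identityʳ _)

  mulP-identityˡ : ∀ p → mulP F (oneP F) p ≈ p
  mulP-identityˡ p = ≈-trans (mulP-constant 1# p) (scale-1 p)

  polyRing : CommutativeRing 0ℓ 0ℓ
  polyRing = record
    { Carrier = Poly F ; _≈_ = _≈_ ; _+_ = addP F ; _*_ = mulP F ; -_ = negP F ; 0# = [] ; 1# = oneP F
    ; isCommutativeRing = record
      { isRing = record
        { +-isAbelianGroup = record
          { isGroup = record
            { isMonoid = record
              { isSemigroup = record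
                { isMagma = record
                  { isEquivalence = record { refl = ≈-refl ; sym = ≈-sym ; trans = ≈-trans }
                  ; ∙-cong = addP-cong }
                ; assoc = addP-assoc }
              ; identity = (λ p → ≈-refl) , addP-identityʳ }
            ; inverse = (λ p → ≈-trans (addP-comm (negP F p) p) (addP-inverseʳ p)) , addP-inverseʳ
            ; ⁻¹-cong = negP-cong }
          ; comm = addP-comm }
        ; *-cong = mulP-cong
        ; *-assoc = mulP-assoc
        ; *-identity = mulP-identityˡ , (λ p → ≈-trans (mulP-comm p (oneP F)) (mulP-identityˡ p))
        ; distrib = mulP-distribˡ , mulP-distribʳ }
      ; *-comm = mulP-comm } }

  X : Poly F
  X = shift (oneP F)

  shift≈X* : ∀ p → shift p ≈ mulP F X p
  shift≈X* p = ≈-sym (≈-trans (mulP-shiftˡ (oneP F) p) (∷-cong refl (mulP-identityˡ p)))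

  module Pow = Algebra.Properties.Semiring.Exp (CommutativeRing.semiring polyRing)

  monomial≈X^ : ∀ e → (List.replicate e 0# List.++ (1# ∷ [])) ≈ (X Pow.^ e)
  monomial≈X^ zero    = ≈-refl
  monomial≈X^ (suc e) = ≈-trans (∷-cong refl (monomial≈X^ e)) (shift≈X* (X Pow.^ e))

  xPowMinusOne≈ : ∀ e → xPowMinusOne F e ≈ addP F (X Pow.^ e) (negP F (oneP F))
  xPowMinusOne≈ e = addP-cong (monomial≈X^ e) ≈-refl

-- Field arithmetic, Euclidean division and irreducible polynomials.

module Field (F : FiniteField) where
  open FiniteField F using (Carrier; elements; elements-unique; elements-complete; size; inverse; 0≢1)
  open CommutativeRing (fieldRing F) hiding (Carrier; zero; refl; sym; trans; _≈_)
  open ≡ using (refl; sym; trans; cong; cong₂)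
  open ≡.≡-Reasoning

  _≟_ : DecidableEquality Carrier
  x ≟ y with Any.index (elements-complete x) Finₚ.≟ Any.index (elements-complete y)
  ... | yes eq = yes (begin
    x                                                     ≡⟨ Anyₚ.lookup-index (elements-complete x) ⟩
    List.lookup elements (Any.index (elements-complete x)) ≡⟨ cong (List.lookup elements) eq ⟩
    List.lookup elements (Any.index (elements-complete y)) ≡⟨ Anyₚ.lookup-index (elements-complete y) ⟨
    y                                                     ∎)
  ... | no neq = no λ { refl → neq refl }

  2≤size : 2 ℕ.≤ size
  2≤size = length-≤ _≡_ (λ p q → trans p (sym q)) {0# ∷ 1# ∷ []}
    ((0≢1 ∷ []) ∷ [] ∷ []) (λ {x} _ → x , elements-complete x , refl)

  zero-product : ∀ {x y} → x * y ≡ 0# → x ≢ 0# → y ≡ 0#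
  zero-product {x} {y} xy≡0 x≢0 with inverse x x≢0
  ... | x⁻¹ , xx⁻¹≡1 = begin
    y               ≡⟨ *-identityˡ y ⟨
    1# * y          ≡⟨ cong (_* y) (trans (*-comm x⁻¹ x) xx⁻¹≡1) ⟨
    x⁻¹ * x * y     ≡⟨ *-assoc x⁻¹ x y ⟩
    x⁻¹ * (x * y)   ≡⟨ cong (x⁻¹ *_) xy≡0 ⟩
    x⁻¹ * 0#        ≡⟨ zeroʳ x⁻¹ ⟩
    0#              ∎

module Division (F : FiniteField) where
  open CommutativeRing (fieldRing F) hiding (zero; refl; sym; trans; _≈_)
  open Algebra.Properties.Ring ring
  open ≡ using (refl; sym; trans; cong; cong₂)
  open Polynomials F
  open Field F
  private module P = CommutativeRing polyRing
  private module FS = ℤ-Solver (fieldRing F)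
  private module PS = ℤ-Solver polyRing
  private module ≈-Reasoning = Relation.Binary.Reasoning.Setoid P.setoid

  -- A bound instead of a degree: coefficient lists may end in zeros, and the zero polynomial is
  -- covered as well.
  DegreeBelow : ℕ → Poly F → Set
  DegreeBelow d p = ∀ i → d ℕ.≤ i → coeff F p i ≡ 0#

  toPoly : ∀ {d} → Vec Carrier d → Poly F
  toPoly = Vec.toList

  toPoly-degree : ∀ {d} (v : Vec Carrier d) → DegreeBelow d (toPoly v)
  toPoly-degree []      i       _           = refl
  toPoly-degree (a ∷ v) (suc i) (ℕ.s≤s d≤i) = toPoly-degree v i d≤i

  monic-degree : ∀ {d} (v : Vec Carrier d) → DegreeBelow (suc d) (monic F v)
  monic-degree []      (suc i) _           = refl
  monic-degree (a ∷ v) (suc i) (ℕ.s≤s d≤i) = monic-degree v i d≤i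

  monic-leading : ∀ {d} (v : Vec Carrier d) → coeff F (monic F v) d ≡ 1#
  monic-leading []      = refl
  monic-leading (a ∷ v) = monic-leading v

  monic-of-degree : ∀ d p → DegreeBelow (suc d) p → coeff F p d ≡ 1# → ∃ λ (v : Vec Carrier d) → p ≈ monic F v
  monic-of-degree zero    []      below leading = [] , coefficientwise λ { zero → leading ; (suc i) → refl }
  monic-of-degree zero    (a ∷ p) below leading = [] ,
    coefficientwise λ { zero → leading ; (suc i) → below (suc i) (ℕ.s≤s ℕ.z≤n) }
  monic-of-degree (suc d) []      below leading with monic-of-degree d [] (λ _ _ → refl) leading
  ... | v , eq = (0# ∷ v) , P.trans (P.sym shift-[]) (∷-cong refl eq)
  monic-of-degree (suc d) (a ∷ p) below leading
    with monic-of-degree d p (λ i d≤i → below (suc i) (ℕ.s≤s d≤i)) leading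
  ... | v , eq = (a ∷ v) , ∷-cong refl eq

  replicate-zero : ∀ d → toPoly (Vec.replicate d 0#) ≈ []
  replicate-zero zero    = P.refl
  replicate-zero (suc d) = P.trans (∷-cong refl (replicate-zero d)) shift-[]

  -- Degrees add when one factor is monic. With m the monic factor, the product with `c ∷ s` is c m
  -- + X m s: beyond degree `d` it only sees m s, which settles the tail by induction. If the tail
  -- is zero, `c` is the leading coefficient of what remains.
  degreeBelow-cancel : ∀ {d} (v : Vec Carrier d) e s →
    DegreeBelow (d ℕ.+ e) (mulP F (monic F v) s) → DegreeBelow e s
  degreeBelow-cancel {d} v e [] below i _ = refl
  degreeBelow-cancel {d} v e (c ∷ s) below = conclude e below
    where
    open ≡.≡-Reasoning
    m = monic F v
    product : ∀ i → coeff F (mulP F m (c ∷ s)) i ≡ c * coeff F m i + coeff F (shift (mulP F m s)) i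
    product i = trans (mulP-∷ʳ m c s .coeff-≡ i)
      (trans (coeff-add (scale c m) (shift (mulP F m s)) i) (+-congʳ (coeff-scale c m i)))
    tail : ∀ i → d ℕ.≤ i → coeff F (mulP F m (c ∷ s)) (suc i) ≡ 0# → coeff F (mulP F m s) i ≡ 0#
    tail i d≤i eq = begin
      coeff F (mulP F m s) i                              ≡⟨ +-identityˡ _ ⟨
      0# + coeff F (mulP F m s) i                         ≡⟨ +-congʳ (zeroʳ c) ⟨
      c * 0# + coeff F (mulP F m s) i                     ≡⟨ +-congʳ (*-congˡ (monic-degree v (suc i) (ℕ.s≤s d≤i))) ⟨
      c * coeff F m (suc i) + coeff F (mulP F m s) i      ≡⟨ product (suc i) ⟨
      coeff F (mulP F m (c ∷ s)) (suc i)                  ≡⟨ eq ⟩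
      0#                                                  ∎
    conclude : ∀ e → DegreeBelow (d ℕ.+ e) (mulP F m (c ∷ s)) → DegreeBelow e (c ∷ s)
    conclude (suc e) below (suc i) (ℕ.s≤s e≤i) =
      degreeBelow-cancel v e s (λ j d+e≤j → tail j (ℕₚ.≤-trans (ℕₚ.m≤m+n d e) d+e≤j)
        (below (suc j) (≡.subst (ℕ._≤ suc j) (sym (ℕₚ.+-suc d e)) (ℕ.s≤s d+e≤j)))) i e≤i
    conclude zero below = λ { zero _ → head ; (suc i) _ → s≈0 i ℕ.z≤n }
      where
      below′ : DegreeBelow d (mulP F m (c ∷ s))
      below′ = ≡.subst (λ e → DegreeBelow e (mulP F m (c ∷ s))) (ℕₚ.+-identityʳ d) below
      s≈0 : DegreeBelow 0 s
      s≈0 = degreeBelow-cancel v 0 s λ i d+0≤i →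
        let d≤i = ℕₚ.≤-trans (ℕₚ.m≤m+n d 0) d+0≤i in tail i d≤i (below′ (suc i) (ℕₚ.m≤n⇒m≤1+n d≤i))
      ms≈0 : shift (mulP F m s) ≈ []
      ms≈0 = P.trans (∷-cong refl (P.trans (mulP-congʳ m (coefficientwise λ i → s≈0 i ℕ.z≤n)) (mulP-[] m))) shift-[]
      head : c ≡ 0#
      head = begin
        c                                               ≡⟨ *-identityʳ c ⟨
        c * 1#                                          ≡⟨ cong (c *_) (monic-leading v) ⟨
        c * coeff F m d                                 ≡⟨ +-identityʳ _ ⟨
        c * coeff F m d + 0#                            ≡⟨ +-congˡ (ms≈0 .coeff-≡ d) ⟨
        c * coeff F m d + coeff F (shift (mulP F m s)) d ≡⟨ product d ⟨
        coeff F (mulP F m (c ∷ s)) d                    ≡⟨ below′ d ℕₚ.≤-refl ⟩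
        0#                                              ∎

  monic∣low : ∀ {d} (v : Vec Carrier d) {p} → DegreeBelow d p → ∀ {s} → mulP F (monic F v) s ≈ p → p ≈ []
  monic∣low {d} v {p} below {s} eq = P.trans (P.sym eq)
    (P.trans (mulP-congʳ (monic F v) (coefficientwise λ i → s≈0 i ℕ.z≤n)) (mulP-[] (monic F v)))
    where
    s≈0 : DegreeBelow 0 s
    s≈0 = degreeBelow-cancel v 0 s λ i d≤i → trans (eq .coeff-≡ i) (below i (ℕₚ.≤-trans (ℕₚ.m≤m+n d 0) d≤i))

  subtract-multiple : ∀ c {d} (u v : Vec Carrier d) → (toPoly u List.++ c ∷ []) ≈
    addP F (scale c (monic F v)) (toPoly (Vec.zipWith (λ x y → x - c * y) u v))
  subtract-multiple c []      []      = ∷-cong (sym (*-identityʳ c)) P.refl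
  subtract-multiple c (x ∷ u) (y ∷ v) = ∷-cong
    (FS.solve 3 (λ c x y → x FS.:= c FS.:* y FS.:+ (x FS.:- c FS.:* y)) refl c x y) (subtract-multiple c u v)

  divMod : ∀ {d} (v : Vec Carrier d) p → ∃ λ s → ∃ λ (r : Vec Carrier d) →
    p ≈ addP F (mulP F (monic F v) s) (toPoly r)
  divMod {d} v [] = [] , Vec.replicate d 0# ,
    P.sym (P.trans (P.+-cong (mulP-[] (monic F v)) (replicate-zero d)) P.refl)
  divMod v (a ∷ p) with divMod v p
  -- `a ∷ r` has one coefficient too many for a remainder. Subtracting `c` times the divisor removes
  -- the top one, and `c` becomes the new constant coefficient of the quotient.
  ... | s , r , p≈ with Vec.initLast (a ∷ r)
  ... | u , c , ar≡uc = (c ∷ s) , Vec.zipWith (λ x y → x - c * y) u v , (begin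
    a ∷ p                                              ≈⟨ ∷-cong (sym (+-identityˡ a)) p≈ ⟩
    addP F (shift (mulP F m s)) (toPoly (a ∷ r))       ≈⟨ P.+-congˡ {shift (mulP F m s)} top ⟩
    addP F (shift (mulP F m s)) (addP F (scale c m) w) ≈⟨ PS.solve 3 (λ x y z → x PS.:+ (y PS.:+ z) PS.:= y PS.:+ x PS.:+ z) P.refl (shift (mulP F m s)) (scale c m) w ⟩
    addP F (addP F (scale c m) (shift (mulP F m s))) w ≈⟨ P.+-congʳ {w} (mulP-∷ʳ m c s) ⟨
    addP F (mulP F m (c ∷ s)) w                        ∎)
    where
    open ≈-Reasoning
    m = monic F v
    w = toPoly (Vec.zipWith (λ x y → x - c * y) u v)
    top : toPoly (a ∷ r) ≈ addP F (scale c m) w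
    top = P.trans (P.reflexive (trans (cong toPoly ar≡uc) (Vecₚ.toList-∷ʳ c u))) (subtract-multiple c u v)

  remainder : ∀ {d} → Vec Carrier d → Poly F → Vec Carrier d
  remainder v p = proj₁ (proj₂ (divMod v p))

  -- Strips trailing zeros and splits off the leading coefficient. The bound on `d` is what makes a
  -- remainder small enough for Euclid's algorithm.
  normalForm : ∀ p → p ≈ [] ⊎ ∃ λ d → d ℕ.< length p × ∃ λ c → c ≢ 0# × ∃ λ (v : Vec Carrier d) →
    p ≈ scale c (monic F v)
  normalForm [] = inj₁ P.refl
  normalForm (a ∷ p) with normalForm p
  ... | inj₂ (d , d< , c , c≢0 , v , p≈) with FiniteField.inverse F c c≢0
  ...   | c⁻¹ , cc⁻¹≡1 = inj₂ (suc d , ℕ.s≤s d< , c , c≢0 , (c⁻¹ * a ∷ v) , ∷-cong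
          (sym (trans (sym (*-assoc c c⁻¹ a)) (trans (cong (_* a) cc⁻¹≡1) (*-identityˡ a)))) p≈)
  normalForm (a ∷ p) | inj₁ p≈[] with a ≟ 0#
  ... | yes a≡0 = inj₁ (P.trans (∷-cong a≡0 p≈[]) shift-[])
  ... | no a≢0  = inj₂ (0 , ℕ.s≤s ℕ.z≤n , a , a≢0 , [] , ∷-cong (sym (*-identityʳ a)) p≈[])

  infix 4 _∣_
  _∣_ : Poly F → Poly F → Set
  f ∣ p = ∃ λ s → mulP F f s ≈ p

  fromDefs-∣ : ∀ {f p} → _∣ₚ_ F f p → f ∣ p
  fromDefs-∣ (s , eq) = s , coefficientwise eq

  toDefs-∣ : ∀ {f p} → f ∣ p → _∣ₚ_ F f p
  toDefs-∣ (s , eq) = s , eq .coeff-≡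

  ∣-respʳ : ∀ {f p r} → p ≈ r → f ∣ p → f ∣ r
  ∣-respʳ p≈r (s , eq) = s , P.trans eq p≈r

  ∣-+* : ∀ {g p r} s t → g ∣ p → g ∣ r → g ∣ addP F (mulP F p s) (mulP F r t)
  ∣-+* {g} {p} {r} s t (a , ga≈p) (b , gb≈r) = addP F (mulP F a s) (mulP F b t) , P.trans
    (PS.solve 5 (λ g a b s t → g PS.:* (a PS.:* s PS.:+ b PS.:* t) PS.:= (g PS.:* a) PS.:* s PS.:+ (g PS.:* b) PS.:* t)
      P.refl g a b s t)
    (P.+-cong (P.*-congʳ ga≈p) (P.*-congʳ gb≈r))

  scale≈* : ∀ c p → scale c p ≈ mulP F p (c ∷ [])
  scale≈* c p = P.trans (P.sym (mulP-constant c p)) (P.*-comm _ _)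

  constant-inverse : ∀ {c} → c ≢ 0# → ∃ λ c⁻¹ → mulP F (c ∷ []) (c⁻¹ ∷ []) ≈ oneP F
  constant-inverse {c} c≢0 with FiniteField.inverse F c c≢0
  ... | c⁻¹ , eq = c⁻¹ , ∷-cong (trans (+-identityʳ _) eq) P.refl

  record Bézout (p r : Poly F) : Set where
    field
      gcd s t : Poly F
      gcd∣p   : gcd ∣ p
      gcd∣r   : gcd ∣ r
      identity : gcd ≈ addP F (mulP F p s) (mulP F r t)

  -- Euclid's algorithm with a monic second argument: a nonzero remainder is made monic before the
  -- recursive call, and `n` is a strict bound on the degree.
  bézout : ∀ n p {d} (v : Vec Carrier d) → d ℕ.< n → Bézout p (monic F v)
  bézout (suc n) p {d} v (ℕ.s≤s d≤n) with divMod v p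
  ... | s , r , p≈ with normalForm (toPoly r)
  ... | inj₁ r≈[] = record
    { gcd = m ; s = [] ; t = oneP F
    ; gcd∣p = s , P.trans (P.sym (P.+-identityʳ _)) (P.sym (P.trans p≈ (P.+-congˡ r≈[])))
    ; gcd∣r = oneP F , P.*-identityʳ m
    ; identity = P.sym (P.trans (P.+-cong (mulP-[] p) (P.*-identityʳ m)) P.refl) }
    where m = monic F v
  ... | inj₂ (e , e<lr , c , c≢0 , w , r≈) = record
    -- Back substitution: the recursive identity expresses the gcd by `m` and the monic remainder
    -- `w`, and `w` is (p - m s) c⁻¹.
    { gcd = B.gcd ; s = mulP F c⁻¹ B.t ; t = addP F B.s (negP F (mulP F s (mulP F c⁻¹ B.t)))
    ; gcd∣p = ∣-respʳ {B.gcd} (P.trans (P.+-congˡ {mulP F m s} (P.sym r≈wc)) (P.sym p≈)) (∣-+* {B.gcd} s (c ∷ []) B.gcd∣p B.gcd∣r)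
    ; gcd∣r = B.gcd∣p
    ; identity = begin
        B.gcd
          ≈⟨ B.identity ⟩
        addP F (mulP F m B.s) (mulP F (monic F w) B.t)
          ≈⟨ P.+-congˡ (P.*-congʳ w≈rc⁻¹) ⟩
        addP F (mulP F m B.s) (mulP F (mulP F (toPoly r) c⁻¹) B.t)
          ≈⟨ P.+-congˡ (P.*-congʳ (P.*-congʳ r≈p-ms)) ⟩
        addP F (mulP F m B.s) (mulP F (mulP F (addP F p (negP F (mulP F m s))) c⁻¹) B.t)
          ≈⟨ PS.solve 6 (λ m a p s c b → m PS.:* a PS.:+ ((p PS.:- m PS.:* s) PS.:* c) PS.:* b
               PS.:= p PS.:* (c PS.:* b) PS.:+ m PS.:* (a PS.:- s PS.:* (c PS.:* b))) P.refl m B.s p s c⁻¹ B.t ⟩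
        addP F (mulP F p (mulP F c⁻¹ B.t)) (mulP F m (addP F B.s (negP F (mulP F s (mulP F c⁻¹ B.t))))) ∎ }
    where
    open ≈-Reasoning
    m = monic F v
    module B = Bézout (bézout n m w (ℕₚ.<-≤-trans (≡.subst (e ℕ.<_) (Vecₚ.length-toList r) e<lr) d≤n))
    c⁻¹ = proj₁ (constant-inverse c≢0) ∷ []
    r≈wc : toPoly r ≈ mulP F (monic F w) (c ∷ [])
    r≈wc = P.trans r≈ (scale≈* c (monic F w))
    w≈rc⁻¹ : monic F w ≈ mulP F (toPoly r) c⁻¹
    w≈rc⁻¹ = begin
      monic F w                                   ≈⟨ P.*-identityʳ (monic F w) ⟨
      mulP F (monic F w) (oneP F)                 ≈⟨ P.*-congˡ {monic F w} (proj₂ (constant-inverse c≢0)) ⟨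
      mulP F (monic F w) (mulP F (c ∷ []) c⁻¹)    ≈⟨ P.*-assoc (monic F w) (c ∷ []) c⁻¹ ⟨
      mulP F (mulP F (monic F w) (c ∷ [])) c⁻¹    ≈⟨ P.*-congʳ r≈wc ⟨
      mulP F (toPoly r) c⁻¹                       ∎
    r≈p-ms : toPoly r ≈ addP F p (negP F (mulP F m s))
    r≈p-ms = P.trans (PS.solve 2 (λ r x → r PS.:= (x PS.:+ r) PS.:- x) P.refl (toPoly r) (mulP F m s))
      (P.+-congʳ (P.sym p≈))

  -- The gcd g of `p` and the irreducible polynomial leaves a cofactor. Either g is a unit, and the
  -- Bézout identity can be normalised to 1, or the cofactor is a unit, and the polynomial divides
  -- everything that g divides.
  irreducible-coprime : ∀ {d} (v : Vec Carrier d) → Irreducible F (monic F v) → ∀ p →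
    monic F v ∣ p ⊎ ∃ λ s → ∃ λ t → addP F (mulP F p s) (mulP F (monic F v) t) ≈ oneP F
  irreducible-coprime {d} v (_ , _ , irr) p with bézout (suc d) p v (ℕₚ.n<1+n d)
  ... | record { gcd = g ; s = s ; t = t ; gcd∣p = a , ga≈p ; gcd∣r = b , gb≈f ; identity = g≈ }
    with irr g b (P.sym gb≈f .coeff-≡)
  ... | inj₁ (h , gh≈1) = inj₂ (mulP F s h , mulP F t h , (begin
    addP F (mulP F p (mulP F s h)) (mulP F (monic F v) (mulP F t h))
      ≈⟨ PS.solve 5 (λ p s f t h → p PS.:* (s PS.:* h) PS.:+ f PS.:* (t PS.:* h) PS.:= (p PS.:* s PS.:+ f PS.:* t) PS.:* h)
           P.refl p s (monic F v) t h ⟩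
    mulP F (addP F (mulP F p s) (mulP F (monic F v) t)) h ≈⟨ P.*-congʳ g≈ ⟨
    mulP F g h                                            ≈⟨ coefficientwise gh≈1 ⟩
    oneP F                                                ∎))
    where open ≈-Reasoning
  ... | inj₂ (h , bh≈1) = inj₁ (mulP F h a , (begin
    mulP F (monic F v) (mulP F h a)     ≈⟨ P.*-congʳ gb≈f ⟨
    mulP F (mulP F g b) (mulP F h a)    ≈⟨ PS.solve 4 (λ g b h a → (g PS.:* b) PS.:* (h PS.:* a) PS.:= g PS.:* (b PS.:* h) PS.:* a) P.refl g b h a ⟩
    mulP F (mulP F g (mulP F b h)) a    ≈⟨ P.*-congʳ {a} (P.*-congˡ {g} (coefficientwise bh≈1)) ⟩
    mulP F (mulP F g (oneP F)) a        ≈⟨ P.*-congʳ {a} (P.*-identityʳ g) ⟩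
    mulP F g a                          ≈⟨ ga≈p ⟩
    p                                   ∎))
    where open ≈-Reasoning

  -- A factor of full degree leaves only a constant cofactor.
  factor-degree : ∀ {m} (v : Vec Carrier m) g h → monic F v ≈ mulP F g h →
    IsUnitP F h ⊎ ∃ λ d → d ℕ.< m × ∃ λ c → c ≢ 0# × ∃ λ (u : Vec Carrier d) → g ≈ scale c (monic F u)
  factor-degree {m} v g h v≈gh with normalForm g
  ... | inj₁ g≈[] = contradiction
    (trans (sym (monic-leading v)) (trans (v≈gh .coeff-≡ m) (P.*-congʳ g≈[] .coeff-≡ m)))
    (λ 1≡0 → FiniteField.0≢1 F (sym 1≡0))
  ... | inj₂ (d , _ , c , c≢0 , u , g≈) with d ℕₚ.<? m
  ...   | yes d<m = inj₂ (d , d<m , c , c≢0 , u , g≈)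
  ...   | no d≮m  = inj₁ (unit h v≈gh (degreeBelow-cancel u 1 h below))
    where
    m≤d = ℕₚ.≮⇒≥ d≮m
    v≈ : monic F v ≈ scale c (mulP F (monic F u) h)
    v≈ = P.trans v≈gh (P.trans (P.*-congʳ g≈) (mulP-scale c (monic F u) h))
    below : DegreeBelow (d ℕ.+ 1) (mulP F (monic F u) h)
    below i d+1≤i = zero-product
      (trans (sym (coeff-scale c (mulP F (monic F u) h) i)) (trans (sym (v≈ .coeff-≡ i)) (monic-degree v i
        (ℕₚ.≤-trans (ℕ.s≤s m≤d) (≡.subst (ℕ._≤ i) (ℕₚ.+-comm d 1) d+1≤i))))) c≢0
    unit : ∀ h → monic F v ≈ mulP F g h → DegreeBelow 1 h → IsUnitP F h
    unit h v≈gh below with coeff F h 0 ≟ 0#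
    ... | yes h₀≡0 = contradiction
      (trans (sym (monic-leading v)) (trans (v≈gh .coeff-≡ m) (P.trans (mulP-congʳ g h≈[]) (mulP-[] g) .coeff-≡ m)))
      (λ 1≡0 → FiniteField.0≢1 F (sym 1≡0))
      where
      h≈[] : h ≈ []
      h≈[] .coeff-≡ zero    = h₀≡0
      h≈[] .coeff-≡ (suc i) = below (suc i) (ℕ.s≤s ℕ.z≤n)
    ... | no h₀≢0 with constant-inverse h₀≢0
    ...   | h₀⁻¹ , eq = (h₀⁻¹ ∷ []) , P.trans (P.*-congʳ h≈h₀) eq .coeff-≡
      where
      h≈h₀ : h ≈ (coeff F h 0 ∷ [])
      h≈h₀ .coeff-≡ zero    = refl
      h≈h₀ .coeff-≡ (suc i) = below (suc i) (ℕ.s≤s ℕ.z≤n)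

-- Modules over F[X], annihilators, and operators on tuples of blocks.

module Operators (F : FiniteField) where
  open CommutativeRing (fieldRing F) hiding (zero; refl; sym; trans; _≈_)
  open Algebra.Properties.Ring ring
  open ≡ using (refl; sym; trans; cong; cong₂)
  open ≡.≡-Reasoning
  open Polynomials F
  open Division F
  open Field F
  private module P = CommutativeRing polyRing

  -- A vector space with an endomorphism, i.e. a module over F[X].
  record Operator : Set₁ where
    infixl 6 _⊕_
    infixr 7 _·_
    field
      V   : Set
      _⊕_ : V → V → V
      𝟎   : V
      _·_ : Carrier → V → V
      op  : V → V
      ⊕-assoc     : ∀ u v w → u ⊕ v ⊕ w ≡ u ⊕ (v ⊕ w)
      ⊕-comm      : ∀ u v → u ⊕ v ≡ v ⊕ u
      ⊕-identityˡ : ∀ v → 𝟎 ⊕ v ≡ v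
      ·-⊕         : ∀ a u v → a · (u ⊕ v) ≡ a · u ⊕ a · v
      +-·         : ∀ a b v → (a + b) · v ≡ a · v ⊕ b · v
      *-·         : ∀ a b v → (a * b) · v ≡ a · b · v
      1-·         : ∀ v → 1# · v ≡ v
      0-·         : ∀ v → 0# · v ≡ 𝟎
      op-⊕        : ∀ u v → op (u ⊕ v) ≡ op u ⊕ op v
      op-·        : ∀ a v → op (a · v) ≡ a · op v

    ⊕-identityʳ : ∀ v → v ⊕ 𝟎 ≡ v
    ⊕-identityʳ v = trans (⊕-comm v 𝟎) (⊕-identityˡ v)

    ·-𝟎 : ∀ a → a · 𝟎 ≡ 𝟎
    ·-𝟎 a = trans (cong (a ·_) (sym (0-· 𝟎))) (trans (sym (*-· a 0# 𝟎)) (trans (cong (_· 𝟎) (zeroʳ a)) (0-· 𝟎)))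

    op-𝟎 : op 𝟎 ≡ 𝟎
    op-𝟎 = trans (cong op (sym (0-· 𝟎))) (trans (op-· 0# 𝟎) (0-· (op 𝟎)))

    ⊕-interchange : ∀ u v w z → (u ⊕ v) ⊕ (w ⊕ z) ≡ (u ⊕ w) ⊕ (v ⊕ z)
    ⊕-interchange u v w z = begin
      (u ⊕ v) ⊕ (w ⊕ z)  ≡⟨ ⊕-assoc u v (w ⊕ z) ⟩
      u ⊕ (v ⊕ (w ⊕ z))  ≡⟨ cong (u ⊕_) (⊕-assoc v w z) ⟨
      u ⊕ (v ⊕ w ⊕ z)    ≡⟨ cong (λ x → u ⊕ (x ⊕ z)) (⊕-comm v w) ⟩
      u ⊕ (w ⊕ v ⊕ z)    ≡⟨ cong (u ⊕_) (⊕-assoc w v z) ⟩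
      u ⊕ (w ⊕ (v ⊕ z))  ≡⟨ ⊕-assoc u w (v ⊕ z) ⟨
      (u ⊕ w) ⊕ (v ⊕ z)  ∎

    ⊕-inverse : ∀ v → v ⊕ (- 1#) · v ≡ 𝟎
    ⊕-inverse v = begin
      v ⊕ (- 1#) · v        ≡⟨ cong (_⊕ (- 1#) · v) (1-· v) ⟨
      1# · v ⊕ (- 1#) · v   ≡⟨ +-· 1# (- 1#) v ⟨
      (1# + - 1#) · v       ≡⟨ cong (_· v) (-‿inverseʳ 1#) ⟩
      0# · v                ≡⟨ 0-· v ⟩
      𝟎                     ∎

    difference-𝟎 : ∀ {u v} → u ⊕ (- 1#) · v ≡ 𝟎 → u ≡ v
    difference-𝟎 {u} {v} eq = begin
      u                            ≡⟨ ⊕-identityʳ u ⟨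
      u ⊕ 𝟎                        ≡⟨ cong (u ⊕_) (⊕-inverse v) ⟨
      u ⊕ (v ⊕ (- 1#) · v)         ≡⟨ cong (u ⊕_) (⊕-comm v _) ⟩
      u ⊕ ((- 1#) · v ⊕ v)         ≡⟨ ⊕-assoc u _ v ⟨
      u ⊕ (- 1#) · v ⊕ v           ≡⟨ cong (_⊕ v) eq ⟩
      𝟎 ⊕ v                        ≡⟨ ⊕-identityˡ v ⟩
      v                            ∎

    ·-cancel : ∀ {a v} → a ≢ 0# → a · v ≡ 𝟎 → v ≡ 𝟎
    ·-cancel {a} {v} a≢0 av≡𝟎 with FiniteField.inverse F a a≢0
    ... | a⁻¹ , eq = begin
      v               ≡⟨ 1-· v ⟨
      1# · v          ≡⟨ cong (_· v) (trans (*-comm a⁻¹ a) eq) ⟨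
      (a⁻¹ * a) · v   ≡⟨ *-· a⁻¹ a v ⟩
      a⁻¹ · a · v     ≡⟨ cong (a⁻¹ ·_) av≡𝟎 ⟩
      a⁻¹ · 𝟎         ≡⟨ ·-𝟎 a⁻¹ ⟩
      𝟎               ∎

    act : Poly F → V → V
    act []      v = 𝟎
    act (a ∷ p) v = a · v ⊕ op (act p v)

    act-⊕ : ∀ p u v → act p (u ⊕ v) ≡ act p u ⊕ act p v
    act-⊕ []      u v = sym (⊕-identityˡ 𝟎)
    act-⊕ (a ∷ p) u v = begin
      a · (u ⊕ v) ⊕ op (act p (u ⊕ v))
        ≡⟨ cong₂ _⊕_ (·-⊕ a u v) (trans (cong op (act-⊕ p u v)) (op-⊕ _ _)) ⟩
      (a · u ⊕ a · v) ⊕ (op (act p u) ⊕ op (act p v))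
        ≡⟨ ⊕-interchange _ _ _ _ ⟩
      act (a ∷ p) u ⊕ act (a ∷ p) v ∎

    act-· : ∀ p a v → act p (a · v) ≡ a · act p v
    act-· []      a v = sym (·-𝟎 a)
    act-· (b ∷ p) a v = begin
      b · a · v ⊕ op (act p (a · v))
        ≡⟨ cong₂ _⊕_ (trans (sym (*-· b a v)) (trans (cong (_· v) (*-comm b a)) (*-· a b v)))
             (trans (cong op (act-· p a v)) (op-· a _)) ⟩
      a · b · v ⊕ a · op (act p v)
        ≡⟨ ·-⊕ a _ _ ⟨
      a · act (b ∷ p) v ∎

    act-𝟎 : ∀ p → act p 𝟎 ≡ 𝟎
    act-𝟎 p = trans (cong (act p) (sym (0-· 𝟎))) (trans (act-· p 0# 𝟎) (0-· _))

    act-op : ∀ p v → act p (op v) ≡ op (act p v)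
    act-op []      v = sym op-𝟎
    act-op (a ∷ p) v = trans (cong₂ _⊕_ (sym (op-· a v)) (cong op (act-op p v))) (sym (op-⊕ _ _))

    act-addP : ∀ p r v → act (addP F p r) v ≡ act p v ⊕ act r v
    act-addP []      r       v = sym (⊕-identityˡ _)
    act-addP (a ∷ p) []      v = sym (⊕-identityʳ _)
    act-addP (a ∷ p) (b ∷ r) v = begin
      (a + b) · v ⊕ op (act (addP F p r) v)
        ≡⟨ cong₂ _⊕_ (+-· a b v) (trans (cong op (act-addP p r v)) (op-⊕ _ _)) ⟩
      (a · v ⊕ b · v) ⊕ (op (act p v) ⊕ op (act r v))
        ≡⟨ ⊕-interchange _ _ _ _ ⟩
      act (a ∷ p) v ⊕ act (b ∷ r) v ∎

    act-scale : ∀ a p v → act (scale a p) v ≡ a · act p v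
    act-scale a []      v = sym (·-𝟎 a)
    act-scale a (b ∷ p) v =
      trans (cong₂ _⊕_ (*-· a b v) (trans (cong op (act-scale a p v)) (op-· a _))) (sym (·-⊕ a _ _))

    act-shift : ∀ p v → act (shift p) v ≡ op (act p v)
    act-shift p v = trans (cong (_⊕ op (act p v)) (0-· v)) (⊕-identityˡ _)

    act-mulP : ∀ p r v → act (mulP F p r) v ≡ act p (act r v)
    act-mulP []      r v = refl
    act-mulP (a ∷ p) r v = trans (act-addP (scale a r) (shift (mulP F p r)) v)
      (cong₂ _⊕_ (act-scale a r v) (trans (act-shift (mulP F p r) v) (cong op (act-mulP p r v))))

    act-≈[] : ∀ p v → p ≈ [] → act p v ≡ 𝟎
    act-≈[] []      v eq = refl
    act-≈[] (a ∷ p) v eq = begin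
      a · v ⊕ op (act p v)
        ≡⟨ cong₂ (λ b w → b · v ⊕ op w) (eq .coeff-≡ 0) (act-≈[] p v (coefficientwise λ i → eq .coeff-≡ (suc i))) ⟩
      0# · v ⊕ op 𝟎   ≡⟨ cong₂ _⊕_ (0-· v) op-𝟎 ⟩
      𝟎 ⊕ 𝟎           ≡⟨ ⊕-identityˡ 𝟎 ⟩
      𝟎               ∎

    act-cong : ∀ {p r} v → p ≈ r → act p v ≡ act r v
    act-cong {[]}    {r}     v eq = sym (act-≈[] r v (P.sym eq))
    act-cong {a ∷ p} {[]}    v eq = act-≈[] (a ∷ p) v eq
    act-cong {a ∷ p} {b ∷ r} v eq = cong₂ (λ c w → c · v ⊕ op w) (eq .coeff-≡ 0)
      (act-cong {p} {r} v (coefficientwise λ i → eq .coeff-≡ (suc i)))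

    act-negP : ∀ p v → act (negP F p) v ≡ (- 1#) · act p v
    act-negP p v = trans (act-cong {negP F p} {scale (- 1#) p} v (coefficientwise λ i → trans (coeff-neg p i)
      (trans (sym (-1*x≈-x _)) (sym (coeff-scale (- 1#) p i))))) (act-scale (- 1#) p v)

    act-oneP : ∀ v → act (oneP F) v ≡ v
    act-oneP v = trans (cong₂ _⊕_ (1-· v) op-𝟎) (⊕-identityʳ v)

    act-X : ∀ v → act X v ≡ op v
    act-X v = trans (act-shift (oneP F) v) (cong op (act-oneP v))

    act-comm : ∀ p r v → act p (act r v) ≡ act r (act p v)
    act-comm p r v = trans (sym (act-mulP p r v)) (trans (act-cong v (P.*-comm p r)) (act-mulP r p v))

    act-X^-minus-one : ∀ e v → act (xPowMinusOne F e) v ≡ 𝟎 → act (X Pow.^ e) v ≡ v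
    act-X^-minus-one e v eq = difference-𝟎 (begin
      act (X Pow.^ e) v ⊕ (- 1#) · v
        ≡⟨ cong (act (X Pow.^ e) v ⊕_) (trans (act-negP (oneP F) v) (cong ((- 1#) ·_) (act-oneP v))) ⟨
      act (X Pow.^ e) v ⊕ act (negP F (oneP F)) v
        ≡⟨ act-addP (X Pow.^ e) (negP F (oneP F)) v ⟨
      act (addP F (X Pow.^ e) (negP F (oneP F))) v
        ≡⟨ act-cong v (xPowMinusOne≈ e) ⟨
      act (xPowMinusOne F e) v
        ≡⟨ eq ⟩
      𝟎 ∎)

    X^-minus-one-act : ∀ e v → act (X Pow.^ e) v ≡ v → act (xPowMinusOne F e) v ≡ 𝟎
    X^-minus-one-act e v eq = begin
      act (xPowMinusOne F e) v
        ≡⟨ act-cong v (xPowMinusOne≈ e) ⟩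
      act (addP F (X Pow.^ e) (negP F (oneP F))) v
        ≡⟨ act-addP (X Pow.^ e) (negP F (oneP F)) v ⟩
      act (X Pow.^ e) v ⊕ act (negP F (oneP F)) v
        ≡⟨ cong₂ _⊕_ eq (trans (act-negP (oneP F) v) (cong ((- 1#) ·_) (act-oneP v))) ⟩
      v ⊕ (- 1#) · v
        ≡⟨ ⊕-inverse v ⟩
      𝟎 ∎

    ∣⇒act-𝟎 : ∀ {f p v} → act f v ≡ 𝟎 → f ∣ p → act p v ≡ 𝟎
    ∣⇒act-𝟎 {f} {p} {v} fv≡𝟎 (s , fs≈p) = begin
      act p v            ≡⟨ act-cong v fs≈p ⟨
      act (mulP F f s) v ≡⟨ act-cong v (P.*-comm f s) ⟩
      act (mulP F s f) v ≡⟨ act-mulP s f v ⟩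
      act s (act f v)    ≡⟨ cong (act s) fv≡𝟎 ⟩
      act s 𝟎            ≡⟨ act-𝟎 s ⟩
      𝟎                  ∎

    module Irreducible-annihilator {d} (f : Vec Carrier d) (irr : Irreducible F (monic F f))
      {v : V} (v≢𝟎 : v ≢ 𝟎) (fv≡𝟎 : act (monic F f) v ≡ 𝟎) where

      -- Otherwise a Bézout identity would write `v` as a sum of two vectors that vanish with `p`
      -- and `f`. So `f` generates the annihilator of `v`, and the orbit of `v` is a copy of
      -- F[X]/(f).
      act-𝟎⇒∣ : ∀ p → act p v ≡ 𝟎 → monic F f ∣ p
      act-𝟎⇒∣ p pv≡𝟎 with irreducible-coprime f irr p
      ... | inj₁ f∣p = f∣p
      ... | inj₂ (s , t , ps+ft≈1) = contradiction (begin
        v                                                       ≡⟨ act-oneP v ⟨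
        act (oneP F) v                                          ≡⟨ act-cong v ps+ft≈1 ⟨
        act (addP F (mulP F p s) (mulP F (monic F f) t)) v      ≡⟨ act-addP (mulP F p s) _ v ⟩
        act (mulP F p s) v ⊕ act (mulP F (monic F f) t) v       ≡⟨ cong₂ _⊕_ (∣⇒act-𝟎 {p} pv≡𝟎 (s , P.refl))
                                                                     (∣⇒act-𝟎 {monic F f} fv≡𝟎 (t , P.refl)) ⟩
        𝟎 ⊕ 𝟎                                                   ≡⟨ ⊕-identityˡ 𝟎 ⟩
        𝟎                                                       ∎) v≢𝟎

      -- The difference kills `v`, hence is a multiple of `f`, but its degree is below that of `f`.
      act-injective : ∀ {a b : Vec Carrier d} → act (toPoly a) v ≡ act (toPoly b) v → a ≡ b
      act-injective {a} {b} eq = toPoly-injective (coefficientwise λ i → x∙y⁻¹≈ε⇒x≈y _ _ (begin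
        coeff F (toPoly a) i + - coeff F (toPoly b) i
          ≡⟨ cong (coeff F (toPoly a) i +_) (coeff-neg (toPoly b) i) ⟨
        coeff F (toPoly a) i + coeff F (negP F (toPoly b)) i
          ≡⟨ coeff-add (toPoly a) (negP F (toPoly b)) i ⟨
        coeff F difference i
          ≡⟨ monic∣low f below (proj₂ divides) .coeff-≡ i ⟩
        0# ∎))
        where
        difference = addP F (toPoly a) (negP F (toPoly b))
        toPoly-injective : ∀ {k} {a b : Vec Carrier k} → toPoly a ≈ toPoly b → a ≡ b
        toPoly-injective {a = []}    {[]}    _  = refl
        toPoly-injective {a = x ∷ a} {y ∷ b} eq =
          cong₂ _∷_ (eq .coeff-≡ 0) (toPoly-injective (coefficientwise λ i → eq .coeff-≡ (suc i)))
        divides : monic F f ∣ difference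
        divides = act-𝟎⇒∣ difference (begin
          act difference v                                  ≡⟨ act-addP (toPoly a) (negP F (toPoly b)) v ⟩
          act (toPoly a) v ⊕ act (negP F (toPoly b)) v      ≡⟨ cong₂ _⊕_ eq (act-negP (toPoly b) v) ⟩
          act (toPoly b) v ⊕ (- 1#) · act (toPoly b) v      ≡⟨ ⊕-inverse _ ⟩
          𝟎                                                 ∎)
        below : DegreeBelow d difference
        below i d≤i = begin
          coeff F difference i ≡⟨ coeff-add (toPoly a) (negP F (toPoly b)) i ⟩
          coeff F (toPoly a) i + coeff F (negP F (toPoly b)) i
            ≡⟨ cong₂ _+_ (toPoly-degree a i d≤i) (trans (coeff-neg (toPoly b) i) (cong -_ (toPoly-degree b i d≤i))) ⟩
          0# + - 0#  ≡⟨ -‿inverseʳ 0# ⟩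
          0#         ∎

      -- The q^d polynomials of degree below d give distinct vectors, and the space has no more than
      -- q^d of them.
      act-surjective : DecidableEquality V → ∀ {vs : List V} → (∀ u → u ∈ vs) → length vs ℕ.≤ FiniteField.size F ℕ.^ d →
        ∀ u → ∃ λ (a : Vec Carrier d) → act (toPoly a) v ≡ u
      act-surjective _≟ⱽ_ {vs} complete vs≤ u = surjective-onto _≟ⱽ_ (λ a → act (toPoly a) v) act-injective
        {allVecs (FiniteField.elements F) d} {vs}
        (allVecs-unique (FiniteField.elements-unique F) d) (λ a → complete (act (toPoly a) v))
        (≡.subst (length vs ℕ.≤_) (sym (length-allVecs (FiniteField.elements F) d)) vs≤)
        (complete u)

    act-remainder : ∀ {d} (f : Vec Carrier d) {v} → act (monic F f) v ≡ 𝟎 →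
      ∀ p → act p v ≡ act (toPoly (remainder f p)) v
    act-remainder f {v} fv≡𝟎 p with divMod f p
    ... | s , a , p≈ = begin
      act p v                                              ≡⟨ act-cong v p≈ ⟩
      act (addP F (mulP F (monic F f) s) (toPoly a)) v     ≡⟨ act-addP (mulP F (monic F f) s) (toPoly a) v ⟩
      act (mulP F (monic F f) s) v ⊕ act (toPoly a) v      ≡⟨ cong (_⊕ act (toPoly a) v) (∣⇒act-𝟎 {monic F f} fv≡𝟎 (s , P.refl)) ⟩
      𝟎 ⊕ act (toPoly a) v                                 ≡⟨ ⊕-identityˡ _ ⟩
      act (toPoly a) v                                     ∎

    iterate : ℕ → V → V
    iterate zero    v = v
    iterate (suc i) v = iterate i (op v)

  record Intertwiner (M N : Operator) : Set where
    private
      module M = Operator M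
      module N = Operator N
    field
      φ    : M.V → N.V
      φ-⊕  : ∀ u v → φ (u M.⊕ v) ≡ φ u N.⊕ φ v
      φ-·  : ∀ a v → φ (a M.· v) ≡ a N.· φ v
      φ-op : ∀ v → φ (M.op v) ≡ N.op (φ v)

    φ-𝟎 : φ M.𝟎 ≡ N.𝟎
    φ-𝟎 = trans (cong φ (sym (M.0-· M.𝟎))) (trans (φ-· 0# M.𝟎) (N.0-· _))

    φ-act : ∀ p v → φ (M.act p v) ≡ N.act p (φ v)
    φ-act []      v = φ-𝟎
    φ-act (a ∷ p) v = trans (φ-⊕ _ _) (cong₂ N._⊕_ (φ-· a v) (trans (φ-op _) (cong N.op (φ-act p v))))

  module Blocks (M : Operator) where
    open Operator M

    combine : ∀ {n} → Vec Carrier n → Vec V n → V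
    combine []      []      = 𝟎
    combine (c ∷ cs) (x ∷ xs) = c · x ⊕ combine cs xs

    combine-⊕ : ∀ {n} (cs : Vec Carrier n) xs ys →
      combine cs (Vec.zipWith _⊕_ xs ys) ≡ combine cs xs ⊕ combine cs ys
    combine-⊕ []       []       []       = sym (⊕-identityˡ 𝟎)
    combine-⊕ (c ∷ cs) (x ∷ xs) (y ∷ ys) =
      trans (cong₂ _⊕_ (·-⊕ c x y) (combine-⊕ cs xs ys)) (⊕-interchange _ _ _ _)

    ·-swap : ∀ a b v → a · b · v ≡ b · a · v
    ·-swap a b v = trans (sym (*-· a b v)) (trans (cong (_· v) (*-comm a b)) (*-· b a v))

    combine-· : ∀ {n} (cs : Vec Carrier n) a xs → combine cs (Vec.map (a ·_) xs) ≡ a · combine cs xs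
    combine-· []       a []       = sym (·-𝟎 a)
    combine-· (c ∷ cs) a (x ∷ xs) =
      trans (cong₂ _⊕_ (·-swap c a x) (combine-· cs a xs)) (sym (·-⊕ a _ _))

    combine-op : ∀ {n} (cs : Vec Carrier n) xs → combine cs (Vec.map op xs) ≡ op (combine cs xs)
    combine-op []       []       = sym op-𝟎
    combine-op (c ∷ cs) (x ∷ xs) =
      trans (cong₂ _⊕_ (sym (op-· c x)) (combine-op cs xs)) (sym (op-⊕ _ _))

    -- The vector space of `n`-tuples over `V` with an arbitrary linear endomorphism. It is used
    -- twice: over the field itself for row vectors, and over row vectors for states of the
    -- register.
    blockwise : (n : ℕ) (next : Vec V n → Vec V n) →
      (∀ xs ys → next (Vec.zipWith _⊕_ xs ys) ≡ Vec.zipWith _⊕_ (next xs) (next ys)) →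
      (∀ a xs → next (Vec.map (a ·_) xs) ≡ Vec.map (a ·_) (next xs)) → Operator
    blockwise n next next-⊕ next-· = record
      { V = Vec V n ; _⊕_ = Vec.zipWith _⊕_ ; 𝟎 = Vec.replicate n 𝟎 ; _·_ = λ a → Vec.map (a ·_) ; op = next
      ; ⊕-assoc = Vecₚ.zipWith-assoc ⊕-assoc
      ; ⊕-comm = Vecₚ.zipWith-comm ⊕-comm
      ; ⊕-identityˡ = Vecₚ.zipWith-identityˡ ⊕-identityˡ
      ; ·-⊕ = λ { a [] [] → refl ; a (x ∷ xs) (y ∷ ys) → cong₂ _∷_ (·-⊕ a x y) (map-⊕ a xs ys) }
      ; +-· = +-map
      ; *-· = λ a b v → trans (Vecₚ.map-cong (*-· a b) v) (Vecₚ.map-∘ (a ·_) (b ·_) v)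
      ; 1-· = λ v → trans (Vecₚ.map-cong 1-· v) (Vecₚ.map-id v)
      ; 0-· = λ v → trans (Vecₚ.map-cong 0-· v) (Vecₚ.map-const v 𝟎)
      ; op-⊕ = next-⊕ ; op-· = next-· }
      where
      map-⊕ : ∀ {k} a (xs ys : Vec V k) →
        Vec.map (a ·_) (Vec.zipWith _⊕_ xs ys) ≡ Vec.zipWith _⊕_ (Vec.map (a ·_) xs) (Vec.map (a ·_) ys)
      map-⊕ a []       []       = refl
      map-⊕ a (x ∷ xs) (y ∷ ys) = cong₂ _∷_ (·-⊕ a x y) (map-⊕ a xs ys)
      +-map : ∀ {k} a b (xs : Vec V k) →
        Vec.map ((a + b) ·_) xs ≡ Vec.zipWith _⊕_ (Vec.map (a ·_) xs) (Vec.map (b ·_) xs)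
      +-map a b []       = refl
      +-map a b (x ∷ xs) = cong₂ _∷_ (+-· a b x) (+-map a b xs)

    diagonal : ℕ → Operator
    diagonal n = blockwise n (Vec.map op) additive (λ a → homogeneous a)
      where
      additive : ∀ {k} (xs ys : Vec V k) →
        Vec.map op (Vec.zipWith _⊕_ xs ys) ≡ Vec.zipWith _⊕_ (Vec.map op xs) (Vec.map op ys)
      additive []       []       = refl
      additive (x ∷ xs) (y ∷ ys) = cong₂ _∷_ (op-⊕ x y) (additive xs ys)
      homogeneous : ∀ a {k} (xs : Vec V k) → Vec.map op (Vec.map (a ·_) xs) ≡ Vec.map (a ·_) (Vec.map op xs)
      homogeneous a []       = refl
      homogeneous a (x ∷ xs) = cong₂ _∷_ (op-· a x) (homogeneous a xs)

    step : ∀ {n} → Vec Carrier (suc n) → Vec V (suc n) → Vec V (suc n)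
    step c (x ∷ xs) = xs Vec.∷ʳ op (combine c (x ∷ xs))

    zipWith-∷ʳ : ∀ {n} (xs ys : Vec V n) x y →
      Vec.zipWith _⊕_ (xs Vec.∷ʳ x) (ys Vec.∷ʳ y) ≡ Vec.zipWith _⊕_ xs ys Vec.∷ʳ (x ⊕ y)
    zipWith-∷ʳ []       []       x y = refl
    zipWith-∷ʳ (z ∷ xs) (w ∷ ys) x y = cong ((z ⊕ w) ∷_) (zipWith-∷ʳ xs ys x y)

    -- The shift register with block feedback: the action of a TSR matrix on row vectors.
    register : ∀ {n} → Vec Carrier (suc n) → Operator
    register {n} c = blockwise (suc n) (step c) additive homogeneous
      where
      additive : ∀ xs ys → step c (Vec.zipWith _⊕_ xs ys) ≡ Vec.zipWith _⊕_ (step c xs) (step c ys)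
      additive (x ∷ xs) (y ∷ ys) = trans
        (cong (Vec.zipWith _⊕_ xs ys Vec.∷ʳ_) (trans (cong op (combine-⊕ c (x ∷ xs) (y ∷ ys))) (op-⊕ _ _)))
        (sym (zipWith-∷ʳ xs ys _ _))
      homogeneous : ∀ a xs → step c (Vec.map (a ·_) xs) ≡ Vec.map (a ·_) (step c xs)
      homogeneous a (x ∷ xs) = trans
        (cong (Vec.map (a ·_) xs Vec.∷ʳ_) (trans (cong op (combine-· c a (x ∷ xs))) (op-· a _)))
        (sym (Vecₚ.map-∷ʳ (a ·_) _ xs))

    -- Applying the block to every component commutes with the register. This is what will make the
    -- block a polynomial in the register.
    step-map-op : ∀ {n} (c : Vec Carrier (suc n)) xs → step c (Vec.map op xs) ≡ Vec.map op (step c xs)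
    step-map-op c (x ∷ xs) = trans
      (cong (λ z → Vec.map op xs Vec.∷ʳ op z) (combine-op c (x ∷ xs)))
      (sym (Vecₚ.map-∷ʳ op _ xs))

-- Matrices acting on row vectors, and the Cayley-Hamilton theorem.

lookup-ext : {A : Set} {k : ℕ} {x y : Vec A k} → (∀ i → lookup x i ≡ lookup y i) → x ≡ y
lookup-ext {x = x} {y} eq =
  ≡.trans (≡.sym (Vecₚ.tabulate∘lookup x)) (≡.trans (Vecₚ.tabulate-cong eq) (Vecₚ.tabulate∘lookup y))

module Matrices (F : FiniteField) where
  open CommutativeRing (fieldRing F) hiding (zero; refl; sym; trans; _≈_)
  open Algebra.Properties.Ring ring
  open Algebra.Properties.Semiring.Sum semiring using (∑-distrib-+; *-distribˡ-sum)
  open ≡ using (refl; sym; trans; cong; cong₂)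
  open ≡.≡-Reasoning
  open Polynomials F
  open Division F
  open Field F
  open Operators F
  open Determinant (fieldRing F)
  private
    module P = CommutativeRing polyRing
    module D = Determinant polyRing

  _≟ⱽ_ : ∀ {k} → DecidableEquality (Vec Carrier k)
  _≟ⱽ_ = Vecₚ.≡-dec _≟_

  vectors : ∀ k → List (Vec Carrier k)
  vectors = allVecs (FiniteField.elements F)

  ∈-vectors : ∀ {k} (v : Vec Carrier k) → v ∈ vectors k
  ∈-vectors = allVecs-complete (FiniteField.elements-complete F)

  length-vectors : ∀ k → length (vectors k) ≡ FiniteField.size F ℕ.^ k
  length-vectors = length-allVecs (FiniteField.elements F)

  0ᵛ : ∀ {k} → Vec Carrier k
  0ᵛ = Vec.replicate _ 0#

  _+ᵛ_ : ∀ {k} → Vec Carrier k → Vec Carrier k → Vec Carrier k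
  _+ᵛ_ = Vec.zipWith _+_

  _·ᵛ_ : ∀ {k} → Carrier → Vec Carrier k → Vec Carrier k
  a ·ᵛ x = Vec.map (a *_) x

  _⊛_ : ∀ {k l} → Vec Carrier k → (Fin k → Fin l → Carrier) → Vec Carrier l
  x ⊛ A = tabulate λ s → sum λ r → lookup x r * A r s

  lookup-⊛ : ∀ {k l} x (A : Fin k → Fin l → Carrier) s → lookup (x ⊛ A) s ≡ sum λ r → lookup x r * A r s
  lookup-⊛ x A s = Vecₚ.lookup∘tabulate _ s

  ⊛-+ᵛ : ∀ {k l} (A : Fin k → Fin l → Carrier) x y → (x +ᵛ y) ⊛ A ≡ (x ⊛ A) +ᵛ (y ⊛ A)
  ⊛-+ᵛ A x y = lookup-ext λ s → begin
    lookup ((x +ᵛ y) ⊛ A) s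
      ≡⟨ lookup-⊛ (x +ᵛ y) A s ⟩
    sum (λ r → lookup (x +ᵛ y) r * A r s)
      ≡⟨ sum-cong-≋ (λ r → trans (cong (_* A r s) (Vecₚ.lookup-zipWith _+_ r x y)) (distribʳ (A r s) _ _)) ⟩
    sum (λ r → lookup x r * A r s + lookup y r * A r s)
      ≡⟨ ∑-distrib-+ (λ r → lookup x r * A r s) (λ r → lookup y r * A r s) ⟩
    sum (λ r → lookup x r * A r s) + sum (λ r → lookup y r * A r s)
      ≡⟨ cong₂ _+_ (lookup-⊛ x A s) (lookup-⊛ y A s) ⟨
    lookup (x ⊛ A) s + lookup (y ⊛ A) s
      ≡⟨ Vecₚ.lookup-zipWith _+_ s (x ⊛ A) (y ⊛ A) ⟨
    lookup ((x ⊛ A) +ᵛ (y ⊛ A)) s ∎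

  ⊛-·ᵛ : ∀ {k l} (A : Fin k → Fin l → Carrier) a x → (a ·ᵛ x) ⊛ A ≡ a ·ᵛ (x ⊛ A)
  ⊛-·ᵛ A a x = lookup-ext λ s → begin
    lookup ((a ·ᵛ x) ⊛ A) s
      ≡⟨ lookup-⊛ (a ·ᵛ x) A s ⟩
    sum (λ r → lookup (a ·ᵛ x) r * A r s)
      ≡⟨ sum-cong-≋ (λ r → trans (cong (_* A r s) (Vecₚ.lookup-map r (a *_) x)) (*-assoc a _ _)) ⟩
    sum (λ r → a * (lookup x r * A r s))
      ≡⟨ *-distribˡ-sum a (λ r → lookup x r * A r s) ⟨
    a * sum (λ r → lookup x r * A r s)
      ≡⟨ cong (a *_) (lookup-⊛ x A s) ⟨
    a * lookup (x ⊛ A) s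
      ≡⟨ Vecₚ.lookup-map s (a *_) (x ⊛ A) ⟨
    lookup (a ·ᵛ (x ⊛ A)) s ∎

  scalars : Operator
  scalars = record
    { V = Carrier ; _⊕_ = _+_ ; 𝟎 = 0# ; _·_ = _*_ ; op = λ x → x
    ; ⊕-assoc = +-assoc ; ⊕-comm = +-comm ; ⊕-identityˡ = +-identityˡ
    ; ·-⊕ = distribˡ ; +-· = λ a b v → distribʳ v a b ; *-· = *-assoc ; 1-· = *-identityˡ ; 0-· = zeroˡ
    ; op-⊕ = λ _ _ → refl ; op-· = λ _ _ → refl }

  entries : ∀ {k l} → Vec (Vec Carrier l) k → Fin k → Fin l → Carrier
  entries A r s = lookup (lookup A r) s

  rowOperator : ∀ {k} → Matrix Carrier k → Operator
  rowOperator {k} A = Blocks.blockwise scalars k (_⊛ entries A) (⊛-+ᵛ (entries A)) (⊛-·ᵛ (entries A))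

  unit : ∀ {k} → Fin k → Vec Carrier k
  unit i = tabulate (δ i)

  unit-nonzero : ∀ {k} (i : Fin k) → unit i ≢ 0ᵛ
  unit-nonzero i eq = FiniteField.0≢1 F (begin
    0#                   ≡⟨ Vecₚ.lookup-replicate i 0# ⟨
    lookup 0ᵛ i          ≡⟨ cong (λ v → lookup v i) eq ⟨
    lookup (unit i) i    ≡⟨ Vecₚ.lookup∘tabulate (δ i) i ⟩
    δ i i                ≡⟨ δ-diagonal i ⟩
    1#                   ∎)

  unit-⊛ : ∀ {k} i (A : Matrix Carrier k) → unit i ⊛ entries A ≡ lookup A i
  unit-⊛ i A = lookup-ext λ s → begin
    lookup (unit i ⊛ entries A) s
      ≡⟨ lookup-⊛ (unit i) (entries A) s ⟩
    sum (λ r → lookup (unit i) r * entries A r s)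
      ≡⟨ sum-isolated i (λ r r≢i → trans (cong (_* entries A r s)
           (trans (Vecₚ.lookup∘tabulate (δ i) r) (δ-off-diagonal (r≢i ∘ sym)))) (zeroˡ _)) ⟩
    lookup (unit i) i * entries A i s
      ≡⟨ cong (_* entries A i s) (trans (Vecₚ.lookup∘tabulate (δ i) i) (δ-diagonal i)) ⟩
    1# * entries A i s
      ≡⟨ *-identityˡ _ ⟩
    lookup (lookup A i) s ∎

  -- Off the diagonal there is an additional zero coefficient, so that all entries uniformly have
  -- the form a + b X, as `det-degree` and `det-leading` expect.
  characteristic : ∀ {k} → Matrix Carrier k → D.Mat k
  characteristic A r s = - entries A r s ∷ δ r s ∷ []

  -- The entries of the matrix in `charPoly` come from a local function that cannot be named from
  -- outside; unification recovers it as the witness.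
  charPoly-entries : ∀ {k} (A : Matrix Carrier k) → Σ (Fin k → Fin k → Poly F) λ E →
    charPoly F A ≡ Det.det (polyOps F) (tabulate λ r → tabulate (E r))
  charPoly-entries A = _ , refl

  charPoly≈det : ∀ {k} (A : Matrix Carrier k) → charPoly F A ≈ D.det (characteristic A)
  charPoly≈det {k} A = P.trans (P.reflexive (proj₂ (charPoly-entries A))) (P.trans
    (D.det-lookup (tabulate λ r → tabulate (proj₁ (charPoly-entries A) r)))
    (D.det-cong λ r s → P.trans
      (P.reflexive (trans (cong (λ row → lookup row s) (Vecₚ.lookup∘tabulate _ r)) (Vecₚ.lookup∘tabulate _ s)))
      (entry r s)))
    where
    entry : ∀ r s → proj₁ (charPoly-entries A) r s ≈ characteristic A r s
    entry r s with r Finₚ.≟ s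
    ... | yes _ = P.refl
    ... | no  _ = ∷-cong refl (P.sym shift-[])

  coeff-altSum : ∀ {k} (f : Fin k → Poly F) i →
    coeff F (Det.altSum D.ringOps f) i ≡ Det.altSum ringOps (λ j → coeff F (f j) i)
  coeff-altSum {zero}  f i = refl
  coeff-altSum {suc k} f i = trans (coeff-add (f zero) _ i)
    (cong (coeff F (f zero) i +_) (trans (coeff-neg (Det.altSum D.ringOps (f ∘ suc)) i) (cong -_ (coeff-altSum (f ∘ suc) i))))

  coeff-linear-mulP : ∀ a b p i → coeff F (mulP F (a ∷ b ∷ []) p) (suc i) ≡ a * coeff F p (suc i) + b * coeff F p i
  coeff-linear-mulP a b p i = trans (coeff-add (scale a p) _ (suc i))
    (cong₂ _+_ (coeff-scale a p (suc i)) (trans (mulP-constant b p .coeff-≡ i) (coeff-scale b p i)))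

  det-degree : ∀ {k} (A B : Mat k) → DegreeBelow (suc k) (D.det λ r s → A r s ∷ B r s ∷ [])
  det-degree {zero}  A B (suc i) _ = refl
  det-degree {suc k} A B (suc i) (ℕ.s≤s k<i) =
    trans (coeff-altSum (λ j → mulP F (A zero j ∷ B zero j ∷ []) (d j)) (suc i)) (altSum-zero λ j → begin
      coeff F (mulP F (A zero j ∷ B zero j ∷ []) (d j)) (suc i)
        ≡⟨ coeff-linear-mulP (A zero j) (B zero j) (d j) i ⟩
      A zero j * coeff F (d j) (suc i) + B zero j * coeff F (d j) i
        ≡⟨ cong₂ (λ x y → A zero j * x + B zero j * y)
             (det-degree (minor A j) (minor B j) (suc i) (ℕₚ.m≤n⇒m≤1+n k<i)) (det-degree (minor A j) (minor B j) i k<i) ⟩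
      A zero j * 0# + B zero j * 0#  ≡⟨ cong₂ _+_ (zeroʳ _) (zeroʳ _) ⟩
      0# + 0#                        ≡⟨ +-identityˡ 0# ⟩
      0#                             ∎)
    where
    d : Fin (suc k) → Poly F
    d j = D.det λ r s → minor A j r s ∷ minor B j r s ∷ []

  -- Each expansion step multiplies by a linear entry whose constant part meets a minor of too small
  -- a degree, so only the `B` parts reach the top coefficient.
  det-leading : ∀ {k} (A B : Mat k) → coeff F (D.det λ r s → A r s ∷ B r s ∷ []) k ≡ det B
  det-leading {zero}  A B = refl
  det-leading {suc k} A B =
    trans (coeff-altSum (λ j → mulP F (A zero j ∷ B zero j ∷ []) (d j)) (suc k)) (altSum-cong λ j → begin
      coeff F (mulP F (A zero j ∷ B zero j ∷ []) (d j)) (suc k)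
        ≡⟨ coeff-linear-mulP (A zero j) (B zero j) (d j) k ⟩
      A zero j * coeff F (d j) (suc k) + B zero j * coeff F (d j) k
        ≡⟨ cong₂ (λ x y → A zero j * x + B zero j * y)
             (det-degree (minor A j) (minor B j) (suc k) ℕₚ.≤-refl) (det-leading (minor A j) (minor B j)) ⟩
      A zero j * 0# + B zero j * det (minor B j)  ≡⟨ cong (_+ B zero j * det (minor B j)) (zeroʳ _) ⟩
      0# + B zero j * det (minor B j)             ≡⟨ +-identityˡ _ ⟩
      B zero j * det (minor B j)                  ∎)
    where
    d : Fin (suc k) → Poly F
    d j = D.det λ r s → minor A j r s ∷ minor B j r s ∷ []

  det-identity : ∀ k → det {k} δ ≡ 1#
  det-identity zero    = refl
  det-identity (suc k) = begin
    δ {suc k} zero zero * det (minor {k} δ zero) - Det.altSum ringOps (λ j → δ {suc k} zero (suc j) * det (minor {k} δ (suc j)))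
      ≡⟨ cong₂ (λ x y → x - y)
           (trans (*-identityˡ _) (trans (det-cong {M = minor δ zero} {δ} δ-suc) (det-identity k)))
           (altSum-zero λ j → zeroˡ (det (minor {k} δ (suc j)))) ⟩
    1# - 0#   ≡⟨ cong (1# +_) -0#≈0# ⟩
    1# + 0#   ≡⟨ +-identityʳ 1# ⟩
    1#        ∎
    where
    δ-suc : ∀ (r s : Fin k) → δ (suc r) (suc s) ≡ δ r s
    δ-suc r s with r Finₚ.≟ s
    ... | yes _ = refl
    ... | no  _ = refl

  charPoly-monic : ∀ {k} (A : Matrix Carrier k) → ∃ λ (f : Vec Carrier k) → charPoly F A ≈ monic F f
  charPoly-monic {k} A = monic-of-degree k (charPoly F A)
    (λ i k<i → trans (charPoly≈det A .coeff-≡ i) (det-degree (λ r s → - entries A r s) δ i k<i))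
    (trans (charPoly≈det A .coeff-≡ k) (trans (det-leading (λ r s → - entries A r s) δ) (det-identity k)))

  module Cayley-Hamilton {k} (A : Matrix Carrier k) where
    open Operator (rowOperator A)
    private
      ⊕-monoid : CommutativeMonoid 0ℓ 0ℓ
      ⊕-monoid = record { isCommutativeMonoid = record
        { isMonoid = record
          { isSemigroup = record
            { isMagma = record { isEquivalence = ≡.isEquivalence ; ∙-cong = cong₂ _⊕_ } ; assoc = ⊕-assoc }
          ; identity = ⊕-identityˡ , ⊕-identityʳ }
        ; comm = ⊕-comm } }
      module ⊕ = Algebra.Properties.CommutativeMonoid.Sum ⊕-monoid

    Σᵛ : ∀ {l} → (Fin l → V) → V
    Σᵛ = ⊕.sum

    Σᵛ-cong : ∀ {l} {f g : Fin l → V} → (∀ i → f i ≡ g i) → Σᵛ f ≡ Σᵛ g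
    Σᵛ-cong = ⊕.sum-cong-≋

    Σᵛ-𝟎 : ∀ {l} {f : Fin l → V} → (∀ i → f i ≡ 𝟎) → Σᵛ f ≡ 𝟎
    Σᵛ-𝟎 {zero}  eq = refl
    Σᵛ-𝟎 {suc l} eq = trans (cong₂ _⊕_ (eq zero) (Σᵛ-𝟎 (eq ∘ suc))) (⊕-identityˡ 𝟎)

    Σᵛ-isolated : ∀ {l} (j : Fin l) {f : Fin l → V} → (∀ i → i ≢ j → f i ≡ 𝟎) → Σᵛ f ≡ f j
    Σᵛ-isolated zero    eq = trans (cong (_ ⊕_) (Σᵛ-𝟎 λ i → eq (suc i) λ ())) (⊕-identityʳ _)
    Σᵛ-isolated (suc j) eq = trans
      (cong₂ _⊕_ (eq zero λ ()) (Σᵛ-isolated j λ i i≢j → eq (suc i) (i≢j ∘ Finₚ.suc-injective)))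
      (⊕-identityˡ _)

    act-Σᵛ : ∀ p {l} (f : Fin l → V) → act p (Σᵛ f) ≡ Σᵛ (λ i → act p (f i))
    act-Σᵛ p {zero}  f = act-𝟎 p
    act-Σᵛ p {suc l} f = trans (act-⊕ p _ _) (cong (act p (f zero) ⊕_) (act-Σᵛ p (f ∘ suc)))

    act-sum : ∀ {l} (f : Fin l → Poly F) v → act (D.sum f) v ≡ Σᵛ (λ i → act (f i) v)
    act-sum {zero}  f v = refl
    act-sum {suc l} f v = trans (act-addP (f zero) _ v) (cong (act (f zero) v ⊕_) (act-sum (f ∘ suc) v))

    lookup-Σᵛ : ∀ {l} (f : Fin l → V) s → lookup (Σᵛ f) s ≡ sum (λ i → lookup (f i) s)
    lookup-Σᵛ {zero}  f s = Vecₚ.lookup-replicate s 0#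
    lookup-Σᵛ {suc l} f s = trans (Vecₚ.lookup-zipWith _+_ s (f zero) _) (cong (lookup (f zero) s +_) (lookup-Σᵛ (f ∘ suc) s))

    Σᵛ-units : ∀ x → Σᵛ (λ i → lookup x i · unit i) ≡ x
    Σᵛ-units x = lookup-ext λ s → begin
      lookup (Σᵛ λ i → lookup x i · unit i) s
        ≡⟨ lookup-Σᵛ (λ i → lookup x i · unit i) s ⟩
      sum (λ i → lookup (lookup x i · unit i) s)
        ≡⟨ sum-cong-≋ (λ i → trans (Vecₚ.lookup-map s (lookup x i *_) (unit i))
             (cong (lookup x i *_) (Vecₚ.lookup∘tabulate (δ i) s))) ⟩
      sum (λ i → lookup x i * δ i s)
        ≡⟨ sum-isolated s (λ i i≢s → trans (cong (lookup x i *_) (δ-off-diagonal i≢s)) (zeroʳ _)) ⟩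
      lookup x s * δ s s
        ≡⟨ trans (cong (lookup x s *_) (δ-diagonal s)) (*-identityʳ _) ⟩
      lookup x s ∎

    -- In the F[X]-module, X times the unit vector `i` is row `i` of `A`, that is, the combination
    -- of unit vectors with the entries of that row as coefficients.
    annihilated-row : ∀ i → Σᵛ (λ c → act (characteristic A i c) (unit c)) ≡ 𝟎
    annihilated-row i = begin
      Σᵛ (λ c → act (characteristic A i c) (unit c))
        ≡⟨ Σᵛ-cong (λ c → cong (((- entries A i c) · unit c) ⊕_) (trans
             (cong op (trans (cong (δ i c · unit c ⊕_) op-𝟎) (⊕-identityʳ _))) (op-· (δ i c) (unit c)))) ⟩
      Σᵛ (λ c → (- entries A i c) · unit c ⊕ δ i c · op (unit c))
        ≡⟨ ⊕.∑-distrib-+ (λ c → (- entries A i c) · unit c) (λ c → δ i c · op (unit c)) ⟩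
      Σᵛ (λ c → (- entries A i c) · unit c) ⊕ Σᵛ (λ c → δ i c · op (unit c))
        ≡⟨ cong₂ _⊕_ negated diagonal ⟩
      (- 1#) · lookup A i ⊕ lookup A i
        ≡⟨ trans (⊕-comm _ _) (⊕-inverse (lookup A i)) ⟩
      𝟎 ∎
      where
      negated : Σᵛ (λ c → (- entries A i c) · unit c) ≡ (- 1#) · lookup A i
      negated = trans
        (Σᵛ-cong λ c → cong (_· unit c)
          (trans (sym (-1*x≈-x _)) (sym (Vecₚ.lookup-map c ((- 1#) *_) (lookup A i)))))
        (Σᵛ-units ((- 1#) · lookup A i))
      diagonal : Σᵛ (λ c → δ i c · op (unit c)) ≡ lookup A i
      diagonal = trans
        (Σᵛ-isolated i λ c c≢i → trans (cong (_· op (unit c)) (δ-off-diagonal (c≢i ∘ sym))) (0-· _))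
        (trans (cong (_· op (unit i)) (δ-diagonal i)) (trans (1-· _) (unit-⊛ i A)))

    -- With χ = X I − A, the unit vectors satisfy χ e = 0, and multiplying by the adjugate gives det χ · e = 0.
    det-annihilates : ∀ j → act (D.det (characteristic A)) (unit j) ≡ 𝟎
    det-annihilates j = begin
      act d (unit j)
        ≡⟨ diagonal ⟨
      Σᵛ (λ c → act (mulP F (D.δ j c) d) (unit c))
        ≡⟨ Σᵛ-cong (λ c → act-cong (unit c) (D.adjugate-* χ j c)) ⟨
      Σᵛ (λ c → act (D.sum λ i → mulP F (adj i) (χ i c)) (unit c))
        ≡⟨ Σᵛ-cong (λ c → trans (act-sum (λ i → mulP F (adj i) (χ i c)) (unit c))
             (Σᵛ-cong λ i → act-mulP (adj i) (χ i c) (unit c))) ⟩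
      Σᵛ (λ c → Σᵛ λ i → act (adj i) (act (χ i c) (unit c)))
        ≡⟨ ⊕.∑-comm (λ c i → act (adj i) (act (χ i c) (unit c))) ⟩
      Σᵛ (λ i → Σᵛ λ c → act (adj i) (act (χ i c) (unit c)))
        ≡⟨ Σᵛ-cong (λ i → act-Σᵛ (adj i) (λ c → act (χ i c) (unit c))) ⟨
      Σᵛ (λ i → act (adj i) (Σᵛ λ c → act (χ i c) (unit c)))
        ≡⟨ Σᵛ-𝟎 (λ i → trans (cong (act (adj i)) (annihilated-row i)) (act-𝟎 (adj i))) ⟩
      𝟎 ∎
      where
      χ = characteristic A
      d = D.det χ
      adj = D.adjugate χ j
      diagonal : Σᵛ (λ c → act (mulP F (D.δ j c) d) (unit c)) ≡ act d (unit j)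
      diagonal = trans
        (Σᵛ-isolated j λ c c≢j → cong (λ p → act (mulP F p d) (unit c)) (D.δ-off-diagonal (c≢j ∘ sym)))
        (trans (cong (λ p → act (mulP F p d) (unit j)) (D.δ-diagonal j)) (act-cong (unit j) (P.*-identityˡ d)))

    cayley-hamilton : ∀ x → act (charPoly F A) x ≡ 𝟎
    cayley-hamilton x = begin
      act (charPoly F A) x
        ≡⟨ act-cong x (charPoly≈det A) ⟩
      act d x
        ≡⟨ cong (act d) (Σᵛ-units x) ⟨
      act d (Σᵛ λ i → lookup x i · unit i)
        ≡⟨ act-Σᵛ d (λ i → lookup x i · unit i) ⟩
      Σᵛ (λ i → act d (lookup x i · unit i))
        ≡⟨ Σᵛ-𝟎 (λ i → trans (act-· d (lookup x i) (unit i))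
             (trans (cong (lookup x i ·_) (det-annihilates i)) (·-𝟎 (lookup x i)))) ⟩
      𝟎 ∎
      where d = D.det (characteristic A)

  open Cayley-Hamilton public using (cayley-hamilton)

-- Kernels, and the Krylov matrix as a faithful record of a matrix and a vector.

module Krylov (F : FiniteField) where
  open CommutativeRing (fieldRing F) hiding (zero; refl; sym; trans; _≈_)
  open Algebra.Properties.Ring ring
  open Algebra.Properties.Semiring.Sum semiring using (∑-distrib-+; *-distribˡ-sum; sum-remove)
  open ≡ using (refl; sym; trans; cong; cong₂)
  open ≡.≡-Reasoning
  open Polynomials F
  open Division F
  open Field F
  open Operators F
  open Matrices F
  open Determinant (fieldRing F)

  nonzero-entry : ∀ {k} {x : Vec Carrier k} → x ≢ 0ᵛ → ∃ λ j → lookup x j ≢ 0#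
  nonzero-entry {x = x} x≢0 = Finₚ.¬∀⟶∃¬ _ _ (λ i → lookup x i ≟ 0#)
    λ all → x≢0 (lookup-ext λ i → trans (all i) (sym (Vecₚ.lookup-replicate i 0#)))

  -- More unknowns than equations. The search runs over all vectors; if it failed, `_⊛ A` would
  -- inject q^(k+1) vectors into q^k.
  pigeonhole : ∀ {k} (A : Fin (suc k) → Fin k → Carrier) → ∃ λ x → x ≢ 0ᵛ × x ⊛ A ≡ 0ᵛ
  pigeonhole {k} A with Any.any? (λ x → ¬? (x ≟ⱽ 0ᵛ) ×-dec ((x ⊛ A) ≟ⱽ 0ᵛ)) (vectors (suc k))
  ... | yes hit = let x , _ , p = find hit in x , p
  ... | no miss = contradiction
    (length-≤ (λ x y → x ⊛ A ≡ y) (λ p q → injective (trans p (sym q)))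
      (allVecs-unique (FiniteField.elements-unique F) (suc k)) (λ {x} _ → x ⊛ A , ∈-vectors (x ⊛ A) , refl))
    (ℕₚ.<⇒≱ (≡.subst₂ ℕ._<_ (sym (length-vectors k)) (sym (length-vectors (suc k)))
      (ℕₚ.^-monoʳ-< (FiniteField.size F) 2≤size (ℕₚ.n<1+n k))))
    where
    -- The zero matrix is a placeholder that gives access to the vector space laws.
    open Operator (rowOperator {suc k} (Vec.replicate (suc k) 0ᵛ)) using (difference-𝟎)
    injective : ∀ {x y} → x ⊛ A ≡ y ⊛ A → x ≡ y
    injective {x} {y} eq = difference-𝟎 (decidable-stable (z ≟ⱽ 0ᵛ)
      λ z≢0 → miss (lose (∈-vectors z) (z≢0 , (begin
        z ⊛ A                              ≡⟨ ⊛-+ᵛ A x ((- 1#) ·ᵛ y) ⟩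
        (x ⊛ A) +ᵛ (((- 1#) ·ᵛ y) ⊛ A)     ≡⟨ cong₂ _+ᵛ_ eq (⊛-·ᵛ A (- 1#) y) ⟩
        (y ⊛ A) +ᵛ ((- 1#) ·ᵛ (y ⊛ A))     ≡⟨ Operator.⊕-inverse (rowOperator {k} (Vec.replicate k 0ᵛ)) (y ⊛ A) ⟩
        0ᵛ                                 ∎))))
      where
      z = x +ᵛ ((- 1#) ·ᵛ y)

  transpose : ∀ {k l} → (Fin k → Fin l → Carrier) → Fin l → Fin k → Carrier
  transpose M c r = M r c

  ⊛-row : ∀ {k l} x (A : Fin k → Fin l → Carrier) → x ⊛ A ≡ 0ᵛ → ∀ s → sum (λ r → lookup x r * A r s) ≡ 0#
  ⊛-row x A eq s = trans (sym (lookup-⊛ x A s)) (trans (cong (λ v → lookup v s) eq) (Vecₚ.lookup-replicate s 0#))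

  ⊛-zero : ∀ {k l} x (A : Fin k → Fin l → Carrier) → (∀ s → sum (λ r → lookup x r * A r s) ≡ 0#) → x ⊛ A ≡ 0ᵛ
  ⊛-zero x A eq = lookup-ext λ s → trans (lookup-⊛ x A s) (trans (eq s) (sym (Vecₚ.lookup-replicate s 0#)))

  sum-insertAt : ∀ {k} (j : Fin (suc k)) (y : Vec Carrier k) (b : Fin (suc k) → Carrier) →
    sum (λ c → lookup (Vec.insertAt y j 0#) c * b c) ≡ sum (λ c → lookup y c * b (punchIn j c))
  sum-insertAt j y b = begin
    sum (λ c → lookup (Vec.insertAt y j 0#) c * b c)
      ≡⟨ sum-remove {i = j} (λ c → lookup (Vec.insertAt y j 0#) c * b c) ⟩
    lookup (Vec.insertAt y j 0#) j * b j + sum (λ c → lookup (Vec.insertAt y j 0#) (punchIn j c) * b (punchIn j c))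
      ≡⟨ cong₂ _+_ (trans (cong (_* b j) (Vecₚ.insertAt-lookup y j 0#)) (zeroˡ _))
           (sum-cong-≋ (λ c → cong (_* b (punchIn j c)) (Vecₚ.insertAt-punchIn y j 0# c))) ⟩
    0# + sum (λ c → lookup y c * b (punchIn j c))
      ≡⟨ +-identityˡ _ ⟩
    sum (λ c → lookup y c * b (punchIn j c)) ∎

  -- A vector x killed by all rows but the first exists by counting.  If it is not
  -- killed by the first row, expanding the determinant with x as a column combination
  -- shows that a minor vanishes; a kernel vector of that minor, corrected by x, works.
  kernel : ∀ {k} (M : Mat k) → det M ≡ 0# → ∃ λ x → x ≢ 0ᵛ × x ⊛ transpose M ≡ 0ᵛ
  kernel {zero}  M 1≡0 = contradiction (sym 1≡0) (FiniteField.0≢1 F)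
  kernel {suc k} M det≡0 with pigeonhole (λ c r → M (suc r) c)
  ... | x , x≢0 , xA≡0 with sum (λ c → lookup x c * M zero c) ≟ 0#
  ...   | yes ρ≡0 = x , x≢0 , ⊛-zero x (transpose M) λ { zero → ρ≡0 ; (suc r) → ⊛-row x (λ c r → M (suc r) c) xA≡0 r }
  ...   | no ρ≢0 with nonzero-entry x≢0
  ...     | j , xj≢0 = conclude (kernel (minor M j) minor≡0)
    where
    ρ : Carrier
    ρ = sum (λ c → lookup x c * M zero c)
    minor≡0 : det (minor M j) ≡ 0#
    minor≡0 = zero-product (det-replace-top M j (⊛-row x (λ c r → M (suc r) c) xA≡0)
      (trans (det-replace-combination M j (lookup x)) (trans (cong (lookup x j *_) det≡0) (zeroʳ _)))) ρ≢0
    conclude : (∃ λ y → y ≢ 0ᵛ × y ⊛ transpose (minor M j) ≡ 0ᵛ) → ∃ λ z → z ≢ 0ᵛ × z ⊛ transpose M ≡ 0ᵛ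
    conclude (y , y≢0 , yN≡0) with sum (λ c → lookup (Vec.insertAt y j 0#) c * M zero c) ≟ 0#
    ... | yes σ≡0 = y⁺ , y⁺≢0 , ⊛-zero y⁺ (transpose M) λ { zero → σ≡0 ; (suc r) → rows r }
      where
      y⁺ = Vec.insertAt y j 0#
      rows : ∀ r → sum (λ c → lookup y⁺ c * M (suc r) c) ≡ 0#
      rows r = trans (sum-insertAt j y (M (suc r))) (⊛-row y (transpose (minor M j)) yN≡0 r)
      y⁺≢0 : y⁺ ≢ 0ᵛ
      y⁺≢0 eq = y≢0 (lookup-ext λ c → begin
        lookup y c                 ≡⟨ Vecₚ.insertAt-punchIn y j 0# c ⟨
        lookup y⁺ (punchIn j c)    ≡⟨ cong (λ v → lookup v (punchIn j c)) eq ⟩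
        lookup 0ᵛ (punchIn j c)    ≡⟨ Vecₚ.lookup-replicate (punchIn j c) 0# ⟩
        0#                         ≡⟨ Vecₚ.lookup-replicate c 0# ⟨
        lookup 0ᵛ c                ∎)
    ... | no σ≢0 = z , z≢0 , (begin
      z ⊛ Mᵀ                                            ≡⟨ ⊛-+ᵛ Mᵀ (σ ·ᵛ x) ((- ρ) ·ᵛ y⁺) ⟩
      ((σ ·ᵛ x) ⊛ Mᵀ) +ᵛ (((- ρ) ·ᵛ y⁺) ⊛ Mᵀ)           ≡⟨ cong₂ _+ᵛ_ (⊛-·ᵛ Mᵀ σ x) (⊛-·ᵛ Mᵀ (- ρ) y⁺) ⟩
      (σ ·ᵛ (x ⊛ Mᵀ)) +ᵛ ((- ρ) ·ᵛ (y⁺ ⊛ Mᵀ))           ≡⟨ lookup-ext entry ⟩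
      0ᵛ                                                ∎)
      where
      Mᵀ = transpose M
      y⁺ = Vec.insertAt y j 0#
      σ = sum (λ c → lookup y⁺ c * M zero c)
      -- The first row takes the value `ρ` on `x` and `σ` on `y⁺`, so it kills this combination. As
      -- `y⁺` vanishes at `j`, entry `j` of `z` is `σ` times the nonzero entry of `x`.
      z = (σ ·ᵛ x) +ᵛ ((- ρ) ·ᵛ y⁺)
      lookup-combination : ∀ {k} (u w : Vec Carrier k) a b i →
        lookup ((a ·ᵛ u) +ᵛ (b ·ᵛ w)) i ≡ a * lookup u i + b * lookup w i
      lookup-combination u w a b i = trans (Vecₚ.lookup-zipWith _+_ i (a ·ᵛ u) (b ·ᵛ w))
        (cong₂ _+_ (Vecₚ.lookup-map i (a *_) u) (Vecₚ.lookup-map i (b *_) w))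
      entry : ∀ r → lookup ((σ ·ᵛ (x ⊛ Mᵀ)) +ᵛ ((- ρ) ·ᵛ (y⁺ ⊛ Mᵀ))) r ≡ lookup 0ᵛ r
      entry r = trans (lookup-combination (x ⊛ Mᵀ) (y⁺ ⊛ Mᵀ) σ (- ρ) r)
        (trans (cong₂ (λ u w → σ * u + - ρ * w) (lookup-⊛ x Mᵀ r) (lookup-⊛ y⁺ Mᵀ r))
          (trans (cancel r) (sym (Vecₚ.lookup-replicate r 0#))))
        where
        cancel : ∀ r → σ * sum (λ c → lookup x c * M r c) + - ρ * sum (λ c → lookup y⁺ c * M r c) ≡ 0#
        cancel zero = begin
          σ * ρ + - ρ * σ    ≡⟨ cong (σ * ρ +_) (trans (sym (-‿distribˡ-* ρ σ)) (cong -_ (*-comm ρ σ))) ⟩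
          σ * ρ + - (σ * ρ)  ≡⟨ -‿inverseʳ _ ⟩
          0#                 ∎
        cancel (suc r) = trans
          (cong₂ (λ u w → σ * u + - ρ * w) (⊛-row x (λ c r → M (suc r) c) xA≡0 r)
            (trans (sum-insertAt j y (M (suc r))) (⊛-row y (transpose (minor M j)) yN≡0 r)))
          (trans (cong₂ _+_ (zeroʳ σ) (zeroʳ (- ρ))) (+-identityˡ 0#))
      z≢0 : z ≢ 0ᵛ
      z≢0 eq = σ≢0 (zero-product (trans (*-comm _ _) (begin
        σ * lookup x j                        ≡⟨ +-identityʳ _ ⟨
        σ * lookup x j + 0#                   ≡⟨ cong (σ * lookup x j +_) (zeroʳ (- ρ)) ⟨
        σ * lookup x j + - ρ * 0#             ≡⟨ cong (λ w → σ * lookup x j + - ρ * w) (Vecₚ.insertAt-lookup y j 0#) ⟨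
        σ * lookup x j + - ρ * lookup y⁺ j    ≡⟨ lookup-combination x y⁺ σ (- ρ) j ⟨
        lookup z j                            ≡⟨ cong (λ v → lookup v j) eq ⟩
        lookup 0ᵛ j                           ≡⟨ Vecₚ.lookup-replicate j 0# ⟩
        0#                                    ∎)) xj≢0)

  krylov : ∀ {k} → Matrix Carrier k → Vec Carrier k → Matrix Carrier k
  krylov A v = tabulate λ i → Operator.iterate (rowOperator A) (toℕ i) v

  monic-irreducible : ∀ {k} {f : Vec Carrier k} {p} → p ≈ monic F f → Irreducible F p → Irreducible F (monic F f)
  monic-irreducible p≈f (¬unit , ≉0 , irr) =
    (λ { (h , fh≈1) → ¬unit (h , P.trans (P.*-congʳ {h} p≈f) (coefficientwise {_} {oneP F} fh≈1) .coeff-≡) }) ,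
    (λ f≈0 → ≉0 (P.trans p≈f (coefficientwise {_} {[]} f≈0) .coeff-≡)) ,
    (λ g h f≈gh → irr g h (P.trans p≈f (coefficientwise {_} {mulP F g h} f≈gh) .coeff-≡))
    where module P = CommutativeRing polyRing

  module Irreducible-matrix {k} (A : Matrix Carrier k) (f : Vec Carrier k) (A≈f : charPoly F A ≈ monic F f)
    (irr : Irreducible F (monic F f)) {v : Vec Carrier k} (v≢0 : v ≢ 0ᵛ) where
    open Operator (rowOperator A)

    annihilates : ∀ x → act (monic F f) x ≡ 0ᵛ
    annihilates x = trans (sym (act-cong x A≈f)) (cayley-hamilton A x)

    open Irreducible-annihilator f irr v≢0 (annihilates v) public

    generates : ∀ u → ∃ λ (a : Vec Carrier k) → act (toPoly a) v ≡ u
    generates = act-surjective _≟ⱽ_ ∈-vectors (ℕₚ.≤-reflexive (length-vectors k))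

    pair : Vec Carrier k → Vec Carrier k → Carrier
    pair x w = sum λ c → lookup x c * lookup w c

    pair-act : ∀ x {l} (a : Vec Carrier l) w → (∀ (i : Fin l) → pair x (iterate (toℕ i) w) ≡ 0#) →
      pair x (act (toPoly a) w) ≡ 0#
    pair-act x []      w eq = sum-zero λ c → trans (cong (lookup x c *_) (Vecₚ.lookup-replicate c 0#)) (zeroʳ _)
    pair-act x (b ∷ a) w eq = begin
      pair x ((b · w) ⊕ op (act (toPoly a) w))
        ≡⟨ sum-cong-≋ (λ c → trans (cong (lookup x c *_) (trans (Vecₚ.lookup-zipWith _+_ c (b · w) _)
             (cong (_+ lookup (op (act (toPoly a) w)) c) (Vecₚ.lookup-map c (b *_) w)))) (rearrange (lookup x c) b (lookup w c) _)) ⟩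
      sum (λ c → b * (lookup x c * lookup w c) + lookup x c * lookup (op (act (toPoly a) w)) c)
        ≡⟨ ∑-distrib-+ (λ c → b * (lookup x c * lookup w c)) (λ c → lookup x c * lookup (op (act (toPoly a) w)) c) ⟩
      sum (λ c → b * (lookup x c * lookup w c)) + pair x (op (act (toPoly a) w))
        ≡⟨ cong₂ _+_ (trans (sym (*-distribˡ-sum b (λ c → lookup x c * lookup w c))) (cong (b *_) (eq zero)))
             (trans (cong (pair x) (sym (act-op (toPoly a) w))) (pair-act x a (op w) (eq ∘ suc))) ⟩
      b * 0# + 0#
        ≡⟨ trans (+-identityʳ _) (zeroʳ b) ⟩
      0# ∎
      where
      rearrange : ∀ x b w o → x * (b * w + o) ≡ b * (x * w) + x * o
      rearrange x b w o = trans (distribˡ x (b * w) o)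
        (cong (_+ x * o) (trans (sym (*-assoc x b w)) (trans (cong (_* w) (*-comm x b)) (*-assoc b x w))))

    -- A kernel vector is orthogonal to `v` and its iterates below `k`, hence to their combinations.
    -- Since `v` generates the space, these include all unit vectors.
    krylov-GL : GL F k (krylov A v)
    krylov-GL detF≡0 with kernel (entries (krylov A v)) (trans (sym (det-lookup (krylov A v))) detF≡0)
    ... | x , x≢0 , xM≡0 = x≢0 (lookup-ext λ j → begin
      lookup x j
        ≡⟨ trans (cong (lookup x j *_) (δ-diagonal j)) (*-identityʳ _) ⟨
      lookup x j * δ j j
        ≡⟨ sum-isolated j (λ i i≢j → trans (cong (lookup x i *_) (δ-off-diagonal (i≢j ∘ sym))) (zeroʳ _)) ⟨
      sum (λ c → lookup x c * δ j c)
        ≡⟨ sum-cong-≋ (λ c → cong (lookup x c *_) (Vecₚ.lookup∘tabulate (δ j) c)) ⟨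
      pair x (unit j)
        ≡⟨ cong (pair x) (proj₂ (generates (unit j))) ⟨
      pair x (act (toPoly (proj₁ (generates (unit j)))) v)
        ≡⟨ pair-act x (proj₁ (generates (unit j))) v (λ i → trans
             (sum-cong-≋ λ c → cong (λ row → lookup x c * lookup row c) (sym (Vecₚ.lookup∘tabulate _ i)))
             (⊛-row x (transpose (entries (krylov A v))) xM≡0 i)) ⟩
      0#
        ≡⟨ Vecₚ.lookup-replicate j 0# ⟨
      lookup 0ᵛ j ∎)

  -- The rows give the iterates of `v` below `k`, and the shared polynomial `f` reduces every higher
  -- power to them, so each polynomial in `A` and in `B` has the same value at `v`. If `a` takes `v`
  -- to a unit vector, then X a takes it to the corresponding row of the matrix.
  krylov-determines-matrix : ∀ {k} (f : Vec Carrier k) → Irreducible F (monic F f) → (A B : Matrix Carrier k) →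
    charPoly F A ≈ monic F f → charPoly F B ≈ monic F f →
    {v : Vec Carrier k} → v ≢ 0ᵛ → krylov A v ≡ krylov B v → A ≡ B
  krylov-determines-matrix {k} f irr A B A≈ B≈ {v} v≢0 eq = lookup-ext row
    where
    module OA = Operator (rowOperator A)
    module OB = Operator (rowOperator B)
    module IA = Irreducible-matrix A f A≈ irr v≢0
    module IB = Irreducible-matrix B f B≈ irr v≢0
    act-agree : ∀ {l} (a : Vec Carrier l) (u w : Vec Carrier k) →
      (∀ (i : Fin l) → OA.iterate (toℕ i) u ≡ OB.iterate (toℕ i) w) → OA.act (toPoly a) u ≡ OB.act (toPoly a) w
    act-agree []      u w eq = refl
    act-agree (b ∷ a) u w eq = cong₂ OA._⊕_ (cong (b OA.·_) (eq zero))
      (trans (sym (OA.act-op (toPoly a) u)) (trans (act-agree a (OA.op u) (OB.op w) (eq ∘ suc)) (OB.act-op (toPoly a) w)))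
    rows : ∀ (i : Fin k) → OA.iterate (toℕ i) v ≡ OB.iterate (toℕ i) v
    rows i = trans (sym (Vecₚ.lookup∘tabulate _ i)) (trans (cong (λ M → lookup M i) eq) (Vecₚ.lookup∘tabulate _ i))
    agree : ∀ p → OA.act p v ≡ OB.act p v
    agree p = trans (OA.act-remainder f (IA.annihilates v) p)
      (trans (act-agree (remainder f p) v v rows) (sym (OB.act-remainder f (IB.annihilates v) p)))
    row : ∀ i → lookup A i ≡ lookup B i
    row i = begin
      lookup A i                       ≡⟨ unit-⊛ i A ⟨
      OA.op (unit i)                   ≡⟨ cong OA.op av≡e ⟨
      OA.op (OA.act a v)               ≡⟨ OA.act-shift a v ⟨
      OA.act (shift a) v               ≡⟨ agree (shift a) ⟩
      OB.act (shift a) v               ≡⟨ OB.act-shift a v ⟩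
      OB.op (OB.act a v)               ≡⟨ cong OB.op (agree a) ⟨
      OB.op (OA.act a v)               ≡⟨ cong OB.op av≡e ⟩
      OB.op (unit i)                   ≡⟨ unit-⊛ i B ⟩
      lookup B i                       ∎
      where
      a : Poly F
      a = toPoly (proj₁ (IA.generates (unit i)))
      av≡e : OA.act a v ≡ unit i
      av≡e = proj₂ (IA.generates (unit i))

  krylov-start : ∀ {k} (A B : Matrix Carrier k) (v w : Vec Carrier k) → krylov A v ≡ krylov B w → v ≡ w
  krylov-start {zero}  A B [] [] _  = refl
  krylov-start {suc k} A B v  w  eq = cong Vec.head eq

  krylov-injective : ∀ {k} (f : Vec Carrier k) → Irreducible F (monic F f) → (A B : Matrix Carrier k) →
    charPoly F A ≈ monic F f → charPoly F B ≈ monic F f →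
    (v w : Vec Carrier k) → v ≢ 0ᵛ → krylov A v ≡ krylov B w → A ≡ B × v ≡ w
  krylov-injective f irr A B A≈ B≈ v w v≢0 eq =
    krylov-determines-matrix f irr A B A≈ B≈ v≢0 (trans eq (cong (krylov B) (sym v≡w))) , v≡w
    where
    v≡w : v ≡ w
    v≡w = krylov-start A B v w eq

-- TSR matrices as shift registers, and irreducibility of the block.

lookup-∷ʳ-last : {A : Set} {k : ℕ} (xs : Vec A k) (x : A) → lookup (xs Vec.∷ʳ x) (fromℕ k) ≡ x
lookup-∷ʳ-last []       x = ≡.refl
lookup-∷ʳ-last (y ∷ xs) x = lookup-∷ʳ-last xs x

lookup-∷ʳ-inject₁ : {A : Set} {k : ℕ} (xs : Vec A k) (x : A) (i : Fin k) → lookup (xs Vec.∷ʳ x) (inject₁ i) ≡ lookup xs i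
lookup-∷ʳ-inject₁ (y ∷ xs) x zero    = ≡.refl
lookup-∷ʳ-inject₁ (y ∷ xs) x (suc i) = lookup-∷ʳ-inject₁ xs x i

All-∷ʳ : {A : Set} {P : A → Set} {k : ℕ} {xs : Vec A k} {x : A} → Allᵛ P xs → P x → Allᵛ P (xs Vec.∷ʳ x)
All-∷ʳ []         p = p ∷ []
All-∷ʳ (px ∷ pxs) p = px ∷ All-∷ʳ pxs p

replicate-∷ʳ : {A : Set} (k : ℕ) (x : A) → Vec.replicate k x Vec.∷ʳ x ≡ Vec.replicate (suc k) x
replicate-∷ʳ zero    x = ≡.refl
replicate-∷ʳ (suc k) x = ≡.cong (x ∷_) (replicate-∷ʳ k x)

module Register (F : FiniteField) where
  open CommutativeRing (fieldRing F) hiding (zero; refl; sym; trans; _≈_)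
  open Algebra.Properties.Ring ring
  open Algebra.Properties.Semiring.Sum semiring using (∑-distrib-+; ∑-comm; *-distribˡ-sum; *-distribʳ-sum)
  open ≡ using (refl; sym; trans; cong; cong₂)
  open ≡.≡-Reasoning
  open Polynomials F
  open Division F
  open Field F
  open Operators F
  open Matrices F
  open Krylov F
  open Determinant (fieldRing F)
  private module P = CommutativeRing polyRing

  sum-++ : ∀ k {l} (f : Fin (k ℕ.+ l) → Carrier) → sum f ≡ sum (λ i → f (i ↑ˡ l)) + sum (λ i → f (k ↑ʳ i))
  sum-++ zero    f = sym (+-identityˡ _)
  sum-++ (suc k) f = trans (cong (f zero +_) (sum-++ k (f ∘ suc))) (sym (+-assoc _ _ _))

  sum-combine : ∀ n {m} (f : Fin (n ℕ.* m) → Carrier) → sum f ≡ sum (λ i → sum λ a → f (Fin.combine {n} {m} i a))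
  sum-combine zero        f = refl
  sum-combine (suc n) {m} f = trans (sum-++ m f) (cong (sum (λ a → f (a ↑ˡ (n ℕ.* m))) +_) (sum-combine n (λ r → f (m ↑ʳ r))))

  -- Names the local entry function of `tsr`, in the same way as `charPoly-entries`.
  tsr-entries : ∀ m n c B → Σ (Fin (n ℕ.* m) → Fin (n ℕ.* m) → Carrier) λ E →
    tsr F m n c B ≡ tabulate λ r → tabulate (E r)
  tsr-entries m n c B = _ , refl

  entries-tsr : ∀ m n c B r s → entries (tsr F m n c B) r s ≡ proj₁ (tsr-entries m n c B) r s
  entries-tsr m n c B r s =
    trans (cong (λ row → lookup row s) (Vecₚ.lookup∘tabulate _ r)) (Vecₚ.lookup∘tabulate _ s)

  -- Coefficients and block enter the matrix only through their products; this is the freedom that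
  -- allows `c` to be rescaled against `B`.
  tsr-cong : ∀ m n {c c′ B B′} → (∀ i a b → lookup c i * entries B a b ≡ lookup c′ i * entries B′ a b) →
    tsr F m n c B ≡ tsr F m n c′ B′
  tsr-cong m n {c} {c′} {B} {B′} eq = Vecₚ.tabulate-cong λ r → Vecₚ.tabulate-cong λ s → entry r s
    where
    entry : ∀ r s → proj₁ (tsr-entries m n c B) r s ≡ proj₁ (tsr-entries m n c′ B′) r s
    entry r s with toℕ (proj₁ (remQuot {n} m s)) ℕ.≟ (n ∸ 1)
    ... | yes _ = eq _ _ _
    ... | no  _ with toℕ (proj₁ (remQuot {n} m r)) ℕ.≟ suc (toℕ (proj₁ (remQuot {n} m s)))
    ...   | no  _ = refl
    ...   | yes _ with proj₂ (remQuot {n} m r) Finₚ.≟ proj₂ (remQuot {n} m s)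
    ...     | yes _ = refl
    ...     | no  _ = refl

  module TSR (m n : ℕ) (c : Vec Carrier (suc n)) (B : Matrix Carrier m) where
    private
      T = tsr F m (suc n) c B
      N = suc n ℕ.* m
      index : Fin (suc n) → Fin m → Fin N
      index = Fin.combine

    module Row = Operator (rowOperator B)
    module Blk = Blocks (rowOperator B)
    shiftRegister : Operator
    shiftRegister = Blk.register c
    module U = Operator shiftRegister
    module TV = Operator (rowOperator T)

    column-last : ∀ r s → toℕ (proj₁ (remQuot {suc n} m s)) ≡ n →
      proj₁ (tsr-entries m (suc n) c B) r s ≡
      lookup c (proj₁ (remQuot {suc n} m r)) * entries B (proj₂ (remQuot {suc n} m r)) (proj₂ (remQuot {suc n} m s))
    column-last r s last with toℕ (proj₁ (remQuot {suc n} m s)) ℕ.≟ n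
    ... | yes _ = refl
    ... | no ¬last = contradiction last ¬last

    column-match : ∀ r s → toℕ (proj₁ (remQuot {suc n} m s)) ≢ n →
      toℕ (proj₁ (remQuot {suc n} m r)) ≡ suc (toℕ (proj₁ (remQuot {suc n} m s))) →
      proj₁ (tsr-entries m (suc n) c B) r s ≡ δ (proj₂ (remQuot {suc n} m r)) (proj₂ (remQuot {suc n} m s))
    column-match r s ¬last match with toℕ (proj₁ (remQuot {suc n} m s)) ℕ.≟ n
    ... | yes last = contradiction last ¬last
    ... | no _ with toℕ (proj₁ (remQuot {suc n} m r)) ℕ.≟ suc (toℕ (proj₁ (remQuot {suc n} m s)))
    ...   | no ¬match = contradiction match ¬match
    ...   | yes _ with proj₂ (remQuot {suc n} m r) Finₚ.≟ proj₂ (remQuot {suc n} m s)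
    ...     | yes _ = refl
    ...     | no  _ = refl

    column-mismatch : ∀ r s → toℕ (proj₁ (remQuot {suc n} m s)) ≢ n →
      toℕ (proj₁ (remQuot {suc n} m r)) ≢ suc (toℕ (proj₁ (remQuot {suc n} m s))) →
      proj₁ (tsr-entries m (suc n) c B) r s ≡ 0#
    column-mismatch r s ¬last ¬match with toℕ (proj₁ (remQuot {suc n} m s)) ℕ.≟ n
    ... | yes last = contradiction last ¬last
    ... | no _ with toℕ (proj₁ (remQuot {suc n} m r)) ℕ.≟ suc (toℕ (proj₁ (remQuot {suc n} m s)))
    ...   | no _      = refl
    ...   | yes match = contradiction match ¬match

    quotient : ∀ i a → remQuot {suc n} m (index i a) ≡ (i , a)
    quotient = Finₚ.remQuot-combine {suc n} {m}

    entry-last : ∀ i a b → entries T (index i a) (index (fromℕ n) b) ≡ lookup c i * entries B a b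
    entry-last i a b = trans (entries-tsr m (suc n) c B _ _) (trans
      (column-last (index i a) (index (fromℕ n) b) (trans (cong (toℕ ∘ proj₁) (quotient (fromℕ n) b)) (Finₚ.toℕ-fromℕ n)))
      (cong₂ (λ p q → lookup c (proj₁ p) * entries B (proj₂ p) (proj₂ q)) (quotient i a) (quotient (fromℕ n) b)))

    not-last : ∀ j b → toℕ (proj₁ (remQuot {suc n} m (index (inject₁ j) b))) ≢ n
    not-last j b eq = ℕₚ.<-irrefl
      (trans (sym (Finₚ.toℕ-inject₁ j)) (trans (sym (cong (toℕ ∘ proj₁) (quotient (inject₁ j) b))) eq)) (Finₚ.toℕ<n j)

    entry-diagonal : ∀ j a b → entries T (index (suc j) a) (index (inject₁ j) b) ≡ δ a b
    entry-diagonal j a b = trans (entries-tsr m (suc n) c B _ _) (trans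
      (column-match (index (suc j) a) (index (inject₁ j) b) (not-last j b)
        (trans (cong (toℕ ∘ proj₁) (quotient (suc j) a))
          (cong suc (trans (sym (Finₚ.toℕ-inject₁ j)) (sym (cong (toℕ ∘ proj₁) (quotient (inject₁ j) b)))))))
      (cong₂ (λ p q → δ (proj₂ p) (proj₂ q)) (quotient (suc j) a) (quotient (inject₁ j) b)))

    entry-zero : ∀ i j a b → i ≢ suc j → entries T (index i a) (index (inject₁ j) b) ≡ 0#
    entry-zero i j a b i≢ = trans (entries-tsr m (suc n) c B _ _)
      (column-mismatch (index i a) (index (inject₁ j) b) (not-last j b) λ eq → i≢ (Finₚ.toℕ-injective (trans
        (sym (cong (toℕ ∘ proj₁) (quotient i a)))
        (trans eq (cong suc (trans (cong (toℕ ∘ proj₁) (quotient (inject₁ j) b)) (Finₚ.toℕ-inject₁ j)))))))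

    lookup-combination : ∀ {k} (cs : Vec Carrier k) xs a →
      lookup (Blk.combine cs xs) a ≡ sum (λ i → lookup cs i * lookup (lookup xs i) a)
    lookup-combination []       []       a = Vecₚ.lookup-replicate a 0#
    lookup-combination (d ∷ cs) (x ∷ xs) a = trans (Vecₚ.lookup-zipWith _+_ a (d ·ᵛ x) (Blk.combine cs xs))
      (cong₂ _+_ (Vecₚ.lookup-map a (d *_) x) (lookup-combination cs xs a))

    -- The last block column of T produces the feedback. Any other column contains a single 1, one
    -- block further down, and copies the next block of the state.
    column-sum : ∀ xs j b → lookup (lookup (Blk.step c xs) j) b ≡
      sum (λ i → sum λ a → lookup (lookup xs i) a * entries T (index i a) (index j b))
    column-sum (x ∷ xs) j b with view j
    ... | ‵fromℕ = begin
      lookup (lookup (xs Vec.∷ʳ (z ⊛ entries B)) (fromℕ n)) b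
        ≡⟨ cong (λ v → lookup v b) (lookup-∷ʳ-last xs _) ⟩
      lookup (z ⊛ entries B) b
        ≡⟨ lookup-⊛ z (entries B) b ⟩
      sum (λ a → lookup z a * entries B a b)
        ≡⟨ sum-cong-≋ (λ a → trans (cong (_* entries B a b) (lookup-combination c (x ∷ xs) a))
             (*-distribʳ-sum (entries B a b) (λ i → lookup c i * X₀ i a))) ⟩
      sum (λ a → sum λ i → lookup c i * X₀ i a * entries B a b)
        ≡⟨ ∑-comm (λ a i → lookup c i * X₀ i a * entries B a b) ⟩
      sum (λ i → sum λ a → lookup c i * X₀ i a * entries B a b)
        ≡⟨ sum-cong-≋ (λ i → sum-cong-≋ λ a → trans
             (cong (_* entries B a b) (*-comm (lookup c i) (X₀ i a)))
             (trans (*-assoc (X₀ i a) (lookup c i) (entries B a b)) (cong (X₀ i a *_) (sym (entry-last i a b))))) ⟩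
      sum (λ i → sum λ a → X₀ i a * entries T (index i a) (index (fromℕ n) b)) ∎
      where
      z = Blk.combine c (x ∷ xs)
      X₀ = λ i a → lookup (lookup (x ∷ xs) i) a
    ... | ‵inject₁ j = begin
      lookup (lookup (xs Vec.∷ʳ _) (inject₁ j)) b
        ≡⟨ cong (λ v → lookup v b) (lookup-∷ʳ-inject₁ xs _ j) ⟩
      X₀ (suc j) b
        ≡⟨ trans (cong (X₀ (suc j) b *_) (trans (entry-diagonal j b b) (δ-diagonal b))) (*-identityʳ _) ⟨
      X₀ (suc j) b * entries T (index (suc j) b) (index (inject₁ j) b)
        ≡⟨ sum-isolated b (λ a a≢b → trans
             (cong (X₀ (suc j) a *_) (trans (entry-diagonal j a b) (δ-off-diagonal a≢b))) (zeroʳ _)) ⟨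
      sum (λ a → X₀ (suc j) a * entries T (index (suc j) a) (index (inject₁ j) b))
        ≡⟨ sum-isolated (suc j) (λ i i≢ → sum-zero λ a →
             trans (cong (X₀ i a *_) (entry-zero i j a b i≢)) (zeroʳ _)) ⟨
      sum (λ i → sum λ a → X₀ i a * entries T (index i a) (index (inject₁ j) b)) ∎
      where
      X₀ = λ i a → lookup (lookup (x ∷ xs) i) a

    concat-zipWith : ∀ {k} (xs ys : Vec (Vec Carrier m) k) →
      Vec.concat (Vec.zipWith _+ᵛ_ xs ys) ≡ Vec.concat xs +ᵛ Vec.concat ys
    concat-zipWith []       []       = refl
    concat-zipWith (x ∷ xs) (y ∷ ys) =
      trans (cong ((x +ᵛ y) Vec.++_) (concat-zipWith xs ys)) (sym (Vecₚ.zipWith-++ _+_ x (Vec.concat xs) y (Vec.concat ys)))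

    concat-injective : ∀ {k} (xs ys : Vec (Vec Carrier m) k) → Vec.concat xs ≡ Vec.concat ys → xs ≡ ys
    concat-injective []       []       _  = refl
    concat-injective (x ∷ xs) (y ∷ ys) eq with Vecₚ.++-injective x y eq
    ... | x≡y , eq′ = cong₂ _∷_ x≡y (concat-injective xs ys eq′)

    -- Concatenation of blocks identifies the register with T on flat row vectors, and so transports
    -- Cayley-Hamilton to the register.
    flatten : Intertwiner shiftRegister (rowOperator T)
    flatten = record
      { φ    = Vec.concat
      ; φ-⊕  = concat-zipWith
      ; φ-·  = λ a xs → sym (Vecₚ.map-concat (a *_) xs)
      ; φ-op = λ xs → lookup-ext (entry xs) }
      where
      entry : ∀ xs s → lookup (Vec.concat (Blk.step c xs)) s ≡ lookup (Vec.concat xs ⊛ entries T) s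
      entry xs s with Finₚ.combine-surjective {suc n} {m} s
      ... | j , b , refl = begin
        lookup (Vec.concat (Blk.step c xs)) (index j b)
          ≡⟨ Vecₚ.lookup-concat (Blk.step c xs) j b ⟩
        lookup (lookup (Blk.step c xs) j) b
          ≡⟨ column-sum xs j b ⟩
        sum (λ i → sum λ a → lookup (lookup xs i) a * entries T (index i a) (index j b))
          ≡⟨ sum-cong-≋ (λ i → sum-cong-≋ λ a → cong (_* entries T (index i a) (index j b)) (Vecₚ.lookup-concat xs i a)) ⟨
        sum (λ i → sum λ a → lookup (Vec.concat xs) (index i a) * entries T (index i a) (index j b))
          ≡⟨ sum-combine (suc n) (λ r → lookup (Vec.concat xs) r * entries T r (index j b)) ⟨
        sum (λ r → lookup (Vec.concat xs) r * entries T r (index j b))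
          ≡⟨ lookup-⊛ (Vec.concat xs) (entries T) (index j b) ⟨
        lookup (Vec.concat xs ⊛ entries T) (index j b) ∎

    states : List (Vec (Vec Carrier m) (suc n))
    states = allVecs (vectors m) (suc n)

    ∈-states : ∀ x → x ∈ states
    ∈-states = allVecs-complete ∈-vectors

    length-states : length states ≡ (FiniteField.size F ℕ.^ m) ℕ.^ suc n
    length-states = trans (length-allVecs (vectors m) (suc n)) (cong (ℕ._^ suc n) (length-vectors m))

    register-annihilates : ∀ x → U.act (charPoly F T) x ≡ U.𝟎
    register-annihilates x = concat-injective _ _ (begin
      Vec.concat (U.act (charPoly F T) x)      ≡⟨ φ-act (charPoly F T) x ⟩
      TV.act (charPoly F T) (Vec.concat x)     ≡⟨ cayley-hamilton T (Vec.concat x) ⟩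
      TV.𝟎                                     ≡⟨ φ-𝟎 ⟨
      Vec.concat U.𝟎                           ∎)
      where open Intertwiner flatten

    module Irreducible-TSR (f : Vec Carrier N) (T≈f : charPoly F T ≈ monic F f) (irr : Irreducible F (monic F f)) where

      annihilates : ∀ x → U.act (monic F f) x ≡ U.𝟎
      annihilates x = trans (sym (U.act-cong x T≈f)) (register-annihilates x)

      module Generator {x : Vec (Vec Carrier m) (suc n)} (x≢𝟎 : x ≢ U.𝟎) where
        open U.Irreducible-annihilator f irr x≢𝟎 (annihilates x) public

        generates : ∀ y → ∃ λ (a : Vec Carrier N) → U.act (toPoly a) x ≡ y
        generates = act-surjective (Vecₚ.≡-dec _≟ⱽ_) ∈-states (ℕₚ.≤-reflexive (trans length-states
          (trans (ℕₚ.^-*-assoc (FiniteField.size F) m (suc n)) (cong (FiniteField.size F ℕ.^_) (ℕₚ.*-comm m (suc n))))))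

      -- With c₀ zero, the state whose only nonzero block is the first is shifted out to zero. Then
      -- X kills a nonzero state, so `f` divides X, although its degree `N` exceeds 1.
      first-coefficient-nonzero : 1 ℕ.< N → {e : Vec Carrier m} → e ≢ 0ᵛ → Vec.head c ≢ 0#
      first-coefficient-nonzero 1<N {e} e≢0 c₀≡0 = FiniteField.0≢1 F (sym
        (monic∣low f {X} below {proj₁ f∣X} (proj₂ f∣X) .coeff-≡ 1))
        where
        below : DegreeBelow N X
        below zero          N≤0 = contradiction (ℕₚ.<-≤-trans 1<N N≤0) λ ()
        below (suc zero)    N≤1 = contradiction (ℕₚ.<-≤-trans 1<N N≤1) (ℕₚ.<-irrefl refl)
        below (suc (suc i)) _   = refl
        combine-𝟎 : ∀ {k} (cs : Vec Carrier k) → Blk.combine cs (Vec.replicate k 0ᵛ) ≡ 0ᵛ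
        combine-𝟎 []       = refl
        combine-𝟎 (d ∷ cs) = trans (cong₂ Row._⊕_ (Row.·-𝟎 d) (combine-𝟎 cs)) (Row.⊕-identityˡ 0ᵛ)
        feedback : ∀ (cs : Vec Carrier (suc n)) → Vec.head cs ≡ 0# → Blk.combine cs (e ∷ Vec.replicate n 0ᵛ) ≡ 0ᵛ
        feedback (d ∷ cs) d≡0 = trans (cong₂ Row._⊕_ (trans (cong (Row._· e) d≡0) (Row.0-· e)) (combine-𝟎 cs))
          (Row.⊕-identityˡ 0ᵛ)
        shifted-out : U.act X (e ∷ Vec.replicate n 0ᵛ) ≡ U.𝟎
        shifted-out = trans (U.act-X _) (trans
          (cong (λ z → Vec.replicate n 0ᵛ Vec.∷ʳ z) (trans (cong Row.op (feedback c c₀≡0)) Row.op-𝟎))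
          (replicate-∷ʳ n 0ᵛ))
        f∣X : monic F f ∣ X
        f∣X = Generator.act-𝟎⇒∣ (λ eq → e≢0 (cong Vec.head eq)) X shifted-out

      -- The vectors a(B) w with deg a < d form a B-invariant subspace, whose (n+1)-st power would be
      -- invariant under the register and hence everything.
      no-small-annihilator : ∀ {d} → d ℕ.< m → (u : Vec Carrier d) {w : Vec Carrier m} → w ≢ 0ᵛ →
        Row.act (monic F u) w ≢ 0ᵛ
      no-small-annihilator {d} d<m u {w} w≢0 uw≡0 = contradiction
        (length-≤ (λ y as → Vec.map at as ≡ y) (λ p q → trans (sym p) q)
          (allVecs-unique (allVecs-unique (FiniteField.elements-unique F) m) (suc n))
          (λ {y} _ → let as , eq = preimage (everything y) in as , allVecs-complete ∈-vectors as , eq))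
        (ℕₚ.<⇒≱ (≡.subst₂ ℕ._<_ (sym (trans (length-allVecs (vectors d) (suc n)) (cong (ℕ._^ suc n) (length-vectors d))))
          (sym length-states)
          (ℕₚ.^-monoˡ-< (suc n) (ℕₚ.^-monoʳ-< (FiniteField.size F) 2≤size d<m))))
        where
        at : Vec Carrier d → Vec Carrier m
        at a = Row.act (toPoly a) w
        Spanned : Vec Carrier m → Set
        Spanned x = ∃ λ p → Row.act p w ≡ x
        spanned-𝟎 : Spanned 0ᵛ
        spanned-𝟎 = [] , refl
        spanned-⊕ : ∀ {x y} → Spanned x → Spanned y → Spanned (x Row.⊕ y)
        spanned-⊕ (p , refl) (r , refl) = addP F p r , Row.act-addP p r w
        spanned-· : ∀ a {x} → Spanned x → Spanned (a Row.· x)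
        spanned-· a (p , refl) = scale a p , Row.act-scale a p w
        spanned-op : ∀ {x} → Spanned x → Spanned (Row.op x)
        spanned-op (p , refl) = shift p , Row.act-shift p w
        all-⊕ : ∀ {k} {xs ys : Vec (Vec Carrier m) k} → Allᵛ Spanned xs → Allᵛ Spanned ys →
          Allᵛ Spanned (Vec.zipWith Row._⊕_ xs ys)
        all-⊕ []       []       = []
        all-⊕ (p ∷ ps) (q ∷ qs) = spanned-⊕ p q ∷ all-⊕ ps qs
        all-· : ∀ a {k} {xs : Vec (Vec Carrier m) k} → Allᵛ Spanned xs → Allᵛ Spanned (Vec.map (a Row.·_) xs)
        all-· a []       = []
        all-· a (p ∷ ps) = spanned-· a p ∷ all-· a ps
        all-𝟎 : ∀ {k} → Allᵛ Spanned (Vec.replicate k 0ᵛ)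
        all-𝟎 {zero}  = []
        all-𝟎 {suc k} = spanned-𝟎 ∷ all-𝟎
        combination : ∀ {k} (cs : Vec Carrier k) {xs} → Allᵛ Spanned xs → Spanned (Blk.combine cs xs)
        combination []       []       = spanned-𝟎
        combination (c ∷ cs) (p ∷ ps) = spanned-⊕ (spanned-· c p) (combination cs ps)
        all-step : ∀ {xs} → Allᵛ Spanned xs → Allᵛ Spanned (U.op xs)
        all-step (p ∷ ps) = All-∷ʳ ps (spanned-op (combination c (p ∷ ps)))
        all-act : ∀ p {xs} → Allᵛ Spanned xs → Allᵛ Spanned (U.act p xs)
        all-act []      ps = all-𝟎
        all-act (a ∷ p) ps = all-⊕ (all-· a ps) (all-step (all-act p ps))
        start : Vec (Vec Carrier m) (suc n)
        start = w ∷ Vec.replicate n 0ᵛ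
        everything : ∀ y → Allᵛ Spanned y
        everything y = ≡.subst (Allᵛ Spanned) (proj₂ generated)
          (all-act (toPoly (proj₁ generated)) ((oneP F , Row.act-oneP w) ∷ all-𝟎))
          where
          generated : ∃ λ (a : Vec Carrier N) → U.act (toPoly a) start ≡ y
          generated = Generator.generates {start} (λ eq → w≢0 (cong Vec.head eq)) y
        preimage : ∀ {k} {ys : Vec (Vec Carrier m) k} → Allᵛ Spanned ys → ∃ λ as → Vec.map at as ≡ ys
        preimage []               = [] , refl
        preimage ((p , eq) ∷ ps) with preimage ps
        -- A spanning polynomial may have any degree; as `u` kills `w`, its remainder modulo `u` has
        -- the same value at `w` and fewer than `d` + 1 coefficients.
        ... | as , eqs = (remainder u p ∷ as) , cong₂ _∷_ (trans (sym (Row.act-remainder u uw≡0 p)) eq) eqs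

      -- In a factorisation without units both factors have degree below `m`. Then neither kills a
      -- nonzero vector, whereas by Cayley-Hamilton their product kills all of them.
      irreducible-block : 1 ℕ.≤ m → ∀ (b : Vec Carrier m) → charPoly F B ≈ monic F b → Irreducible F (monic F b)
      irreducible-block 1≤m b B≈b = ¬unit , ¬zero , factors
        where
        1≢0 : 1# ≢ 0#
        1≢0 1≡0 = FiniteField.0≢1 F (sym 1≡0)
        ¬unit : ¬ IsUnitP F (monic F b)
        ¬unit (h , eq) = 1≢0 (monic∣low b {oneP F} (λ { zero m≤0 → contradiction (ℕₚ.≤-trans 1≤m m≤0) λ () ; (suc i) _ → refl })
          {h} (coefficientwise eq) .coeff-≡ 0)
        ¬zero : ¬ (_≈ₚ_ F (monic F b) [])
        ¬zero eq = 1≢0 (trans (sym (monic-leading b)) (eq m))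
        vanish : ∀ {d} (u : Vec Carrier d) a → a ≢ 0# → ∀ {p} → p ≈ scale a (monic F u) → d ℕ.< m →
          ∀ {w} → w ≢ 0ᵛ → Row.act p w ≢ 0ᵛ
        vanish u a a≢0 {p} p≈ d<m {w} w≢0 pw≡0 = no-small-annihilator d<m u w≢0
          (Row.·-cancel a≢0 (trans (sym (Row.act-scale a (monic F u) w)) (trans (sym (Row.act-cong w p≈)) pw≡0)))
        factors : ∀ g h → _≈ₚ_ F (monic F b) (mulP F g h) → IsUnitP F g ⊎ IsUnitP F h
        factors g h eq with factor-degree b g h (coefficientwise eq)
          | factor-degree b h g (P.trans (coefficientwise {_} {mulP F g h} eq) (P.*-comm g h))
        ... | inj₁ unit-h | _           = inj₂ unit-h
        ... | inj₂ _      | inj₁ unit-g = inj₁ unit-g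
        ... | inj₂ (d , d<m , a , a≢0 , u , g≈) | inj₂ (d′ , d′<m , a′ , a′≢0 , u′ , h≈) =
          contradiction gh≡0 (vanish u a a≢0 g≈ d<m (vanish u′ a′ a′≢0 h≈ d′<m (unit-nonzero (Fin.fromℕ< 1≤m))))
          where
          e : Vec Carrier m
          e = unit (Fin.fromℕ< 1≤m)
          gh≡0 : Row.act g (Row.act h e) ≡ 0ᵛ
          gh≡0 = begin
            Row.act g (Row.act h e)     ≡⟨ Row.act-mulP g h e ⟨
            Row.act (mulP F g h) e      ≡⟨ Row.act-cong {monic F b} {mulP F g h} e (coefficientwise eq) ⟨
            Row.act (monic F b) e       ≡⟨ Row.act-cong e B≈b ⟨
            Row.act (charPoly F B) e    ≡⟨ cayley-hamilton B e ⟩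
            0ᵛ                          ∎

-- Fermat's theorem, Frobenius and norms in a domain.

unique-⊆⇒↭ : {A : Set} {xs ys : List A} → Unique xs → (∀ {x} → x ∈ xs → x ∈ ys) → length xs ≡ length ys → xs ↭ ys
unique-⊆⇒↭ {xs = []}     {[]} _ _ _ = ↭.↭-refl
unique-⊆⇒↭ {xs = x ∷ xs} {ys} (x∉ ∷ uniq) sub len with ∈ₚ.∈-∃++ (sub (here ≡.refl))
... | as , bs , ≡.refl = ↭.↭-trans
  (↭.prep x (unique-⊆⇒↭ uniq
    (λ y∈ → ∈-skip as (sub (there y∈)) λ y≡x → All.lookup x∉ y∈ (≡.sym y≡x))
    (ℕₚ.suc-injective (≡.trans len (≡.trans (Listₚ.length-++ as)
      (≡.trans (ℕₚ.+-suc (length as) (length bs)) (≡.cong suc (≡.sym (Listₚ.length-++ as)))))))))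
  (↭.↭-sym (↭ₚ.shift x as bs))

-- The sum 1 + Q + ... + Q^(n-1), in Horner form to match the recursion of `conjugate`.
geometric : ℕ → ℕ → ℕ
geometric Q zero    = 0
geometric Q (suc n) = 1 ℕ.+ Q ℕ.* geometric Q n

record IsDomain (K : CommutativeRing 0ℓ 0ℓ) : Set where
  open CommutativeRing K
  field
    1≉0              : ¬ 1# ≈ 0#
    no-zero-divisors : ∀ {x y} → x * y ≈ 0# → ¬ x ≈ 0# → y ≈ 0#

module Domain (K : CommutativeRing 0ℓ 0ℓ) (isDomain : IsDomain K) where
  open CommutativeRing K hiding (zero)
  open IsDomain isDomain
  open Algebra.Properties.Ring ring
  open Algebra.Properties.CommutativeSemiring.Exp commutativeSemiring
  open ℤ-Solver K
  open Relation.Binary.Reasoning.Setoid setoid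

  prod : List Carrier → Carrier
  prod []       = 1#
  prod (x ∷ xs) = x * prod xs

  prod-↭ : {A : Set} (ev : A → Carrier) {xs ys : List A} → xs ↭ ys → prod (List.map ev xs) ≈ prod (List.map ev ys)
  prod-↭ ev ↭.refl         = refl
  prod-↭ ev (↭.prep x p)   = *-congˡ (prod-↭ ev p)
  prod-↭ ev (↭.swap x y p) = trans (*-congˡ (*-congˡ (prod-↭ ev p)))
    (solve 3 (λ a b c → a :* (b :* c) := b :* (a :* c)) refl (ev x) (ev y) _)
  prod-↭ ev (↭.trans p q)  = trans (prod-↭ ev p) (prod-↭ ev q)

  prod-nonzero : ∀ {xs} → All (λ x → ¬ x ≈ 0#) xs → ¬ prod xs ≈ 0#
  prod-nonzero []         = 1≉0
  prod-nonzero (x≉0 ∷ ps) = λ eq → prod-nonzero ps (no-zero-divisors eq x≉0)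

  difference-0 : ∀ {x y} → x - y ≈ 0# → x ≈ y
  difference-0 = x∙y⁻¹≈ε⇒x≈y _ _

  cancel : ∀ {x y z} → ¬ z ≈ 0# → z * x ≈ z * y → x ≈ y
  cancel {x} {y} {z} z≉0 eq = difference-0 (no-zero-divisors (begin
    z * (x - y)    ≈⟨ solve 3 (λ x y z → z :* (x :- y) := z :* x :- z :* y) refl x y z ⟩
    z * x - z * y  ≈⟨ +-congʳ eq ⟩
    z * y - z * y  ≈⟨ -‿inverseʳ _ ⟩
    0#             ∎) z≉0)

  -- Multiplication by x permutes ev as, so it fixes the product.
  fermat : {A : Set} (ev : A → Carrier) → (∀ {a b} → ev a ≈ ev b → a ≡ b) →
    (as : List A) → Unique as → All (λ a → ¬ ev a ≈ 0#) as →
    ∀ {x} → ¬ x ≈ 0# → (∀ {a} → a ∈ as → ∃ λ b → b ∈ as × x * ev a ≈ ev b) →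
    x ^ length as ≈ 1#
  fermat {A} ev ev-injective as unique nonzero {x} x≉0 closed = cancel (prod-nonzero (Allₚ.map⁺ nonzero)) (begin
    prod (List.map ev as) * x ^ length as  ≈⟨ *-comm _ _ ⟩
    x ^ length as * prod (List.map ev as)  ≈⟨ all-images.product ⟩
    prod (List.map ev all-images.list)     ≈⟨ prod-↭ ev (unique-⊆⇒↭ all-images.list-unique
                                                (λ b∈ → proj₁ (All.lookup all-images.list⊆ b∈)) (≡.sym all-images.same-length)) ⟩
    prod (List.map ev as)                  ≈⟨ *-identityʳ _ ⟨
    prod (List.map ev as) * 1#             ∎)
    where
    -- The representatives of the products with `x`. Each keeps its origin in `cs`, so that two
    -- equal ones can be traced back and `x` cancelled.
    record Images (cs : List A) : Set where
      field
        list : List A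
        list⊆ : All (λ b → b ∈ as × ∃ λ a → a ∈ cs × x * ev a ≈ ev b) list
        list-unique : Unique list
        same-length : length cs ≡ length list
        product : x ^ length cs * prod (List.map ev cs) ≈ prod (List.map ev list)

    image : ∀ cs → (∀ {c} → c ∈ cs → c ∈ as) → Unique cs → Images cs
    image []       sub _ = record
      { list = [] ; list⊆ = [] ; list-unique = [] ; same-length = ≡.refl ; product = *-identityʳ 1# }
    image (c ∷ cs) sub (c∉ ∷ uniq) with closed (sub (here ≡.refl)) | image cs (sub ∘ there) uniq
    ... | b , b∈as , xc≈b | I = record
      { list = b ∷ I.list
      ; list⊆ = (b∈as , c , here ≡.refl , xc≈b) ∷ All.map (λ { (b∈ , a , a∈ , eq) → b∈ , a , there a∈ , eq }) I.list⊆
      ; list-unique = All.map (λ { (_ , a , a∈ , xa≈b′) ≡.refl →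
          All.lookup c∉ a∈ (ev-injective (cancel x≉0 (trans xc≈b (sym xa≈b′)))) }) I.list⊆ ∷ I.list-unique
      ; same-length = ≡.cong suc I.same-length
      ; product = trans
          (solve 4 (λ x p c r → (x :* p) :* (c :* r) := (x :* c) :* (p :* r)) refl x (x ^ length cs) (ev c) (prod (List.map ev cs)))
          (*-cong xc≈b I.product) }
      where module I = Images I

    module all-images = Images (image as (λ p → p) unique)

  -- Monic and low-degree polynomial functions in Horner form; P constrains the non-leading coefficients.
  Monic : (Carrier → Set) → ℕ → (Carrier → Carrier) → Set
  Monic P zero    f = ∀ y → f y ≈ 1#
  Monic P (suc n) f = ∃ λ g → ∃ λ c → P c × Monic P n g × (∀ y → f y ≈ y * g y + c)

  Low : ℕ → (Carrier → Carrier) → Set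
  Low zero    f = ∀ y → f y ≈ 0#
  Low (suc n) f = ∃ λ g → ∃ λ c → Low n g × (∀ y → f y ≈ y * g y + c)

  Any-coefficient : Carrier → Set
  Any-coefficient _ = ⊤

  forget : ∀ {P} n {f} → Monic P n f → Monic Any-coefficient n f
  forget zero    f≈ = f≈
  forget (suc n) (g , c , _ , g-monic , f≈) = g , c , tt , forget n g-monic , f≈

  -- Synthetic division by y - r, read off the Horner form; the remainder is the value at `r`.
  divide : ∀ n {f} → Monic Any-coefficient (suc n) f → ∀ r →
    ∃ λ g → Monic Any-coefficient n g × (∀ y → f y ≈ (y - r) * g y + f r)
  divide zero {f} (g , c , _ , g≈1 , f≈) r = g , g≈1 , λ y → begin
    f y                                    ≈⟨ f≈ y ⟩
    y * g y + c                            ≈⟨ solve 4 (λ y g c r → y :* g :+ c := (y :- r) :* g :+ (r :* g :+ c)) refl y (g y) c r ⟩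
    (y - r) * g y + (r * g y + c)          ≈⟨ +-congˡ (+-congʳ (*-congˡ (trans (g≈1 y) (sym (g≈1 r))))) ⟩
    (y - r) * g y + (r * g r + c)          ≈⟨ +-congˡ (f≈ r) ⟨
    (y - r) * g y + f r                    ∎
  divide (suc n) {f} (g , c , _ , g-monic , f≈) r with divide n g-monic r
  ... | h , h-monic , g≈ = (λ y → y * h y + g r) , (h , g r , tt , h-monic , λ _ → refl) , λ y → begin
    f y                                              ≈⟨ f≈ y ⟩
    y * g y + c                                      ≈⟨ +-congʳ (*-congˡ (g≈ y)) ⟩
    y * ((y - r) * h y + g r) + c                    ≈⟨ solve 5 (λ y r h g c → y :* ((y :- r) :* h :+ g) :+ c
                                                          := (y :- r) :* (y :* h :+ g) :+ (r :* g :+ c)) refl y r (h y) (g r) c ⟩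
    (y - r) * (y * h y + g r) + (r * g r + c)        ≈⟨ +-congˡ (f≈ r) ⟨
    (y - r) * (y * h y + g r) + f r                  ∎

  Distinct : List Carrier → Set
  Distinct = AllPairs (λ x y → ¬ x ≈ y)

  -- Each root is divided out in turn. The other roots stay roots of the quotient because they
  -- differ from it and there are no zero divisors.
  factor : ∀ {rs f} → Monic Any-coefficient (length rs) f → Distinct rs → All (λ r → f r ≈ 0#) rs →
    ∀ y → f y ≈ prod (List.map (λ r → y - r) rs)
  factor {[]}         f-monic _ _ y = f-monic y
  factor {r ∷ rs} {f} f-monic (r∉ ∷ distinct) (fr≈0 ∷ roots) y with divide (length rs) f-monic r
  ... | g , g-monic , f≈ = begin
    f y                                            ≈⟨ f≈ y ⟩
    (y - r) * g y + f r                            ≈⟨ trans (+-congˡ fr≈0) (+-identityʳ _) ⟩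
    (y - r) * g y                                  ≈⟨ *-congˡ (factor g-monic distinct (All.zipWith root (r∉ , roots)) y) ⟩
    (y - r) * prod (List.map (λ r → y - r) rs)     ∎
    where
    root : ∀ {s} → ¬ r ≈ s × f s ≈ 0# → g s ≈ 0#
    root {s} (r≉s , fs≈0) = no-zero-divisors
      (trans (sym (trans (f≈ s) (trans (+-congˡ fr≈0) (+-identityʳ _)))) fs≈0)
      λ s-r≈0 → r≉s (sym (difference-0 s-r≈0))

  Monic+Low : ∀ n {f g} → Monic Any-coefficient n f → Low n g → Monic Any-coefficient n (λ y → f y + g y)
  Monic+Low zero    f≈1 g≈0 y = trans (+-cong (f≈1 y) (g≈0 y)) (+-identityʳ 1#)
  Monic+Low (suc n) (f′ , c , _ , f′-monic , f≈) (g′ , d , g′-low , g≈) =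
    (λ y → f′ y + g′ y) , c + d , tt , Monic+Low n f′-monic g′-low , λ y → trans (+-cong (f≈ y) (g≈ y))
      (solve 5 (λ y f g c d → (y :* f :+ c) :+ (y :* g :+ d) := y :* (f :+ g) :+ (c :+ d)) refl y (f′ y) (g′ y) c d)

  *-Monic : ∀ n {f} x → Monic Any-coefficient n f → Low (suc n) (λ y → x * f y)
  *-Monic zero    x f≈1 = (λ _ → 0#) , x , (λ _ → refl) , λ y → trans (*-congˡ (f≈1 y))
    (trans (*-identityʳ x) (sym (trans (+-congʳ (zeroʳ y)) (+-identityˡ x))))
  *-Monic (suc n) x (g , c , _ , g-monic , f≈) = (λ y → x * g y) , x * c , *-Monic n x g-monic , λ y →
    trans (*-congˡ (f≈ y)) (solve 4 (λ x y g c → x :* (y :* g :+ c) := y :* (x :* g) :+ x :* c) refl x y (g y) c)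

  Low-0 : ∀ n → Low n (λ _ → 0#)
  Low-0 zero    _ = refl
  Low-0 (suc n) = (λ _ → 0#) , 0# , Low-0 n , λ y → sym (trans (+-congʳ (zeroʳ y)) (+-identityˡ 0#))

  -- An affine function stays below the leading term only in degree at least 2, which is why Q is
  -- written as `2 ℕ.+ k`.
  Low-affine : ∀ n c → Low (2 ℕ.+ n) (λ y → - y + c)
  Low-affine n c = (λ _ → - 1#) , c , ((λ _ → 0#) , - 1# , Low-0 n , λ y → sym (trans (+-congʳ (zeroʳ y)) (+-identityˡ _))) ,
    λ y → +-congʳ (trans (sym (-1*x≈-x y)) (*-comm _ y))

  Monic-translate : ∀ n x → Monic Any-coefficient n (λ y → (y + x) ^ n)
  Monic-translate zero    x y = refl
  Monic-translate (suc n) x with Monic+Low (suc n)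
    ((λ y → (y + x) ^ n) , 0# , tt , Monic-translate n x , (λ y → refl)) (*-Monic n x (Monic-translate n x))
  ... | g , c , _ , g-monic , eq = g , c , tt , g-monic , λ y → trans
    (solve 3 (λ x y h → (y :+ x) :* h := (y :* h :+ con ℤ.0ℤ) :+ x :* h) refl x y ((y + x) ^ n)) (eq y)

  Monic-power : ∀ n → Monic Any-coefficient n (_^ n)
  Monic-power zero    y = refl
  Monic-power (suc n) = (_^ n) , 0# , tt , Monic-power n , λ y → sym (+-identityʳ _)

  module Frobenius (In : Carrier → Set) (In-+ : ∀ {x y} → In x → In y → In (x + y)) (elements : List Carrier)
    (elements-In : All In elements) (distinct : Distinct elements)
    (k : ℕ) (size≡ : length elements ≡ 2 ℕ.+ k)
    (In-fixed : ∀ {x} → In x → x ^ (2 ℕ.+ k) ≈ x) where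

    Q : ℕ
    Q = 2 ℕ.+ k

    -- Both sides are monic of degree Q and vanish on the Q given elements.
    agree : ∀ {f} → Monic Any-coefficient Q f → (∀ {y} → In y → f y ≈ 0#) → ∀ y → f y ≈ y ^ Q + (- y + 0#)
    agree {f} f-monic vanish y = trans
      (factor {elements} {f} (≡.subst (λ n → Monic Any-coefficient n f) (≡.sym size≡) f-monic) distinct (All.map vanish elements-In) y)
      (sym (factor {elements} {λ y → y ^ Q + (- y + 0#)} (≡.subst (λ n → Monic Any-coefficient n (λ y → y ^ Q + (- y + 0#))) (≡.sym size≡)
        (Monic+Low Q (Monic-power Q) (Low-affine k 0#))) distinct
        (All.map (λ {y} y∈ → trans (+-congʳ (In-fixed y∈)) (solve 1 (λ y → y :+ (:- y :+ con ℤ.0ℤ) := con ℤ.0ℤ) refl y)) elements-In) y))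

    -- For `a` in the subset, (y + a)^Q - y - a is monic of degree Q in y and vanishes on the
    -- subset, which is closed under addition. Hence it equals y^Q - y everywhere.
    ^Q-+-In : ∀ {a} → In a → ∀ x → (x + a) ^ Q ≈ x ^ Q + a
    ^Q-+-In {a} a∈ x = begin
      (x + a) ^ Q
        ≈⟨ solve 3 (λ p x a → p := (p :+ (:- x :+ :- a)) :+ (x :+ a)) refl ((x + a) ^ Q) x a ⟩
      ((x + a) ^ Q + (- x + - a)) + (x + a)
        ≈⟨ +-congʳ (agree {λ x → (x + a) ^ Q + (- x + - a)} (Monic+Low Q (Monic-translate Q a) (Low-affine k (- a)))
             (λ {y} y∈ → trans (+-congʳ (In-fixed (In-+ y∈ a∈))) (solve 2 (λ y a → (y :+ a) :+ (:- y :+ :- a) := con ℤ.0ℤ) refl y a)) x) ⟩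
      (x ^ Q + (- x + 0#)) + (x + a)
        ≈⟨ solve 3 (λ p x a → (p :+ (:- x :+ con ℤ.0ℤ)) :+ (x :+ a) := p :+ a) refl (x ^ Q) x a ⟩
      x ^ Q + a ∎

    -- The same comparison a second time, now for (y + x)^Q - y - x^Q with arbitrary `x`: that it
    -- vanishes for y in the subset is the previous lemma with the summands exchanged.
    ^Q-+ : ∀ x y → (x + y) ^ Q ≈ x ^ Q + y ^ Q
    ^Q-+ x y = begin
      (x + y) ^ Q
        ≈⟨ ^-congˡ Q (+-comm x y) ⟩
      (y + x) ^ Q
        ≈⟨ solve 3 (λ p y z → p := (p :+ (:- y :+ :- z)) :+ (y :+ z)) refl ((y + x) ^ Q) y (x ^ Q) ⟩
      ((y + x) ^ Q + (- y + - (x ^ Q))) + (y + x ^ Q)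
        ≈⟨ +-congʳ (agree {λ y → (y + x) ^ Q + (- y + - (x ^ Q))} (Monic+Low Q (Monic-translate Q x) (Low-affine k (- (x ^ Q))))
             (λ {a} a∈ → trans (+-congʳ (trans (^-congˡ Q (+-comm a x)) (^Q-+-In a∈ x)))
               (solve 2 (λ p a → (p :+ a) :+ (:- a :+ :- p) := con ℤ.0ℤ) refl (x ^ Q) a)) y) ⟩
      (y ^ Q + (- y + 0#)) + (y + x ^ Q)
        ≈⟨ solve 3 (λ p y z → (p :+ (:- y :+ con ℤ.0ℤ)) :+ (y :+ z) := z :+ p) refl (y ^ Q) y (x ^ Q) ⟩
      x ^ Q + y ^ Q ∎

    Fixed : Carrier → Set
    Fixed c = c ^ Q ≈ c

    -- The Q-th power is additive and multiplicative and fixes the coefficients. It therefore sends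
    -- roots of `f` to roots of `f`.
    Monic-^Q : ∀ n {f} → Monic Fixed n f → ∀ y → f (y ^ Q) ≈ f y ^ Q
    Monic-^Q zero    f≈1 y = trans (f≈1 _) (sym (trans (^-congˡ Q (f≈1 y)) (^-zeroˡ Q)))
      where
      ^-zeroˡ : ∀ n → 1# ^ n ≈ 1#
      ^-zeroˡ zero    = refl
      ^-zeroˡ (suc n) = trans (*-identityˡ _) (^-zeroˡ n)
    Monic-^Q (suc n) {f} (g , c , c-fixed , g-monic , f≈) y = begin
      f (y ^ Q)                   ≈⟨ f≈ (y ^ Q) ⟩
      y ^ Q * g (y ^ Q) + c       ≈⟨ +-cong (*-congˡ (Monic-^Q n g-monic y)) (sym c-fixed) ⟩
      y ^ Q * g y ^ Q + c ^ Q     ≈⟨ +-congʳ (^-distrib-* y (g y) Q) ⟨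
      (y * g y) ^ Q + c ^ Q       ≈⟨ ^Q-+ (y * g y) c ⟨
      (y * g y + c) ^ Q           ≈⟨ ^-congˡ Q (f≈ y) ⟨
      f y ^ Q                     ∎

    conjugate : Carrier → ℕ → Carrier
    conjugate α zero    = α
    conjugate α (suc j) = conjugate (α ^ Q) j

    prod-conjugates : ∀ n α → prod (List.map (λ r → 0# - r) (List.applyUpTo (conjugate α) n)) ≈ (- 1#) ^ n * α ^ geometric Q n
    prod-conjugates zero    α = sym (*-identityˡ 1#)
    prod-conjugates (suc n) α = begin
      (0# - α) * prod (List.map (λ r → 0# - r) (List.applyUpTo (conjugate (α ^ Q)) n))
        ≈⟨ *-congˡ (trans (prod-conjugates n (α ^ Q)) (*-congˡ (^-assocʳ α Q (geometric Q n)))) ⟩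
      (0# - α) * ((- 1#) ^ n * α ^ (Q ℕ.* geometric Q n))
        ≈⟨ *-congʳ (trans (+-identityˡ (- α)) (sym (-1*x≈-x α))) ⟩
      (- 1# * α) * ((- 1#) ^ n * α ^ (Q ℕ.* geometric Q n))
        ≈⟨ solve 4 (λ m a p b → (m :* a) :* (p :* b) := (m :* p) :* (a :* b)) refl (- 1#) α ((- 1#) ^ n) (α ^ (Q ℕ.* geometric Q n)) ⟩
      (- 1#) ^ suc n * α ^ geometric Q (suc n) ∎

    conjugate-power : ∀ j α → conjugate α j ≈ α ^ (Q ℕ.^ j)
    conjugate-power zero    α = sym (*-identityʳ α)
    conjugate-power (suc j) α = trans (conjugate-power j (α ^ Q)) (^-assocʳ α Q (Q ℕ.^ j))

    conjugate-root : ∀ {n f} → Monic Fixed n f → ∀ j {α} → f α ≈ 0# → f (conjugate α j) ≈ 0#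
    conjugate-root f-monic zero    fα≈0 = fα≈0
    conjugate-root {n} f-monic (suc j) {α} fα≈0 =
      conjugate-root f-monic j (trans (Monic-^Q n f-monic α) (trans (^-congˡ Q fα≈0) (zeroˡ _)))

    -- The conjugates of α are the roots of f, and f 0 is the product of their negatives.
    norm : ∀ n {f} → Monic Fixed n f → ∀ α → f α ≈ 0# →
      (∀ {i j} → i ℕ.< j → j ℕ.< n → ¬ α ^ (Q ℕ.^ i) ≈ α ^ (Q ℕ.^ j)) →
      f 0# ≈ (- 1#) ^ n * α ^ geometric Q n
    norm n {f} f-monic α fα≈0 distinct-powers = trans
      (factor {roots} {f} (≡.subst (λ l → Monic Any-coefficient l f) (≡.sym (Listₚ.length-applyUpTo (conjugate α) n)) (forget n f-monic))
        (AllPairsₚ.applyUpTo⁺₁ (conjugate α) n λ {i} {j} i<j j<n eq → distinct-powers i<j j<n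
          (trans (sym (conjugate-power i α)) (trans eq (conjugate-power j α))))
        (Allₚ.applyUpTo⁺₂ (conjugate α) n λ j → conjugate-root {n} f-monic j fα≈0) 0#)
      (prod-conjugates n α)
      where roots = List.applyUpTo (conjugate α) n

-- The finite geometric series (Q - 1)(1 + ... + Q^(n-1)) = Q^n - 1 at Q = 2 + k, arranged so that
-- no truncated subtraction occurs.
geometric-sum : ∀ k n → (1 ℕ.+ k) ℕ.* geometric (2 ℕ.+ k) n ℕ.+ 1 ≡ (2 ℕ.+ k) ℕ.^ n
geometric-sum k zero    = ≡.cong (ℕ._+ 1) (ℕₚ.*-zeroʳ (1 ℕ.+ k))
geometric-sum k (suc n) = begin
  (1 ℕ.+ k) ℕ.* (1 ℕ.+ (2 ℕ.+ k) ℕ.* g) ℕ.+ 1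
    ≡⟨ solve 2 (λ k g → (con 1 :+ k) :* (con 1 :+ (con 2 :+ k) :* g) :+ con 1 := (con 2 :+ k) :* ((con 1 :+ k) :* g :+ con 1)) ≡.refl k g ⟩
  (2 ℕ.+ k) ℕ.* ((1 ℕ.+ k) ℕ.* g ℕ.+ 1)
    ≡⟨ ≡.cong ((2 ℕ.+ k) ℕ.*_) (geometric-sum k n) ⟩
  (2 ℕ.+ k) ℕ.^ suc n ∎
  where
  open ≡.≡-Reasoning
  open Data.Nat.Solver.+-*-Solver
  g = geometric (2 ℕ.+ k) n

-- The block of a primitive TSR matrix is primitive.

module NonzeroVectors (F : FiniteField) where
  open Matrices F
  open FiniteField F using (Carrier; size; elements-unique)
  open ≡ using (refl)

  nonzeroVectors : ∀ k → List (Vec Carrier k)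
  nonzeroVectors k = List.filter (λ v → ¬? (v ≟ⱽ 0ᵛ)) (vectors k)

  ∈-nonzeroVectors : ∀ {k} {v : Vec Carrier k} → v ≢ 0ᵛ → v ∈ nonzeroVectors k
  ∈-nonzeroVectors {v = v} v≢0 = ∈ₚ.∈-filter⁺ (λ v → ¬? (v ≟ⱽ 0ᵛ)) (∈-vectors v) v≢0

  nonzeroVectors-nonzero : ∀ {k} {v : Vec Carrier k} → v ∈ nonzeroVectors k → v ≢ 0ᵛ
  nonzeroVectors-nonzero v∈ = proj₂ (∈ₚ.∈-filter⁻ (λ v → ¬? (v ≟ⱽ 0ᵛ)) {xs = vectors _} v∈)

  nonzeroVectors-unique : ∀ k → Unique (nonzeroVectors k)
  nonzeroVectors-unique k = Uniqueₚ.filter⁺ (λ v → ¬? (v ≟ⱽ 0ᵛ)) (allVecs-unique elements-unique k)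

  length-nonzeroVectors : ∀ k → suc (length (nonzeroVectors k)) ≡ size ℕ.^ k
  length-nonzeroVectors k = ≡.trans (ℕₚ.≤-antisym
    (length-≤ _≡_ (λ p q → ≡.trans p (≡.sym q)) {0ᵛ ∷ nonzeroVectors k} {vectors k}
      (All.tabulate (λ v∈ 0≡v → nonzeroVectors-nonzero v∈ (≡.sym 0≡v)) ∷ nonzeroVectors-unique k)
      (λ {v} _ → v , ∈-vectors v , refl))
    (length-≤ _≡_ (λ p q → ≡.trans p (≡.sym q)) {vectors k} {0ᵛ ∷ nonzeroVectors k}
      (allVecs-unique elements-unique k) (λ {v} _ → v , cover v , refl)))
    (length-vectors k)
    where
    cover : ∀ v → v ∈ 0ᵛ ∷ nonzeroVectors k
    cover v with v ≟ⱽ 0ᵛ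
    ... | yes refl = here refl
    ... | no v≢0   = there (∈-nonzeroVectors v≢0)

module PrimitiveTSR (F : FiniteField) where
  open CommutativeRing (fieldRing F) hiding (zero; refl; sym; trans; _≈_)
  open Algebra.Properties.Ring ring
  open ≡ using (refl; sym; trans; cong; cong₂)
  open ≡.≡-Reasoning
  open Polynomials F
  open Division F
  open Field F
  open Operators F
  open Matrices F
  open Krylov F
  open Register F
  open NonzeroVectors F
  private module P = CommutativeRing polyRing

  -- The power (-1)^n. For `suc n` blocks the value of c₀ that the norm formula asks for, (-1)^(suc
  -- n + 1), is `sign n`.
  sign : ℕ → Carrier
  sign zero    = 1#
  sign (suc n) = - sign n

  sign² : ∀ n → sign n * sign n ≡ 1#
  sign² zero    = *-identityˡ 1#
  sign² (suc n) = begin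
    - sign n * - sign n      ≡⟨ -‿distribˡ-* (sign n) (- sign n) ⟨
    - (sign n * - sign n)    ≡⟨ cong -_ (-‿distribʳ-* (sign n) (sign n)) ⟨
    - - (sign n * sign n)    ≡⟨ -‿involutive _ ⟩
    sign n * sign n          ≡⟨ sign² n ⟩
    1#                       ∎

  sign-nonzero : ∀ n → sign n ≢ 0#
  sign-nonzero n eq = FiniteField.0≢1 F (trans (sym (zeroˡ (sign n))) (trans (cong (_* sign n) (sym eq)) (sign² n)))

  module _ (m n : ℕ) (c : Vec Carrier (suc n)) (B : Matrix Carrier m) where
    open TSR m n c B
    private
      N = suc n ℕ.* m
      Uⱽ = Vec (Vec Carrier m) (suc n)

    module Block (f : Vec Carrier N) (T≈f : charPoly F (tsr F m (suc n) c B) ≈ monic F f) (f-irr : Irreducible F (monic F f))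
      (b : Vec Carrier m) (B≈b : charPoly F B ≈ monic F b) (b-irr : Irreducible F (monic F b))
      {e : Vec Carrier m} (e≢0 : e ≢ 0ᵛ) where
      open Irreducible-TSR f T≈f f-irr
      private module IB = Irreducible-matrix B b B≈b b-irr e≢0

      DV : Operator
      DV = Blk.diagonal (suc n)
      module D = Operator DV

      component : Fin (suc n) → Intertwiner DV (rowOperator B)
      component i = record
        { φ = λ y → lookup y i
        ; φ-⊕ = λ x y → Vecₚ.lookup-zipWith Row._⊕_ i x y
        ; φ-· = λ a x → Vecₚ.lookup-map i (a Row.·_) x
        ; φ-op = λ x → Vecₚ.lookup-map i Row.op x }

      D-act : ∀ p y → D.act p y ≡ Vec.map (Row.act p) y
      D-act p y = lookup-ext λ i → trans (Intertwiner.φ-act (component i) p y) (sym (Vecₚ.lookup-map i (Row.act p) y))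

      x₀ : Uⱽ
      x₀ = e ∷ Vec.replicate n 0ᵛ

      x₀≢𝟎 : x₀ ≢ U.𝟎
      x₀≢𝟎 eq = e≢0 (cong Vec.head eq)

      open Generator x₀≢𝟎

      -- The field F[X]/(f), realised on polynomials through their action on the generator x₀.
      record _≈ₖ_ (p r : Poly F) : Set where
        constructor by-action
        field action : U.act p x₀ ≡ U.act r x₀
      open _≈ₖ_

      lift : ∀ {p r} → p ≈ r → p ≈ₖ r
      lift eq = by-action (U.act-cong x₀ eq)

      K : CommutativeRing 0ℓ 0ℓ
      K = record
        { Carrier = Poly F ; _≈_ = _≈ₖ_ ; _+_ = addP F ; _*_ = mulP F ; -_ = negP F ; 0# = [] ; 1# = oneP F
        ; isCommutativeRing = record
          { isRing = record
            { +-isAbelianGroup = record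
              { isGroup = record
                { isMonoid = record
                  { isSemigroup = record
                    { isMagma = record
                      { isEquivalence = record
                        { refl = by-action refl
                        ; sym = λ p → by-action (sym (action p))
                        ; trans = λ p q → by-action (trans (action p) (action q)) }
                      ; ∙-cong = λ {p} {p′} {r} {r′} p≈ r≈ → by-action (trans (U.act-addP p r x₀)
                          (trans (cong₂ U._⊕_ (action p≈) (action r≈)) (sym (U.act-addP p′ r′ x₀)))) }
                    ; assoc = λ p r s → lift (P.+-assoc p r s) }
                  ; identity = (λ p → lift (P.+-identityˡ p)) , (λ p → lift (P.+-identityʳ p)) }
                ; inverse = (λ p → lift (P.-‿inverseˡ p)) , (λ p → lift (P.-‿inverseʳ p))
                ; ⁻¹-cong = λ {p} {r} p≈ → by-action (trans (U.act-negP p x₀)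
                    (trans (cong ((- 1#) U.·_) (action p≈)) (sym (U.act-negP r x₀)))) }
              ; comm = λ p r → lift (P.+-comm p r) }
            ; *-cong = λ {p} {p′} {r} {r′} p≈ r≈ → by-action (*-cong-action p p′ r r′ (action p≈) (action r≈))
            ; *-assoc = λ p r s → lift (P.*-assoc p r s)
            ; *-identity = (λ p → lift (P.*-identityˡ p)) , (λ p → lift (P.*-identityʳ p))
            ; distrib = (λ p r s → lift (P.distribˡ p r s)) , (λ p r s → lift (P.distribʳ p r s)) }
          ; *-comm = λ p r → lift (P.*-comm p r) } }
        where
        *-cong-action : ∀ p p′ r r′ → U.act p x₀ ≡ U.act p′ x₀ → U.act r x₀ ≡ U.act r′ x₀ →
          U.act (mulP F p r) x₀ ≡ U.act (mulP F p′ r′) x₀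
        *-cong-action p p′ r r′ p≈ r≈ = begin
          U.act (mulP F p r) x₀       ≡⟨ U.act-mulP p r x₀ ⟩
          U.act p (U.act r x₀)        ≡⟨ cong (U.act p) r≈ ⟩
          U.act p (U.act r′ x₀)       ≡⟨ U.act-comm p r′ x₀ ⟩
          U.act r′ (U.act p x₀)       ≡⟨ cong (U.act r′) p≈ ⟩
          U.act r′ (U.act p′ x₀)      ≡⟨ U.act-comm r′ p′ x₀ ⟩
          U.act p′ (U.act r′ x₀)      ≡⟨ U.act-mulP p′ r′ x₀ ⟨
          U.act (mulP F p′ r′) x₀     ∎

      private module K = CommutativeRing K

      1≉0 : ¬ oneP F ≈ₖ []
      1≉0 eq = x₀≢𝟎 (trans (sym (U.act-oneP x₀)) (action eq))

      -- If `r` takes `x₀` to a nonzero state, then `p` kills that state, so `f` divides `p` and `p`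
      -- kills `x₀` as well.
      no-zero-divisors : ∀ {p r} → mulP F p r ≈ₖ [] → ¬ p ≈ₖ [] → r ≈ₖ []
      no-zero-divisors {p} {r} pr≈0 p≉0 = by-action (decidable-stable (Vecₚ.≡-dec _≟ⱽ_ (U.act r x₀) U.𝟎) λ rx≢𝟎 →
        p≉0 (by-action (U.∣⇒act-𝟎 {monic F f} {p} (annihilates x₀)
          (Generator.act-𝟎⇒∣ rx≢𝟎 p (trans (sym (U.act-mulP p r x₀)) (action pr≈0))))))

      isDomain : IsDomain K
      isDomain = record { 1≉0 = 1≉0 ; no-zero-divisors = λ {p} {r} → no-zero-divisors {p} {r} }

      open Domain K isDomain

      private module Powᴷ = Algebra.Properties.Semiring.Exp K.semiring

      ^-agrees : ∀ x l → x Powᴷ.^ l ≡ x Pow.^ l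
      ^-agrees x zero    = refl
      ^-agrees x (suc l) = cong (mulP F x) (^-agrees x l)

      B̂ : Intertwiner shiftRegister shiftRegister
      B̂ = record { φ = D.op ; φ-⊕ = D.op-⊕ ; φ-· = D.op-· ; φ-op = λ x → sym (Blk.step-map-op c x) }

      β : Poly F
      β = toPoly (proj₁ (generates (D.op x₀)))

      -- `β` is chosen to agree with the block at `x₀` only. Both commute with the register and `x₀`
      -- generates all states, so they agree everywhere.
      act-β : ∀ y → U.act β y ≡ D.op y
      act-β y = begin
        U.act β y                  ≡⟨ cong (U.act β) py≡ ⟨
        U.act β (U.act p x₀)       ≡⟨ U.act-comm β p x₀ ⟩
        U.act p (U.act β x₀)       ≡⟨ cong (U.act p) (proj₂ (generates (D.op x₀))) ⟩
        U.act p (D.op x₀)          ≡⟨ Intertwiner.φ-act B̂ p x₀ ⟨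
        D.op (U.act p x₀)          ≡⟨ cong D.op py≡ ⟩
        D.op y                     ∎
        where
        p : Poly F
        p = toPoly (proj₁ (generates y))
        py≡ : U.act p x₀ ≡ y
        py≡ = proj₂ (generates y)

      -- Substitution of `β` for the variable; its image is the subfield L generated by the block.
      at-β : Poly F → Poly F
      at-β []      = []
      at-β (a ∷ q) = addP F (a ∷ []) (mulP F β (at-β q))

      act-constant : ∀ a y → U.act (a ∷ []) y ≡ a U.· y
      act-constant a y = trans (cong (a U.· y U.⊕_) U.op-𝟎) (U.⊕-identityʳ _)

      act-at-β : ∀ q y → U.act (at-β q) y ≡ D.act q y
      act-at-β []      y = refl
      act-at-β (a ∷ q) y = trans (U.act-addP (a ∷ []) (mulP F β (at-β q)) y) (cong₂ U._⊕_ (act-constant a y) (begin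
        U.act (mulP F β (at-β q)) y    ≡⟨ U.act-mulP β (at-β q) y ⟩
        U.act β (U.act (at-β q) y)     ≡⟨ act-β _ ⟩
        D.op (U.act (at-β q) y)        ≡⟨ cong D.op (act-at-β q y) ⟩
        D.op (D.act q y)               ∎))

      ev : Vec Carrier m → Poly F
      ev a = at-β (toPoly a)

      -- On the first block of `x₀` a polynomial in `β` acts as the same polynomial in `B` on `e`,
      -- and the irreducible `b` separates polynomials of degree below `m` there.
      ev-injective : ∀ {a a′} → ev a ≈ₖ ev a′ → a ≡ a′
      ev-injective {a} {a′} eq = IB.act-injective (begin
        Row.act (toPoly a) e                        ≡⟨ Intertwiner.φ-act (component zero) (toPoly a) x₀ ⟨
        lookup (D.act (toPoly a) x₀) zero           ≡⟨ cong (λ y → lookup y zero) (trans (sym (act-at-β (toPoly a) x₀)) (trans (action eq) (act-at-β (toPoly a′) x₀))) ⟩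
        lookup (D.act (toPoly a′) x₀) zero          ≡⟨ Intertwiner.φ-act (component zero) (toPoly a′) x₀ ⟩
        Row.act (toPoly a′) e                       ∎)

      D-annihilates : ∀ y → D.act (monic F b) y ≡ D.𝟎
      D-annihilates y = trans (D-act (monic F b) y) (trans (Vecₚ.map-cong IB.annihilates y) (Vecₚ.map-const y 0ᵛ))

      at-β-remainder : ∀ q → at-β q ≈ₖ ev (remainder b q)
      at-β-remainder q = by-action (trans (act-at-β q x₀)
        (trans (D.act-remainder b (D-annihilates x₀) q) (sym (act-at-β (toPoly (remainder b q)) x₀))))

      at-β-* : ∀ q r → mulP F (at-β q) (at-β r) ≈ₖ at-β (mulP F q r)
      at-β-* q r = by-action (begin
        U.act (mulP F (at-β q) (at-β r)) x₀      ≡⟨ U.act-mulP (at-β q) (at-β r) x₀ ⟩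
        U.act (at-β q) (U.act (at-β r) x₀)       ≡⟨ trans (act-at-β q _) (cong (D.act q) (act-at-β r x₀)) ⟩
        D.act q (D.act r x₀)                     ≡⟨ D.act-mulP q r x₀ ⟨
        D.act (mulP F q r) x₀                    ≡⟨ act-at-β (mulP F q r) x₀ ⟨
        U.act (at-β (mulP F q r)) x₀             ∎)

      at-β-+ : ∀ q r → addP F (at-β q) (at-β r) ≈ₖ at-β (addP F q r)
      at-β-+ q r = by-action (begin
        U.act (addP F (at-β q) (at-β r)) x₀                ≡⟨ U.act-addP (at-β q) (at-β r) x₀ ⟩
        U.act (at-β q) x₀ U.⊕ U.act (at-β r) x₀            ≡⟨ cong₂ U._⊕_ (act-at-β q x₀) (act-at-β r x₀) ⟩
        D.act q x₀ D.⊕ D.act r x₀                          ≡⟨ D.act-addP q r x₀ ⟨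
        D.act (addP F q r) x₀                              ≡⟨ act-at-β (addP F q r) x₀ ⟨
        U.act (at-β (addP F q r)) x₀                       ∎)

      InL : Poly F → Set
      InL x = ∃ λ q → x ≈ₖ at-β q

      InL-+ : ∀ {x y} → InL x → InL y → InL (addP F x y)
      InL-+ (q , x≈) (r , y≈) = addP F q r , K.trans (K.+-cong x≈ y≈) (at-β-+ q r)

      -- The nonzero elements of L are represented by the nonzero vectors of length `m`, and
      -- `remainder b` finds the representative of a product.
      InL-fermat : ∀ {x} → InL x → ¬ x ≈ₖ [] → (x Powᴷ.^ length (nonzeroVectors m)) ≈ₖ oneP F
      InL-fermat {x} (q , x≈q) x≉0 = fermat ev ev-injective (nonzeroVectors m) (nonzeroVectors-unique m)
        (All.tabulate λ a∈ → ev-nonzero (nonzeroVectors-nonzero a∈)) x≉0 λ {a} a∈ →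
          let xa≈ = K.trans (K.*-congʳ x≈q) (K.trans (at-β-* q (toPoly a)) (at-β-remainder (mulP F q (toPoly a)))) in
          remainder b (mulP F q (toPoly a)) ,
          ∈-nonzeroVectors (λ eq → ev-nonzero (nonzeroVectors-nonzero a∈)
            (no-zero-divisors (K.trans xa≈ (≡.subst (λ v → ev v ≈ₖ []) (sym eq) ev-0)) x≉0)) ,
          xa≈
        where
        ev-0 : ev 0ᵛ ≈ₖ []
        ev-0 = by-action (trans (act-at-β (toPoly (0ᵛ {m})) x₀) (D.act-≈[] (toPoly (0ᵛ {m})) x₀ (replicate-zero m)))
        ev-nonzero : ∀ {a} → a ≢ 0ᵛ → ¬ ev a ≈ₖ []
        ev-nonzero a≢0 ev≈0 = a≢0 (ev-injective (K.trans ev≈0 (K.sym ev-0)))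

      module Order (k : ℕ) (size≡ : FiniteField.size F ℕ.^ m ≡ 2 ℕ.+ k) where

        *-absorbs-0 : ∀ p r → p ≈ₖ [] → mulP F p r ≈ₖ p
        *-absorbs-0 p r p≈0 = K.trans (K.*-cong {p} {[]} {r} {r} p≈0 K.refl) (K.sym p≈0)

        *-absorbs-1 : ∀ p r → r ≈ₖ oneP F → mulP F p r ≈ₖ p
        *-absorbs-1 p r r≈1 = K.trans (K.*-cong {p} {p} {r} {oneP F} K.refl r≈1) (K.*-identityʳ p)

        InL-fixed : ∀ {x} → InL x → (x Powᴷ.^ (2 ℕ.+ k)) ≈ₖ x
        InL-fixed {x} x∈ = case Vecₚ.≡-dec _≟ⱽ_ (U.act x x₀) U.𝟎 of λ where
          (yes eq) → *-absorbs-0 x (x Powᴷ.^ (1 ℕ.+ k)) (by-action eq)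
          (no neq) → *-absorbs-1 x (x Powᴷ.^ (1 ℕ.+ k)) (≡.subst (λ l → (x Powᴷ.^ l) ≈ₖ oneP F)
            (ℕₚ.suc-injective (trans (length-nonzeroVectors m) size≡)) (InL-fermat x∈ λ eq → neq (action eq)))

        L : List (Poly F)
        L = List.map ev (vectors m)

        L-distinct : Distinct L
        L-distinct = AllPairsₚ.map⁺ (AllPairs.map (λ a≢a′ eq → a≢a′ (ev-injective eq))
          (allVecs-unique (FiniteField.elements-unique F) m))

        open Frobenius InL InL-+ L (Allₚ.map⁺ (All.tabulate λ {a} _ → toPoly a , K.refl)) L-distinct k
          (trans (Listₚ.length-map ev (vectors m)) (trans (length-vectors m) size≡)) InL-fixed

        -- The function Y^l - β (a₀ + a₁ Y + ...) in Horner form. The coefficient - a β is written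
        -- as `at-β` of - a X, which exhibits it as an element of L.
        feedback : ∀ {l} → Vec Carrier l → Poly F → Poly F
        feedback []       y = oneP F
        feedback (a ∷ as) y = addP F (mulP F y (feedback as y)) (at-β (shift (- a ∷ [])))

        feedback-monic : ∀ {l} (as : Vec Carrier l) → Monic Fixed l (feedback as)
        feedback-monic []       y = K.refl
        feedback-monic (a ∷ as) = feedback as , at-β (shift (- a ∷ [])) ,
          InL-fixed (shift (- a ∷ []) , K.refl) , feedback-monic as , λ y → K.refl

        act-coefficient : ∀ a y → U.act (at-β (shift (- a ∷ []))) y ≡ (- a) D.· D.op y
        act-coefficient a y = trans (act-at-β (shift (- a ∷ [])) y) (trans (D.act-shift (- a ∷ []) y)
          (trans (cong D.op (trans (cong ((- a) D.· y D.⊕_) D.op-𝟎) (D.⊕-identityʳ _))) (D.op-· (- a) y)))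

        heads : ∀ l → Uⱽ → Vec (Vec Carrier m) l
        heads l y = tabulate λ i → Vec.head (U.iterate (toℕ i) y)

        head-⊕ : ∀ (x y : Uⱽ) → Vec.head (x U.⊕ y) ≡ Vec.head x Row.⊕ Vec.head y
        head-⊕ (x ∷ xs) (y ∷ ys) = refl

        head-·op : ∀ a (y : Uⱽ) → Vec.head (a D.· D.op y) ≡ a Row.· Row.op (Vec.head y)
        head-·op a (y ∷ ys) = refl

        -- Only the first block is computed: it involves the output sequence of the register alone,
        -- and `feedback-root` shows that it is enough.
        head-feedback : ∀ {l} (as : Vec Carrier l) y → Vec.head (U.act (feedback as X) y) ≡
          Vec.head (U.iterate l y) Row.⊕ (- 1#) Row.· Row.op (Blk.combine as (heads l y))
        head-feedback [] y = trans (cong Vec.head (U.act-oneP y))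
          (sym (trans (cong (Vec.head y Row.⊕_) (trans (cong ((- 1#) Row.·_) Row.op-𝟎) (Row.·-𝟎 _))) (Row.⊕-identityʳ _)))
        head-feedback {suc l} (a ∷ as) y = begin
          Vec.head (U.act (addP F (mulP F X (feedback as X)) (at-β (shift (- a ∷ [])))) y)
            ≡⟨ cong Vec.head (trans (U.act-addP (mulP F X (feedback as X)) (at-β (shift (- a ∷ []))) y)
                 (cong₂ U._⊕_ shifted (act-coefficient a y))) ⟩
          Vec.head (U.act (feedback as X) (U.op y) U.⊕ (- a) D.· D.op y)
            ≡⟨ trans (head-⊕ (U.act (feedback as X) (U.op y)) ((- a) D.· D.op y)) (cong₂ Row._⊕_ (head-feedback as (U.op y)) (head-·op (- a) y)) ⟩
          (h Row.⊕ (- 1#) Row.· Row.op C) Row.⊕ (- a) Row.· Row.op (Vec.head y)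
            ≡⟨ Row.⊕-assoc _ _ _ ⟩
          h Row.⊕ ((- 1#) Row.· Row.op C Row.⊕ (- a) Row.· Row.op (Vec.head y))
            ≡⟨ cong (h Row.⊕_) (trans (Row.⊕-comm _ _) (cong (Row._⊕ (- 1#) Row.· Row.op C) (trans
                 (cong (Row._· Row.op (Vec.head y)) (sym (-1*x≈-x a))) (Row.*-· (- 1#) a _)))) ⟩
          h Row.⊕ ((- 1#) Row.· a Row.· Row.op (Vec.head y) Row.⊕ (- 1#) Row.· Row.op C)
            ≡⟨ cong (h Row.⊕_) (Row.·-⊕ (- 1#) _ _) ⟨
          h Row.⊕ (- 1#) Row.· (a Row.· Row.op (Vec.head y) Row.⊕ Row.op C)
            ≡⟨ cong (λ z → h Row.⊕ (- 1#) Row.· z) (trans (cong (Row._⊕ Row.op C) (sym (Row.op-· a (Vec.head y)))) (sym (Row.op-⊕ (a Row.· Vec.head y) C))) ⟩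
          h Row.⊕ (- 1#) Row.· Row.op (a Row.· Vec.head y Row.⊕ C) ∎
          where
          h : Vec Carrier m
          h = Vec.head (U.iterate l (U.op y))
          C : Vec Carrier m
          C = Blk.combine as (heads l (U.op y))
          shifted : U.act (mulP F X (feedback as X)) y ≡ U.act (feedback as X) (U.op y)
          shifted = trans (U.act-mulP X (feedback as X) y) (trans (U.act-X _) (sym (U.act-op (feedback as X) y)))

        lookup-op : ∀ j (y : Uⱽ) → lookup (U.op y) (inject₁ j) ≡ lookup y (suc j)
        lookup-op j (y ∷ ys) = lookup-∷ʳ-inject₁ ys _ j

        lookup-op-last : ∀ (y : Uⱽ) → lookup (U.op y) (fromℕ n) ≡ Row.op (Blk.combine c y)
        lookup-op-last (y ∷ ys) = lookup-∷ʳ-last ys _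

        -- A state is a window on the output sequence: its block `i` reaches the front after `i`
        -- steps.
        head-iterate : ∀ l (i : Fin (suc n)) y → toℕ i ≡ l → Vec.head (U.iterate l y) ≡ lookup y i
        head-iterate zero    zero    (y ∷ ys) _  = refl
        head-iterate (suc l) (suc j) y        eq =
          trans (head-iterate l (inject₁ j) (U.op y) (trans (Finₚ.toℕ-inject₁ j) (ℕₚ.suc-injective eq))) (lookup-op j y)

        heads-all : ∀ y → heads (suc n) y ≡ y
        heads-all y = lookup-ext λ i → trans (Vecₚ.lookup∘tabulate (λ i → Vec.head (U.iterate (toℕ i) y)) i) (head-iterate (toℕ i) i y refl)

        -- After `suc n` steps the front block is the one fed in at the first step, which is exactly
        -- the feedback that the polynomial subtracts.
        head-feedback-𝟎 : ∀ y → Vec.head (U.act (feedback c X) y) ≡ 0ᵛ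
        head-feedback-𝟎 y = begin
          Vec.head (U.act (feedback c X) y)
            ≡⟨ head-feedback c y ⟩
          Vec.head (U.iterate n (U.op y)) Row.⊕ (- 1#) Row.· Row.op (Blk.combine c (heads (suc n) y))
            ≡⟨ cong₂ (λ u w → u Row.⊕ (- 1#) Row.· Row.op (Blk.combine c w))
                 (trans (head-iterate n (fromℕ n) (U.op y) (Finₚ.toℕ-fromℕ n)) (lookup-op-last y)) (heads-all y) ⟩
          Row.op (Blk.combine c y) Row.⊕ (- 1#) Row.· Row.op (Blk.combine c y)
            ≡⟨ Row.⊕-inverse _ ⟩
          0ᵛ ∎

        -- A nonzero value would generate x₀, whose first block is nonzero.
        feedback-root : feedback c X ≈ₖ []
        feedback-root = by-action (decidable-stable (Vecₚ.≡-dec _≟ⱽ_ z U.𝟎) λ z≢𝟎 →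
          let p = toPoly (proj₁ (Generator.generates z≢𝟎 x₀)) in e≢0 (begin
            Vec.head x₀                                      ≡⟨ cong Vec.head (proj₂ (Generator.generates z≢𝟎 x₀)) ⟨
            Vec.head (U.act p (U.act (feedback c X) x₀))     ≡⟨ cong Vec.head (U.act-comm p (feedback c X) x₀) ⟩
            Vec.head (U.act (feedback c X) (U.act p x₀))     ≡⟨ head-feedback-𝟎 _ ⟩
            0ᵛ                                               ∎))
          where z = U.act (feedback c X) x₀

        exponent : ℕ
        exponent = geometric (2 ℕ.+ k) (suc n)

        module _ (c₀≡sign : Vec.head c ≡ sign n)
          (X-distinct : ∀ {i j} → i ℕ.< j → j ℕ.< suc n → ¬ (X Pow.^ ((2 ℕ.+ k) ℕ.^ i)) ≈ₖ (X Pow.^ ((2 ℕ.+ k) ℕ.^ j))) where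

          act-sign : ∀ l y → U.act (negP F (oneP F) Pow.^ l) y ≡ sign l U.· y
          act-sign zero    y = trans (U.act-oneP y) (sym (U.1-· y))
          act-sign (suc l) y = begin
            U.act (mulP F (negP F (oneP F)) (negP F (oneP F) Pow.^ l)) y
              ≡⟨ U.act-mulP (negP F (oneP F)) (negP F (oneP F) Pow.^ l) y ⟩
            U.act (negP F (oneP F)) (U.act (negP F (oneP F) Pow.^ l) y)
              ≡⟨ trans (U.act-negP (oneP F) _) (cong ((- 1#) U.·_) (trans (U.act-oneP _) (act-sign l y))) ⟩
            (- 1#) U.· sign l U.· y
              ≡⟨ U.*-· (- 1#) (sign l) y ⟨
            (- 1# * sign l) U.· y
              ≡⟨ cong (U._· y) (-1*x≈-x (sign l)) ⟩
            (- sign l) U.· y ∎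

          feedback-at-0 : ∀ (as : Vec Carrier (suc n)) y → U.act (feedback as []) y ≡ (- Vec.head as) D.· D.op y
          feedback-at-0 (a ∷ as) y = act-coefficient a y

          -- The feedback polynomial at 0 is - c₀ β directly, and (-1)^(suc n) times X^E by the norm
          -- formula, with E the `exponent`. The normalisation of c₀ makes both signs
          -- `sign (suc n)`, which cancels.
          block-on-x₀ : D.op x₀ ≡ U.act (X Pow.^ exponent) x₀
          block-on-x₀ = U.difference-𝟎 (U.·-cancel (sign-nonzero (suc n)) (begin
            sign (suc n) U.· (D.op x₀ U.⊕ (- 1#) U.· w)
              ≡⟨ U.·-⊕ (sign (suc n)) _ _ ⟩
            sign (suc n) U.· D.op x₀ U.⊕ sign (suc n) U.· (- 1#) U.· w
              ≡⟨ cong₂ U._⊕_ norm-action (Blocks.·-swap shiftRegister (sign (suc n)) (- 1#) w) ⟩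
            sign (suc n) U.· w U.⊕ (- 1#) U.· sign (suc n) U.· w
              ≡⟨ U.⊕-inverse _ ⟩
            U.𝟎 ∎))
            where
            w = U.act (X Pow.^ exponent) x₀
            norm-action : sign (suc n) U.· D.op x₀ ≡ sign (suc n) U.· w
            norm-action = begin
              sign (suc n) U.· D.op x₀
                ≡⟨ cong (λ a → (- a) U.· D.op x₀) c₀≡sign ⟨
              (- Vec.head c) D.· D.op x₀
                ≡⟨ feedback-at-0 c x₀ ⟨
              U.act (feedback c []) x₀
                ≡⟨ action (norm (suc n) {feedback c} (feedback-monic c) X feedback-root λ {i} {j} i<j j<n eq → X-distinct i<j j<n
                     (≡.subst₂ _≈ₖ_ (^-agrees X (Q ℕ.^ i)) (^-agrees X (Q ℕ.^ j)) eq)) ⟩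
              U.act (mulP F (negP F (oneP F) Powᴷ.^ suc n) (X Powᴷ.^ exponent)) x₀
                ≡⟨ cong₂ (λ p r → U.act (mulP F p r) x₀) (^-agrees (negP F (oneP F)) (suc n)) (^-agrees X exponent) ⟩
              U.act (mulP F (negP F (oneP F) Pow.^ suc n) (X Pow.^ exponent)) x₀
                ≡⟨ U.act-mulP (negP F (oneP F) Pow.^ suc n) (X Pow.^ exponent) x₀ ⟩
              U.act (negP F (oneP F) Pow.^ suc n) w
                ≡⟨ act-sign (suc n) w ⟩
              sign (suc n) U.· w ∎

          block-power : ∀ y → D.op y ≡ U.act (X Pow.^ exponent) y
          block-power y = begin
            D.op y                                    ≡⟨ cong D.op py≡ ⟨
            D.op (U.act p x₀)                         ≡⟨ Intertwiner.φ-act B̂ p x₀ ⟩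
            U.act p (D.op x₀)                         ≡⟨ cong (U.act p) block-on-x₀ ⟩
            U.act p (U.act (X Pow.^ exponent) x₀)     ≡⟨ U.act-comm p (X Pow.^ exponent) x₀ ⟩
            U.act (X Pow.^ exponent) (U.act p x₀)     ≡⟨ cong (U.act (X Pow.^ exponent)) py≡ ⟩
            U.act (X Pow.^ exponent) y                ∎
            where
            p : Poly F
            p = toPoly (proj₁ (generates y))
            py≡ : U.act p x₀ ≡ y
            py≡ = proj₂ (generates y)

          block-powers : ∀ l y → D.act (X Pow.^ l) y ≡ U.act (X Pow.^ (exponent ℕ.* l)) y
          block-powers zero    y = trans (D.act-oneP y)
            (sym (trans (cong (λ l → U.act (X Pow.^ l) y) (ℕₚ.*-zeroʳ exponent)) (U.act-oneP y)))
          block-powers (suc l) y = begin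
            D.act (mulP F X (X Pow.^ l)) y
              ≡⟨ trans (D.act-mulP X (X Pow.^ l) y) (D.act-X _) ⟩
            D.op (D.act (X Pow.^ l) y)
              ≡⟨ trans (block-power _) (cong (U.act (X Pow.^ exponent)) (block-powers l y)) ⟩
            U.act (X Pow.^ exponent) (U.act (X Pow.^ (exponent ℕ.* l)) y)
              ≡⟨ U.act-mulP (X Pow.^ exponent) (X Pow.^ (exponent ℕ.* l)) y ⟨
            U.act (mulP F (X Pow.^ exponent) (X Pow.^ (exponent ℕ.* l))) y
              ≡⟨ U.act-cong y (Pow.^-homo-* X exponent (exponent ℕ.* l)) ⟨
            U.act (X Pow.^ (exponent ℕ.+ exponent ℕ.* l)) y
              ≡⟨ cong (λ l → U.act (X Pow.^ l) y) (ℕₚ.*-suc exponent l) ⟨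
            U.act (X Pow.^ (exponent ℕ.* suc l)) y ∎

          -- The block to the power `l` is the register to the power E l, with E the `exponent`. As
          -- `f` and `b` generate the annihilators of `x₀` and `e`, divisibility of X^l - 1 passes
          -- between them in both directions.
          order-⇒ : ∀ l → monic F b ∣ xPowMinusOne F l → monic F f ∣ xPowMinusOne F (exponent ℕ.* l)
          order-⇒ l b∣ = act-𝟎⇒∣ (xPowMinusOne F (exponent ℕ.* l)) (U.X^-minus-one-act (exponent ℕ.* l) x₀ (begin
            U.act (X Pow.^ (exponent ℕ.* l)) x₀   ≡⟨ block-powers l x₀ ⟨
            D.act (X Pow.^ l) x₀                  ≡⟨ D.act-X^-minus-one l x₀ (D.∣⇒act-𝟎 {monic F b} (D-annihilates x₀) b∣) ⟩
            x₀                                    ∎))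

          order-⇐ : ∀ l → monic F f ∣ xPowMinusOne F (exponent ℕ.* l) → monic F b ∣ xPowMinusOne F l
          order-⇐ l f∣ = IB.act-𝟎⇒∣ (xPowMinusOne F l) (Row.X^-minus-one-act l e (begin
            Row.act (X Pow.^ l) e                             ≡⟨ Intertwiner.φ-act (component zero) (X Pow.^ l) x₀ ⟨
            lookup (D.act (X Pow.^ l) x₀) zero                ≡⟨ cong (λ y → lookup y zero) (block-powers l x₀) ⟩
            lookup (U.act (X Pow.^ (exponent ℕ.* l)) x₀) zero ≡⟨ cong (λ y → lookup y zero)
              (U.act-X^-minus-one (exponent ℕ.* l) x₀ (U.∣⇒act-𝟎 {monic F f} (annihilates x₀) f∣)) ⟩
            e                                                 ∎))

        X-powers-nonzero : ¬ X ≈ₖ [] → ∀ l → ¬ (X Pow.^ l) ≈ₖ []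
        X-powers-nonzero X≉0 zero    eq = 1≉0 eq
        X-powers-nonzero X≉0 (suc l) eq = X-powers-nonzero X≉0 l (no-zero-divisors {X} {X Pow.^ l} eq X≉0)

        register-order : FiniteField.size F ℕ.^ N ∸ 1 ≡ exponent ℕ.* (1 ℕ.+ k)
        register-order = begin
          FiniteField.size F ℕ.^ N ∸ 1                  ≡⟨ cong (λ l → FiniteField.size F ℕ.^ l ∸ 1) (ℕₚ.*-comm (suc n) m) ⟩
          FiniteField.size F ℕ.^ (m ℕ.* suc n) ∸ 1      ≡⟨ cong (_∸ 1) (ℕₚ.^-*-assoc (FiniteField.size F) m (suc n)) ⟨
          (FiniteField.size F ℕ.^ m) ℕ.^ suc n ∸ 1      ≡⟨ cong (λ q → q ℕ.^ suc n ∸ 1) size≡ ⟩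
          (2 ℕ.+ k) ℕ.^ suc n ∸ 1                       ≡⟨ cong (_∸ 1) (geometric-sum k (suc n)) ⟨
          (1 ℕ.+ k) ℕ.* exponent ℕ.+ 1 ∸ 1              ≡⟨ ℕₚ.m+n∸n≡m ((1 ℕ.+ k) ℕ.* exponent) 1 ⟩
          (1 ℕ.+ k) ℕ.* exponent                        ≡⟨ ℕₚ.*-comm (1 ℕ.+ k) exponent ⟩
          exponent ℕ.* (1 ℕ.+ k)                        ∎

        block-order : FiniteField.size F ℕ.^ m ∸ 1 ≡ 1 ℕ.+ k
        block-order = cong (_∸ 1) size≡

        module _ (f-prim : Primitive F N (monic F f)) where

          f∣ : monic F f ∣ xPowMinusOne F (exponent ℕ.* (1 ℕ.+ k))
          f∣ = ≡.subst (λ l → monic F f ∣ xPowMinusOne F l) register-order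
            (fromDefs-∣ {monic F f} {xPowMinusOne F (FiniteField.size F ℕ.^ N ∸ 1)} (proj₁ (proj₂ f-prim)))

          minimal : ∀ l → 1 ℕ.≤ l → l ℕ.< exponent ℕ.* (1 ℕ.+ k) → ¬ monic F f ∣ xPowMinusOne F l
          minimal l 1≤l l< f∣l = proj₂ (proj₂ f-prim) l 1≤l (≡.subst (l ℕ.<_) (sym register-order) l<)
            (toDefs-∣ {monic F f} {xPowMinusOne F l} f∣l)

          X≉0 : ¬ X ≈ₖ []
          X≉0 X≈0 = x₀≢𝟎 (begin
            x₀                                     ≡⟨ U.act-X^-minus-one (suc l) x₀ (U.∣⇒act-𝟎 {monic F f} (annihilates x₀) f∣) ⟨
            U.act (mulP F X (X Pow.^ l)) x₀        ≡⟨ U.act-mulP X (X Pow.^ l) x₀ ⟩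
            U.act X (U.act (X Pow.^ l) x₀)         ≡⟨ U.act-comm X (X Pow.^ l) x₀ ⟩
            U.act (X Pow.^ l) (U.act X x₀)         ≡⟨ cong (U.act (X Pow.^ l)) (action X≈0) ⟩
            U.act (X Pow.^ l) U.𝟎                  ≡⟨ U.act-𝟎 (X Pow.^ l) ⟩
            U.𝟎                                    ∎)
            where
            -- `exponent` and `1 ℕ.+ k` are both visibly successors, so `suc l` reduces to their
            -- product.
            l : ℕ
            l = ℕ.pred (exponent ℕ.* (1 ℕ.+ k))

          -- A coincidence gives X^d = 1 with d = Q^j - Q^i after cancelling. This d is positive
          -- and, since j is at most n, below Q^(n+1) - 1, the order of X.
          X-powers-distinct : ∀ {i j} → i ℕ.< j → j ℕ.< suc n →
            ¬ (X Pow.^ ((2 ℕ.+ k) ℕ.^ i)) ≈ₖ (X Pow.^ ((2 ℕ.+ k) ℕ.^ j))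
          X-powers-distinct {i} {j} i<j j<n eq = minimal d 1≤d d<E
            (act-𝟎⇒∣ (xPowMinusOne F d) (U.X^-minus-one-act d x₀ (trans (action X^d≈1) (U.act-oneP x₀))))
            where
            q : ℕ
            q = 2 ℕ.+ k
            d : ℕ
            d = q ℕ.^ j ∸ q ℕ.^ i
            qⁱ<qʲ : q ℕ.^ i ℕ.< q ℕ.^ j
            qⁱ<qʲ = ℕₚ.^-monoʳ-< q (ℕ.s≤s (ℕ.s≤s ℕ.z≤n)) i<j
            qʲ≡ : q ℕ.^ i ℕ.+ d ≡ q ℕ.^ j
            qʲ≡ = ℕₚ.m+[n∸m]≡n (ℕₚ.<⇒≤ qⁱ<qʲ)
            1≤d : 1 ℕ.≤ d
            1≤d = ℕₚ.m<n⇒0<n∸m qⁱ<qʲ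
            qʲ≤E : q ℕ.^ j ℕ.≤ exponent ℕ.* (1 ℕ.+ k)
            qʲ≤E = ℕₚ.≤-pred (≡.subst (q ℕ.^ j ℕ.<_)
              (trans (sym (geometric-sum k (suc n))) (trans (ℕₚ.+-comm _ 1) (cong suc (ℕₚ.*-comm (1 ℕ.+ k) exponent))))
              (ℕₚ.^-monoʳ-< q (ℕ.s≤s (ℕ.s≤s ℕ.z≤n)) j<n))
            d<E : d ℕ.< exponent ℕ.* (1 ℕ.+ k)
            d<E = ℕₚ.<-≤-trans (≡.subst (d ℕ.<_) qʲ≡ (ℕₚ.m<n+m d (ℕₚ.m^n>0 q i))) qʲ≤E
            X^d≈1 : (X Pow.^ d) ≈ₖ oneP F
            X^d≈1 = cancel {X Pow.^ d} {oneP F} {X Pow.^ (q ℕ.^ i)} (X-powers-nonzero X≉0 (q ℕ.^ i)) (by-action (begin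
              U.act (mulP F (X Pow.^ (q ℕ.^ i)) (X Pow.^ d)) x₀   ≡⟨ U.act-cong x₀ (Pow.^-homo-* X (q ℕ.^ i) d) ⟨
              U.act (X Pow.^ (q ℕ.^ i ℕ.+ d)) x₀                  ≡⟨ cong (λ l → U.act (X Pow.^ l) x₀) qʲ≡ ⟩
              U.act (X Pow.^ (q ℕ.^ j)) x₀                        ≡⟨ action eq ⟨
              U.act (X Pow.^ (q ℕ.^ i)) x₀                        ≡⟨ U.act-cong x₀ (P.*-identityʳ (X Pow.^ (q ℕ.^ i))) ⟨
              U.act (mulP F (X Pow.^ (q ℕ.^ i)) (oneP F)) x₀      ∎))

          -- An exponent l below Q - 1 for `b` would give the exponent E l for `f`, where E is the
          -- `exponent`, and E l is below E (Q - 1) = q^N - 1, against the primitivity of `f`.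
          primitive-block : Vec.head c ≡ sign n → Primitive F m (monic F b)
          primitive-block c₀≡sign = b-irr ,
            toDefs-∣ {monic F b} {xPowMinusOne F (FiniteField.size F ℕ.^ m ∸ 1)}
              (≡.subst (λ l → monic F b ∣ xPowMinusOne F l) (sym block-order)
                (order-⇐ c₀≡sign X-powers-distinct (1 ℕ.+ k) f∣)) ,
            λ l 1≤l l< b∣l → minimal (exponent ℕ.* l)
              (ℕₚ.*-mono-≤ {1} {exponent} {1} {l} (ℕ.s≤s ℕ.z≤n) 1≤l)
              (ℕₚ.*-monoʳ-< exponent (≡.subst (l ℕ.<_) block-order l<))
              (order-⇒ c₀≡sign X-powers-distinct l (fromDefs-∣ {monic F b} {xPowMinusOne F l} b∣l))

-- Normalisation of TSR matrices and the count.

module Bound (F : FiniteField) where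
  open FiniteField F using (size)
  open CommutativeRing (fieldRing F) hiding (zero; refl; sym; trans; _≈_)
  open ≡ using (refl; sym; trans; cong; cong₂)
  open ≡.≡-Reasoning
  open Polynomials F
  open Division F
  open Field F
  open Matrices F
  open Krylov F
  open Register F
  open NonzeroVectors F
  open PrimitiveTSR F
  private module P = CommutativeRing polyRing

  monic-primitive : ∀ {k} {f : Vec Carrier k} {p} → p ≈ monic F f → Primitive F k p → Primitive F k (monic F f)
  monic-primitive {k} {f} {p} p≈f (irr , p∣ , minimal) =
    monic-irreducible p≈f irr , transport {g = xPowMinusOne F (size ℕ.^ k ∸ 1)} p≈f p∣ ,
    λ l 1≤l l< f∣ → minimal l 1≤l l< (transport {g = xPowMinusOne F l} (P.sym p≈f) f∣)
    where
    transport : ∀ {p r g} → p ≈ r → _∣ₚ_ F p g → _∣ₚ_ F r g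
    transport {p} {r} {g} p≈r (s , ps≈g) =
      s , P.trans (P.*-congʳ {s} (P.sym p≈r)) (coefficientwise {mulP F p s} {g} ps≈g) .coeff-≡

  -- For the characteristic polynomial of the block to inherit primitivity, c₀ has to be ±1 with the sign of the norm.
  record NormalisedTSR (m n : ℕ) (T : Matrix Carrier (suc n ℕ.* m)) : Set where
    field
      rest        : Vec Carrier n
      block       : Matrix Carrier m
      T≡tsr       : T ≡ tsr F m (suc n) (sign n ∷ rest) block
      b           : Vec Carrier m
      block≈b     : charPoly F block ≈ monic F b
      irreducible : Irr F m b
      b-primitive : Primitive F (suc n ℕ.* m) (charPoly F T) → Prim F m b

  tsr-rescale : ∀ m n (c₀ : Carrier) (cs : Vec Carrier n) (B : Matrix Carrier m) → c₀ ≢ 0# →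
    ∃ λ rest → ∃ λ B′ → tsr F m (suc n) (c₀ ∷ cs) B ≡ tsr F m (suc n) (sign n ∷ rest) B′
  tsr-rescale m n c₀ cs B c₀≢0 = a ·ᵛ cs , Vec.map (a′ ·ᵛ_) B ,
    tsr-cong m (suc n) {c₀ ∷ cs} {sign n ∷ (a ·ᵛ cs)} {B} {Vec.map (a′ ·ᵛ_) B} entry
    where
    c₀⁻¹ = proj₁ (FiniteField.inverse F c₀ c₀≢0)
    a a′ : Carrier
    -- `a` moves c₀ to `sign n`, and `a′` is its inverse because `sign n` squares to 1; the products
    -- of coefficients and block entries are unchanged.
    a  = sign n * c₀⁻¹
    a′ = c₀ * sign n
    a*c₀ : a * c₀ ≡ sign n
    a*c₀ = trans (*-assoc (sign n) c₀⁻¹ c₀) (trans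
      (cong (sign n *_) (trans (*-comm c₀⁻¹ c₀) (proj₂ (FiniteField.inverse F c₀ c₀≢0)))) (*-identityʳ (sign n)))
    a*a′ : a * a′ ≡ 1#
    a*a′ = trans (sym (*-assoc a c₀ (sign n))) (trans (cong (_* sign n) a*c₀) (sign² n))
    scaled-entry : ∀ i p q → (a * lookup (c₀ ∷ cs) i) * entries (Vec.map (a′ ·ᵛ_) B) p q ≡ lookup (c₀ ∷ cs) i * entries B p q
    scaled-entry i p q = begin
      (a * x) * entries (Vec.map (a′ ·ᵛ_) B) p q
        ≡⟨ cong ((a * x) *_) (trans (cong (λ row → lookup row q) (Vecₚ.lookup-map p (a′ ·ᵛ_) B)) (Vecₚ.lookup-map q (a′ *_) (lookup B p))) ⟩
      (a * x) * (a′ * y)     ≡⟨ *-assoc a x (a′ * y) ⟩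
      a * (x * (a′ * y))     ≡⟨ cong (a *_) (trans (sym (*-assoc x a′ y)) (trans (cong (_* y) (*-comm x a′)) (*-assoc a′ x y))) ⟩
      a * (a′ * (x * y))     ≡⟨ *-assoc a a′ (x * y) ⟨
      (a * a′) * (x * y)     ≡⟨ trans (cong (_* (x * y)) a*a′) (*-identityˡ (x * y)) ⟩
      x * y                  ∎
      where
      x y : Carrier
      x = lookup (c₀ ∷ cs) i
      y = entries B p q
    entry : ∀ i p q → lookup (c₀ ∷ cs) i * entries B p q ≡ lookup (sign n ∷ (a ·ᵛ cs)) i * entries (Vec.map (a′ ·ᵛ_) B) p q
    entry zero    p q = trans (sym (scaled-entry zero p q)) (cong (_* entries (Vec.map (a′ ·ᵛ_) B) p q) a*c₀)
    entry (suc i) p q = trans (sym (scaled-entry (suc i) p q))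
      (cong (_* entries (Vec.map (a′ ·ᵛ_) B) p q) (sym (Vecₚ.lookup-map i (a *_) cs)))

  -- Irreducibility alone gives c₀ nonzero, hence the rescaling, and then the irreducible block.
  -- Primitivity of the block is kept conditional on that of T, so that one normalisation serves
  -- both bounds.
  normalise : ∀ m n → 1 ℕ.≤ m → 1 ℕ.< suc n ℕ.* m → ∀ T →
    IsTSR F m (suc n) T → Irreducible F (charPoly F T) → NormalisedTSR m n T
  normalise m n 1≤m 1<N T (c₀ ∷ cs , B , T≡) irr = record
    { rest = rest ; block = B′ ; T≡tsr = T≡′ ; b = b ; block≈b = B′≈b ; irreducible = b-irr
    ; b-primitive = λ T-prim → Blk.Order.primitive-block k size≡ (monic-primitive T≈f (≡.subst (λ T → Primitive F (suc n ℕ.* m) (charPoly F T)) T≡′ T-prim)) refl }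
    where
    e≢0 = unit-nonzero (Fin.fromℕ< 1≤m)
    c₀≢0 : c₀ ≢ 0#
    c₀≢0 = TSR.Irreducible-TSR.first-coefficient-nonzero m n (c₀ ∷ cs) B (proj₁ T-monic) (proj₂ T-monic)
      (monic-irreducible (proj₂ T-monic) (≡.subst (λ T → Irreducible F (charPoly F T)) T≡ irr)) 1<N e≢0
      where T-monic = charPoly-monic (tsr F m (suc n) (c₀ ∷ cs) B)
    rescaled = tsr-rescale m n c₀ cs B c₀≢0
    rest = proj₁ rescaled
    B′ = proj₁ (proj₂ rescaled)
    T≡′ : T ≡ tsr F m (suc n) (sign n ∷ rest) B′
    T≡′ = trans T≡ (proj₂ (proj₂ rescaled))
    f = proj₁ (charPoly-monic (tsr F m (suc n) (sign n ∷ rest) B′))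
    T≈f : charPoly F (tsr F m (suc n) (sign n ∷ rest) B′) ≈ monic F f
    T≈f = proj₂ (charPoly-monic (tsr F m (suc n) (sign n ∷ rest) B′))
    f-irr : Irreducible F (monic F f)
    f-irr = monic-irreducible T≈f (≡.subst (λ T → Irreducible F (charPoly F T)) T≡′ irr)
    b = proj₁ (charPoly-monic B′)
    B′≈b = proj₂ (charPoly-monic B′)
    b-irr : Irreducible F (monic F b)
    b-irr = TSR.Irreducible-TSR.irreducible-block m n (sign n ∷ rest) B′ f T≈f f-irr 1≤m b B′≈b
    module Blk = Block m n (sign n ∷ rest) B′ f T≈f f-irr b B′≈b b-irr e≢0
    k : ℕ
    -- No truncation takes place: a field has at least two elements and `m` is positive.
    k = size ℕ.^ m ∸ 2
    size≡ : size ℕ.^ m ≡ 2 ℕ.+ k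
    size≡ = sym (ℕₚ.m+[n∸m]≡n (ℕₚ.^-monoʳ-< size 2≤size 1≤m))

  tsr-functional : ∀ m n c {B B′ T T′} → B ≡ B′ → T ≡ tsr F m n c B → T′ ≡ tsr F m n c B′ → T ≡ T′
  tsr-functional m n c refl T≡ T′≡ = trans T≡ (sym T′≡)

  -- (T , v) is recorded by the Krylov matrix of its block at v, the characteristic polynomial of
  -- the block and the coefficients other than c₀.
  count-bound : ∀ m n (S : Vec Carrier m → Set) →
    (TS : List (Matrix Carrier (suc n ℕ.* m))) → Unique TS →
    (∀ {T} → T ∈ TS → Σ (NormalisedTSR m n T) λ normal → S (NormalisedTSR.b normal)) →
    (Ms : List (Matrix Carrier m)) → (∀ M → GL F m M → M ∈ Ms) →
    (bs : List (Vec Carrier m)) → (∀ b → S b → b ∈ bs) →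
    length TS ℕ.* (size ℕ.^ m ∸ 1) ℕ.≤ length Ms ℕ.* length bs ℕ.* size ℕ.^ n
  count-bound m n S TS TS-unique normal Ms Ms-complete bs bs-complete =
    ≡.subst₂ ℕ._≤_
      (trans (length-cartesianProductWith _,_ TS (nonzeroVectors m))
        (cong (length TS ℕ.*_) (cong (_∸ 1) (length-nonzeroVectors m))))
      (trans (length-cartesianProductWith _,_ (List.cartesianProduct Ms bs) (vectors n))
        (cong₂ ℕ._*_ (length-cartesianProductWith _,_ Ms bs) (length-vectors n)))
      (length-≤ Encodes (λ {x} {x′} {y} → Encodes-injective {x} {x′} {y})
        {List.cartesianProduct TS (nonzeroVectors m)} {List.cartesianProduct (List.cartesianProduct Ms bs) (vectors n)}
        (Uniqueₚ.cartesianProduct⁺ TS-unique (nonzeroVectors-unique m)) encode)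
    where
    Encodes : Matrix Carrier (suc n ℕ.* m) × Vec Carrier m →
      (Matrix Carrier m × Vec Carrier m) × Vec Carrier n → Set
    Encodes (T , v) ((M , b) , rest) = ∃ λ B → T ≡ tsr F m (suc n) (sign n ∷ rest) B ×
      charPoly F B ≈ monic F b × Irr F m b × v ≢ 0ᵛ × M ≡ krylov B v
    Encodes-injective : ∀ {x x′ y} → Encodes x y → Encodes x′ y → x ≡ x′
    Encodes-injective {T , v} {T′ , v′} {(M , b) , rest} (B , T≡ , B≈b , irr , v≢0 , M≡) (B′ , T′≡ , B′≈b , _ , _ , M≡′) =
      -- The shared `b` is the characteristic polynomial of both blocks, so the shared Krylov matrix
      -- identifies blocks and vectors; the shared `rest` then identifies the TSR matrices.
      let B≡B′ , v≡v′ = krylov-injective b irr B B′ B≈b B′≈b v v′ v≢0 (trans (sym M≡) M≡′) in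
      cong₂ _,_ (tsr-functional m (suc n) (sign n ∷ rest) B≡B′ T≡ T′≡) v≡v′
    encode : ∀ {x} → x ∈ List.cartesianProduct TS (nonzeroVectors m) →
      ∃ λ y → y ∈ List.cartesianProduct (List.cartesianProduct Ms bs) (vectors n) × Encodes x y
    encode {T , v} x∈ = ((krylov N.block v , N.b) , N.rest) ,
      ∈ₚ.∈-cartesianProduct⁺ (∈ₚ.∈-cartesianProduct⁺
        (Ms-complete (krylov N.block v) (Irreducible-matrix.krylov-GL N.block N.b N.block≈b N.irreducible v≢0))
        (bs-complete N.b (proj₂ (normal T∈)))) (∈-vectors N.rest) ,
      (N.block , N.T≡tsr , N.block≈b , N.irreducible , v≢0 , refl)
      where
      T∈ : T ∈ TS
      T∈ = proj₁ (∈ₚ.∈-cartesianProduct⁻ TS (nonzeroVectors m) x∈)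
      v≢0 : v ≢ 0ᵛ
      v≢0 = nonzeroVectors-nonzero (proj₂ (∈ₚ.∈-cartesianProduct⁻ TS (nonzeroVectors m) x∈))
      module N = NormalisedTSR (proj₁ (normal T∈))

open import Data.Nat using (_≤_; _<_; _*_; _^_; _⊔_)

-- The larger of the two factors exceeds 1 by itself, and the other is at least 1.
1<product : ∀ m n → 1 ≤ m → 1 ≤ n → 1 < m ⊔ n → 1 < n * m
1<product m n 1≤m 1≤n 1<m⊔n with ℕₚ.⊔-sel m n
... | inj₁ eq = ℕₚ.≤-trans (≡.subst (1 <_) eq 1<m⊔n) (ℕₚ.≤-trans (ℕₚ.≤-reflexive (≡.sym (ℕₚ.*-identityˡ m))) (ℕₚ.*-monoˡ-≤ m 1≤n))
... | inj₂ eq = ℕₚ.≤-trans (≡.subst (1 <_) eq 1<m⊔n) (ℕₚ.≤-trans (ℕₚ.≤-reflexive (≡.sym (ℕₚ.*-identityʳ n))) (ℕₚ.*-monoʳ-≤ n 1≤m))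

theorem6p1 : (F : FiniteField) (m n : ℕ) → 1 ≤ m → 1 ≤ n → 1 < m ⊔ n →
    (g i p t s : ℕ) →
    Card (GL F m) g → Card (Irr F m) i → Card (Prim F m) p →
    Card (TSRI F m n) t → Card (TSRP F m n) s →
    (t * (FiniteField.size F ^ m ∸ 1) ≤ g * i * FiniteField.size F ^ (n ∸ 1))
    × (s * (FiniteField.size F ^ m ∸ 1) ≤ g * p * FiniteField.size F ^ (n ∸ 1))
theorem6p1 F m (suc n) 1≤m 1≤n 1<m⊔n _ _ _ _ _
  (Ms , _ , _ , Ms-complete , ≡.refl) (is , _ , _ , is-complete , ≡.refl) (ps , _ , _ , ps-complete , ≡.refl)
  (TI , TI-unique , TI-all , _ , ≡.refl) (TP , TP-unique , TP-all , _ , ≡.refl) =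
  count-bound m n (Irr F m) TI TI-unique
    (λ T∈ → let tsr , irr = All.lookup TI-all T∈
                normal = normalise m n 1≤m 1<N _ tsr irr in
      normal , NormalisedTSR.irreducible normal)
    Ms Ms-complete is is-complete ,
  count-bound m n (Prim F m) TP TP-unique
    (λ T∈ → let tsr , prim = All.lookup TP-all T∈
                normal = normalise m n 1≤m 1<N _ tsr (proj₁ prim) in
      normal , NormalisedTSR.b-primitive normal prim)
    Ms Ms-complete ps ps-complete
  where
  open Bound F
  1<N : 1 < suc n * m
  1<N = 1<product m (suc n) 1≤m 1≤n 1<m⊔n
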